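{- Let $k\ge 3$ be an integer, let $\beta>\frac{2(k-1)}{k}$ be a real number, and let $q(n):=\sqrt[k-1]{(k-1)\,\beta^{k-2}\,n^{k-2}}$ for $n\in\mathbb{N}$. Then there exists $N\in\mathbb{N}$ such that for all $n>N$ Breaker has a winning strategy in the Maker-Breaker $C_k$-game with bias $q(n)$ on $K_n$.
   Context: $C_k$ denotes the cycle of length $k$. The Maker-Breaker $C_k$-game with bias $q$ on the complete graph $K_n$ is played as follows. All edges of $K_n$ are initially unclaimed. In each turn first Maker claims exactly one unclaimed edge, then Breaker claims at most $q$ unclaimed edges (at least one, if any is left); for real $q$ this means at most $\lfloor q\rfloor$ edges. The game ends when all edges are claimed. Maker wins if the graph formed by Maker's edges contains a copy of $C_k$ (a not necessarily induced subgraph isomorphic to $C_k$) at the end; otherwise Breaker wins. It is a perfect information game. -}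

module Defs where

import Algebra.Definitions.RawSemiring
import Algebra.Properties.Group
open import Data.Fin using (Fin; toℕ)
import Data.Fin as Fin
open import Data.Integer using (+[1+_])
import Data.Integer as ℤ
import Data.Integer.Properties as ℤP
open import Data.List using (List; []; _∷_; length; map; concatMap)
open import Data.List.Membership.Propositional using (_∈_)
open import Data.List.Relation.Unary.All using (All)
open import Data.List.Relation.Unary.Unique.Propositional using (Unique)
open import Data.Nat using (ℕ; zero; suc; _∸_)
import Data.Nat as ℕ
import Data.Nat.Properties as ℕP
open import Data.Product using (Σ; ∃; ∃-syntax; _×_; _,_; proj₁; proj₂)
open import Data.Rational using (ℚ; mkℚ; 0ℚ; 1ℚ; ½; _+_; _*_; _-_; -_; _/_; _⊔_; ∣_∣; 1/_;
  _≤_; _<_; Positive; NonNegative; NonZero; positive; nonNegative; toℚᵘ)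
open import Data.Rational.Base using (+-*-rawSemiring)
import Data.Rational.Unnormalised as ℚᵘ
import Data.Rational.Unnormalised.Properties as ℚᵘP
open import Data.Rational.Properties
open import Data.Sum using (_⊎_; inj₁; inj₂)
open import Function.Definitions using (Injective)
open import Level using (0ℓ)
open import Relation.Binary.Core using (Rel)
open import Relation.Binary.PropositionalEquality using (_≡_; _≢_; refl; sym; trans; cong; cong₂; subst)
open import Relation.Nullary using (¬_; yes; no; contradiction)

open Algebra.Definitions.RawSemiring +-*-rawSemiring using (_^_)
open Algebra.Properties.Group +-0-group using (⁻¹-involutive)

-- Real numbers: Cauchy sequences of rationals, compared up to _≈ᴿ_.

record ℝ : Set where
  constructor mkℝ
  field
    seq    : ℕ → ℚ
    cauchy : ∀ ε → 0ℚ < ε → ∃[ N ] (∀ m n → N ℕ.≤ m → N ℕ.≤ n → ∣ seq m - seq n ∣ ≤ ε)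

open ℝ public

infix 4 _≈ᴿ_ _≤ᴿ_ _<ᴿ_

_≈ᴿ_ : Rel ℝ 0ℓ
x ≈ᴿ y = ∀ ε → 0ℚ < ε → ∃[ N ] (∀ n → N ℕ.≤ n → ∣ seq x n - seq y n ∣ ≤ ε)

_≤ᴿ_ : Rel ℝ 0ℓ
x ≤ᴿ y = ∀ ε → 0ℚ < ε → ∃[ N ] (∀ n → N ℕ.≤ n → seq x n ≤ seq y n + ε)

_<ᴿ_ : Rel ℝ 0ℓ
x <ᴿ y = ∃[ ε ] (0ℚ < ε × ∃[ N ] (∀ n → N ℕ.≤ n → seq x n + ε ≤ seq y n))

+-sub : ∀ b e → b + e - b ≡ e
+-sub b e = trans (cong (_- b) (+-comm b e)) (trans (+-assoc e b (- b))
  (trans (cong (e +_) (+-inverseʳ b)) (+-identityʳ e)))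

b+a-b : ∀ a b → a ≡ b + (a - b)
b+a-b a b = sym (trans (sym (+-assoc b a (- b))) (+-sub b a))

telescope : ∀ a b c → a - c ≡ (a - b) + (b - c)
telescope a b c = trans (cong (_- c) (trans (b+a-b a b) (+-comm b (a - b)))) (+-assoc (a - b) b (- c))

*-distribˡ-sub : ∀ a b c → a * (b - c) ≡ a * b - a * c
*-distribˡ-sub a b c = trans (*-distribˡ-+ a b (- c)) (cong (a * b +_) (sym (neg-distribʳ-* a c)))

p≤∣p∣ : ∀ p → p ≤ ∣ p ∣
p≤∣p∣ p with ≤-total 0ℚ p
... | inj₁ 0≤p = ≤-reflexive (sym (0≤p⇒∣p∣≡p 0≤p))
... | inj₂ p≤0 = ≤-trans p≤0 (0≤∣p∣ p)

∣a-b∣≤ε⇒a≤b+ε : ∀ a b {ε} → ∣ a - b ∣ ≤ ε → a ≤ b + ε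
∣a-b∣≤ε⇒a≤b+ε a b {ε} h = begin
  a            ≡⟨ b+a-b a b ⟩
  b + (a - b)  ≤⟨ +-monoʳ-≤ b (≤-trans (p≤∣p∣ (a - b)) h) ⟩
  b + ε        ∎
  where open ≤-Reasoning

a≤b+ε⇒a-b≤ε : ∀ a b {ε} → a ≤ b + ε → a - b ≤ ε
a≤b+ε⇒a-b≤ε a b {ε} h = begin
  a - b        ≤⟨ +-monoˡ-≤ (- b) h ⟩
  b + ε - b    ≡⟨ +-sub b ε ⟩
  ε            ∎
  where open ≤-Reasoning

neg-sub : ∀ a b → - (a - b) ≡ b - a
neg-sub a b = trans (neg-distrib-+ a (- b)) (trans (cong (- a +_) (⁻¹-involutive b)) (+-comm (- a) b))

∣a-b∣-sym : ∀ a b → ∣ a - b ∣ ≡ ∣ b - a ∣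
∣a-b∣-sym a b = trans (sym (∣-p∣≡∣p∣ (a - b))) (cong ∣_∣ (neg-sub a b))

∣a-b∣≤ε : ∀ a b {ε} → a ≤ b + ε → b ≤ a + ε → ∣ a - b ∣ ≤ ε
∣a-b∣≤ε a b {ε} h₁ h₂ with ∣p∣≡p∨∣p∣≡-p (a - b)
... | inj₁ eq = subst (_≤ ε) (sym eq) (a≤b+ε⇒a-b≤ε a b h₁)
... | inj₂ eq = subst (_≤ ε) (sym (trans eq (neg-sub a b))) (a≤b+ε⇒a-b≤ε b a h₂)

*-mono-≤₀ : ∀ {a b c d} → 0ℚ ≤ a → 0ℚ ≤ d → a ≤ b → c ≤ d → a * c ≤ b * d
*-mono-≤₀ {a} {b} {c} {d} 0≤a 0≤d a≤b c≤d = ≤-trans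
  (*-monoˡ-≤-nonNeg a {{nonNegative 0≤a}} c≤d)
  (*-monoʳ-≤-nonNeg d {{nonNegative 0≤d}} a≤b)

0≤* : ∀ {a b} → 0ℚ ≤ a → 0ℚ ≤ b → 0ℚ ≤ a * b
0≤* {a} {b} 0≤a 0≤b = subst (_≤ a * b) (*-zeroˡ b) (*-monoʳ-≤-nonNeg b {{nonNegative 0≤b}} 0≤a)

0<* : ∀ {a b} → 0ℚ < a → 0ℚ < b → 0ℚ < a * b
0<* {a} {b} 0<a 0<b = subst (_< a * b) (*-zeroˡ b) (*-monoˡ-<-pos b {{positive 0<b}} 0<a)

0≤+ : ∀ {a b} → 0ℚ ≤ a → 0ℚ ≤ b → 0ℚ ≤ a + b
0≤+ {a} {b} 0≤a 0≤b = ≤-trans (≤-reflexive (sym (+-identityˡ 0ℚ))) (+-mono-≤ 0≤a 0≤b)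

≤+ : ∀ {a b} → 0ℚ ≤ b → a ≤ a + b
≤+ {a} {b} 0≤b = subst (_≤ a + b) (+-identityʳ a) (+-monoʳ-≤ a 0≤b)

0<1 : 0ℚ < 1ℚ
0<1 = positive⁻¹ 1ℚ

*-close : ∀ {a b c d B C η} → 0ℚ ≤ η → ∣ a ∣ ≤ B → ∣ d ∣ ≤ C →
          ∣ a - c ∣ ≤ η → ∣ b - d ∣ ≤ η → ∣ a * b - c * d ∣ ≤ (B + C) * η
*-close {a} {b} {c} {d} {B} {C} {η} 0≤η a≤B d≤C ac bd = begin
  ∣ a * b - c * d ∣                  ≡⟨ cong ∣_∣ split ⟩
  ∣ a * (b - d) + d * (a - c) ∣      ≤⟨ ∣p+q∣≤∣p∣+∣q∣ (a * (b - d)) (d * (a - c)) ⟩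
  ∣ a * (b - d) ∣ + ∣ d * (a - c) ∣  ≡⟨ cong₂ _+_ (∣p*q∣≡∣p∣*∣q∣ a (b - d)) (∣p*q∣≡∣p∣*∣q∣ d (a - c)) ⟩
  ∣ a ∣ * ∣ b - d ∣ + ∣ d ∣ * ∣ a - c ∣
    ≤⟨ +-mono-≤ (*-mono-≤₀ (0≤∣p∣ a) 0≤η a≤B bd) (*-mono-≤₀ (0≤∣p∣ d) 0≤η d≤C ac) ⟩
  B * η + C * η                      ≡⟨ sym (*-distribʳ-+ η B C) ⟩
  (B + C) * η                        ∎
  where
  open ≤-Reasoning
  split : a * b - c * d ≡ a * (b - d) + d * (a - c)
  split = trans (telescope (a * b) (a * d) (c * d)) (cong₂ _+_ (sym (*-distribˡ-sub a b d))
    (trans (cong₂ _-_ (*-comm a d) (*-comm c d)) (sym (*-distribˡ-sub d a c))))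

shrink : ∀ {K ε} → 0ℚ < K → 0ℚ < ε → ∃[ η ] (0ℚ < η × K * η ≡ ε)
shrink {K} {ε} 0<K 0<ε = η , 0<* 0<ε (positive⁻¹ _ {{1/pos⇒pos K}}) , eq
  where
  instance
    K⁺ : Positive K
    K⁺ = positive 0<K
    K≢0 : NonZero K
    K≢0 = pos⇒nonZero K
  η : ℚ
  η = ε * (1/ K)
  eq : K * η ≡ ε
  eq = trans (cong (K *_) (*-comm ε (1/ K)))
      (trans (sym (*-assoc K (1/ K) ε))
      (trans (cong (_* ε) (*-inverseʳ K)) (*-identityˡ ε)))

halve : ∀ {ε} → 0ℚ < ε → ∃[ h ] (0ℚ < h × h + h ≡ ε)
halve {ε} 0<ε = ½ * ε , 0<* (positive⁻¹ ½) 0<ε , trans (sym (*-distribʳ-+ ε ½ ½)) (*-identityˡ ε)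

eventuallyBounded : ∀ x → ∃[ B ] (0ℚ < B × ∃[ N ] (∀ n → N ℕ.≤ n → ∣ seq x n ∣ ≤ B))
eventuallyBounded x with cauchy x 1ℚ 0<1
... | N , close = ∣ seq x N ∣ + 1ℚ
  , <-≤-trans 0<1 (subst (1ℚ ≤_) (+-comm 1ℚ ∣ seq x N ∣) (≤+ (0≤∣p∣ (seq x N))))
  , N , λ n N≤n → begin
    ∣ seq x n ∣                          ≡⟨ cong ∣_∣ (b+a-b (seq x n) (seq x N)) ⟩
    ∣ seq x N + (seq x n - seq x N) ∣    ≤⟨ ∣p+q∣≤∣p∣+∣q∣ (seq x N) (seq x n - seq x N) ⟩
    ∣ seq x N ∣ + ∣ seq x n - seq x N ∣  ≤⟨ +-monoʳ-≤ ∣ seq x N ∣ (close n N N≤n ℕP.≤-refl) ⟩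
    ∣ seq x N ∣ + 1ℚ                     ∎
  where open ≤-Reasoning

fromℚ : ℚ → ℝ
fromℚ p = mkℝ (λ _ → p) λ ε 0<ε → 0 , λ _ _ _ _ →
  subst (λ r → ∣ r ∣ ≤ ε) (sym (+-inverseʳ p)) (<⇒≤ 0<ε)

fromℕ : ℕ → ℝ
fromℕ n = fromℚ (ℤ.+ n / 1)

infixl 7 _*ᴿ_
infixr 8 _^ᴿ_

_*ᴿ_ : ℝ → ℝ → ℝ
x *ᴿ y = mkℝ (λ n → seq x n * seq y n) cauchy*
  where
  cauchy* : ∀ ε → 0ℚ < ε → ∃[ N ] (∀ m n → N ℕ.≤ m → N ℕ.≤ n →
            ∣ seq x m * seq y m - seq x n * seq y n ∣ ≤ ε)
  cauchy* ε 0<ε with eventuallyBounded x | eventuallyBounded y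
  ... | B , 0<B , N₁ , x≤B | C , 0<C , N₂ , y≤C
    with shrink (<-≤-trans 0<B (≤+ (<⇒≤ 0<C))) 0<ε
  ... | η , 0<η , eq with cauchy x η 0<η | cauchy y η 0<η
  ... | N₃ , cx | N₄ , cy = N₁₂ ℕ.⊔ N₃₄ , λ m n hm hn → subst (_ ≤_) eq
    (*-close (<⇒≤ 0<η)
      (x≤B m (ℕP.m⊔n≤o⇒m≤o N₁ N₂ (ℕP.m⊔n≤o⇒m≤o N₁₂ N₃₄ hm)))
      (y≤C n (ℕP.m⊔n≤o⇒n≤o N₁ N₂ (ℕP.m⊔n≤o⇒m≤o N₁₂ N₃₄ hn)))
      (cx m n (ℕP.m⊔n≤o⇒m≤o N₃ N₄ (ℕP.m⊔n≤o⇒n≤o N₁₂ N₃₄ hm))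
              (ℕP.m⊔n≤o⇒m≤o N₃ N₄ (ℕP.m⊔n≤o⇒n≤o N₁₂ N₃₄ hn)))
      (cy m n (ℕP.m⊔n≤o⇒n≤o N₃ N₄ (ℕP.m⊔n≤o⇒n≤o N₁₂ N₃₄ hm))
              (ℕP.m⊔n≤o⇒n≤o N₃ N₄ (ℕP.m⊔n≤o⇒n≤o N₁₂ N₃₄ hn))))
    where
    N₁₂ = N₁ ℕ.⊔ N₂
    N₃₄ = N₃ ℕ.⊔ N₄

_^ᴿ_ : ℝ → ℕ → ℝ
x ^ᴿ zero  = fromℚ 1ℚ
x ^ᴿ suc n = x *ᴿ x ^ᴿ n

^-nonNeg : ∀ {a} d → 0ℚ ≤ a → 0ℚ ≤ a ^ d
^-nonNeg zero    0≤a = <⇒≤ 0<1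
^-nonNeg (suc d) 0≤a = 0≤* 0≤a (^-nonNeg d 0≤a)

^-pos : ∀ {a} d → 0ℚ < a → 0ℚ < a ^ d
^-pos zero    0<a = 0<1
^-pos (suc d) 0<a = 0<* 0<a (^-pos d 0<a)

^-mono-≤ : ∀ {a b} d → 0ℚ ≤ a → a ≤ b → a ^ d ≤ b ^ d
^-mono-≤ zero    0≤a a≤b = ≤-refl
^-mono-≤ (suc d) 0≤a a≤b =
  *-mono-≤₀ 0≤a (^-nonNeg d (≤-trans 0≤a a≤b)) a≤b (^-mono-≤ d 0≤a a≤b)

1≤^ : ∀ {a} d → 1ℚ ≤ a → 1ℚ ≤ a ^ d
1≤^ zero    1≤a = ≤-refl
1≤^ (suc d) 1≤a = ≤-trans (≤-reflexive (sym (*-identityˡ 1ℚ)))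
  (*-mono-≤₀ (<⇒≤ 0<1) (^-nonNeg d (≤-trans (<⇒≤ 0<1) 1≤a)) 1≤a (1≤^ d 1≤a))

^-superadditive : ∀ {a b} d → 0ℚ ≤ a → 0ℚ ≤ b → a ^ suc d + b ^ suc d ≤ (a + b) ^ suc d
^-superadditive {a} {b} d 0≤a 0≤b = begin
  a * a ^ d + b * b ^ d
    ≤⟨ +-mono-≤ (*-monoˡ-≤-nonNeg a {{nonNegative 0≤a}} (^-mono-≤ d 0≤a (≤+ 0≤b)))
                (*-monoˡ-≤-nonNeg b {{nonNegative 0≤b}} (^-mono-≤ d 0≤b b≤a+b)) ⟩
  a * (a + b) ^ d + b * (a + b) ^ d  ≡⟨ sym (*-distribʳ-+ ((a + b) ^ d) a b) ⟩
  (a + b) * (a + b) ^ d              ∎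
  where
  open ≤-Reasoning
  b≤a+b : b ≤ a + b
  b≤a+b = subst (b ≤_) (+-comm b a) (≤+ 0≤a)

^-close : ∀ B d ε → 0ℚ < B → 0ℚ < ε → ∃[ η ] (0ℚ < η × (∀ a b → 0ℚ ≤ a → 0ℚ ≤ b → a ≤ B → b ≤ B →
          ∣ a - b ∣ ≤ η → ∣ a ^ d - b ^ d ∣ ≤ ε))
^-close B zero    ε 0<B 0<ε = 1ℚ , 0<1 , λ _ _ _ _ _ _ _ → <⇒≤ 0<ε
^-close B (suc d) ε 0<B 0<ε
  with shrink (<-≤-trans 0<B (≤+ (^-nonNeg d (<⇒≤ 0<B)))) 0<ε
... | η , 0<η , eq with ^-close B d η 0<B 0<η
... | η′ , 0<η′ , close = η″ , 0<η″ , λ a b 0≤a 0≤b a≤B b≤B h → subst (_ ≤_) eq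
    (*-close (<⇒≤ 0<η)
      (subst (_≤ B) (sym (0≤p⇒∣p∣≡p 0≤a)) a≤B)
      (subst (_≤ B ^ d) (sym (0≤p⇒∣p∣≡p (^-nonNeg d 0≤b))) (^-mono-≤ d 0≤b b≤B))
      (≤-trans h (p⊓q≤p η η′))
      (close a b 0≤a 0≤b a≤B b≤B (≤-trans h (p⊓q≤q η η′))))
  where
  open Data.Rational using (_⊓_)
  η″ : ℚ
  η″ = η ⊓ η′
  0<η″ : 0ℚ < η″
  0<η″ with ⊓-sel η η′
  ... | inj₁ e = subst (0ℚ <_) (sym e) 0<η
  ... | inj₂ e = subst (0ℚ <_) (sym e) 0<η′

mesh : ℕ → ℚ
mesh j = ℤ.+ 1 / suc j

infixr 7 _×ℚ_

_×ℚ_ : ℕ → ℚ → ℚ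
zero  ×ℚ δ = 0ℚ
suc m ×ℚ δ = m ×ℚ δ + δ

×ℚ-nonNeg : ∀ m {δ} → 0ℚ < δ → 0ℚ ≤ m ×ℚ δ
×ℚ-nonNeg zero    0<δ = ≤-refl
×ℚ-nonNeg (suc m) 0<δ = 0≤+ (×ℚ-nonNeg m 0<δ) (<⇒≤ 0<δ)

×ℚ-scale : ∀ m δ → δ * (m ×ℚ 1ℚ) ≡ m ×ℚ δ
×ℚ-scale zero    δ = *-zeroʳ δ
×ℚ-scale (suc m) δ = trans (*-distribˡ-+ δ (m ×ℚ 1ℚ) 1ℚ) (cong₂ _+_ (×ℚ-scale m δ) (*-identityʳ δ))

toℚᵘ-×ℚ1 : ∀ m → toℚᵘ (m ×ℚ 1ℚ) ℚᵘ.≃ ℚᵘ.mkℚᵘ (ℤ.+ m) 0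
toℚᵘ-×ℚ1 zero    = ℚᵘP.≃-refl
toℚᵘ-×ℚ1 (suc m) = ℚᵘP.≃-trans (toℚᵘ-homo-+ (m ×ℚ 1ℚ) 1ℚ)
  (ℚᵘP.≃-trans (ℚᵘP.+-congˡ (toℚᵘ 1ℚ) (toℚᵘ-×ℚ1 m)) (ℚᵘ.*≡* (cong (ℤ._* ℤ.+ 1) eq)))
  where
  eq : ℤ.+ m ℤ.* ℤ.+ 1 ℤ.+ ℤ.+ 1 ≡ ℤ.+ suc m
  eq = trans (cong (ℤ._+ ℤ.+ 1) (ℤP.*-identityʳ (ℤ.+ m))) (cong ℤ.+_ (ℕP.+-comm m 1))

<-natural : ∀ s → ∃[ m ] s < m ×ℚ 1ℚ
<-natural s@(mkℚ a b _) = m , toℚᵘ-cancel-< (ℚᵘP.<-respʳ-≃ (ℚᵘP.≃-sym (toℚᵘ-×ℚ1 m)) (ℚᵘ.*<* lt))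
  where
  open ℤP.≤-Reasoning
  m : ℕ
  m = suc ℤ.∣ a ∣
  i≤∣i∣ : ∀ i → i ℤ.≤ ℤ.+ ℤ.∣ i ∣
  i≤∣i∣ (ℤ.+ n)      = ℤP.≤-refl
  i≤∣i∣ ℤ.-[1+ n ]   = ℤ.-≤+
  lt : a ℤ.* ℤ.+ 1 ℤ.< ℤ.+ m ℤ.* ℤ.+ suc b
  lt = begin-strict
    a ℤ.* ℤ.+ 1           ≡⟨ ℤP.*-identityʳ a ⟩
    a                     ≤⟨ i≤∣i∣ a ⟩
    ℤ.+ ℤ.∣ a ∣           <⟨ ℤ.+<+ (ℕP.n<1+n ℤ.∣ a ∣) ⟩
    ℤ.+ m                 ≤⟨ ℤ.+≤+ (ℕP.m≤m*n m (suc b)) ⟩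
    ℤ.+ (m ℕ.* suc b)     ≡⟨ ℤP.pos-* m (suc b) ⟩
    ℤ.+ m ℤ.* ℤ.+ suc b   ∎

archimedean : ∀ {δ} t → 0ℚ < δ → ∃[ m ] t < m ×ℚ δ
archimedean {δ} t 0<δ with <-natural (t * (1/ δ) {{pos⇒nonZero δ {{positive 0<δ}}}})
... | m , lt = m , (begin-strict
    t                       ≡⟨ sym (*-identityʳ t) ⟩
    t * 1ℚ                  ≡⟨ cong (t *_) (sym (*-inverseˡ δ)) ⟩
    t * ((1/ δ) * δ)        ≡⟨ sym (*-assoc t (1/ δ) δ) ⟩
    t * (1/ δ) * δ          <⟨ *-monoˡ-<-pos δ lt ⟩
    (m ×ℚ 1ℚ) * δ           ≡⟨ *-comm (m ×ℚ 1ℚ) δ ⟩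
    δ * (m ×ℚ 1ℚ)           ≡⟨ ×ℚ-scale m δ ⟩
    m ×ℚ δ                  ∎)
  where
  open ≤-Reasoning
  instance
    δ⁺ : Positive δ
    δ⁺ = positive 0<δ
    δ≢0 : NonZero δ
    δ≢0 = pos⇒nonZero δ

0<mesh : ∀ j → 0ℚ < mesh j
0<mesh j = positive⁻¹ (mesh j) {{normalize-pos 1 (suc j)}}

mesh-small : ∀ ε → 0ℚ < ε → ∃[ N ] (∀ j → N ℕ.≤ j → mesh j ≤ ε)
mesh-small (mkℚ +[1+ p ] q _) 0<ε = q , λ j q≤j →
  toℚᵘ-cancel-≤ (ℚᵘP.≤-respˡ-≃ (ℚᵘP.≃-sym (toℚᵘ-fromℚᵘ (ℚᵘ.mkℚᵘ (ℤ.+ 1) j))) (ℚᵘ.*≤* (begin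
    ℤ.+ 1 ℤ.* ℤ.+ suc q          ≡⟨ ℤP.*-identityˡ (ℤ.+ suc q) ⟩
    ℤ.+ suc q                    ≤⟨ ℤ.+≤+ (ℕ.s≤s q≤j) ⟩
    ℤ.+ suc j                    ≤⟨ ℤ.+≤+ (ℕP.m≤n*m (suc j) (suc p)) ⟩
    ℤ.+ (suc p ℕ.* suc j)        ≡⟨ ℤP.pos-* (suc p) (suc j) ⟩
    ℤ.+ suc p ℤ.* ℤ.+ suc j      ∎)))
  where open ℤP.≤-Reasoning
mesh-small (mkℚ (ℤ.+ 0) _ _)      0<ε = contradiction (positive 0<ε) λ ()
mesh-small (mkℚ ℤ.-[1+ _ ] _ _)   0<ε = contradiction (positive 0<ε) λ ()

record RootApprox (d : ℕ) (t δ : ℚ) : Set where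
  field
    value  : ℚ
    nonNeg : 0ℚ ≤ value
    below  : value ^ suc d ≤ t
    above  : t < (value + δ) ^ suc d

open RootApprox

rootApprox : ∀ d t δ → 0ℚ ≤ t → 0ℚ < δ → RootApprox d t δ
rootApprox d t δ 0≤t 0<δ with archimedean (t + 1ℚ) 0<δ
... | m₀ , lt = search m₀ t<z^
  where
  open ≤-Reasoning
  z : ℚ
  z = m₀ ×ℚ δ
  0≤z : 0ℚ ≤ z
  0≤z = ×ℚ-nonNeg m₀ 0<δ
  1≤z : 1ℚ ≤ z
  1≤z = ≤-trans (≤+ 0≤t) (≤-trans (≤-reflexive (+-comm 1ℚ t)) (<⇒≤ lt))
  t<z^ : t < z ^ suc d
  t<z^ = begin-strict
    t          ≤⟨ ≤+ (<⇒≤ 0<1) ⟩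
    t + 1ℚ     <⟨ lt ⟩
    z          ≡⟨ sym (*-identityʳ z) ⟩
    z * 1ℚ     ≤⟨ *-monoˡ-≤-nonNeg z {{nonNegative 0≤z}} (1≤^ d 1≤z) ⟩
    z * z ^ d  ∎
  search : ∀ m → t < (m ×ℚ δ) ^ suc d → RootApprox d t δ
  search zero    h = contradiction (<-≤-trans h (≤-trans (≤-reflexive (*-zeroˡ (0ℚ ^ d))) 0≤t)) (<-irrefl refl)
  search (suc m) h with t <? (m ×ℚ δ) ^ suc d
  ... | yes h′ = search m h′
  ... | no ¬h′ = record { value = m ×ℚ δ ; nonNeg = ×ℚ-nonNeg m 0<δ ; below = ≮⇒≥ ¬h′ ; above = h }

0≤⊔0 : ∀ p → 0ℚ ≤ p ⊔ 0ℚ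
0≤⊔0 p = p≤q⊔p p 0ℚ

⊔0-close : ∀ {p q η} → 0ℚ ≤ η → p ≤ q + η → p ⊔ 0ℚ ≤ q ⊔ 0ℚ + η
⊔0-close {p} {q} {η} 0≤η h = ⊔-lub (≤-trans h (+-monoˡ-≤ η (p≤p⊔q q 0ℚ))) (0≤+ (0≤⊔0 q) 0≤η)

rootApproxᴿ : ∀ d x j → RootApprox d (seq x j ⊔ 0ℚ) (mesh j)
rootApproxᴿ d x j = rootApprox d (seq x j ⊔ 0ℚ) (mesh j) (0≤⊔0 (seq x j)) (0<mesh j)

rootApprox-close : ∀ {d s t δ δ′ h} (a : RootApprox d s δ) (b : RootApprox d t δ′) →
                   0ℚ ≤ h → δ′ ≤ h → 0ℚ ≤ δ′ → s ≤ t + h ^ suc d → value a ≤ value b + (h + h)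
rootApprox-close {d} {s} {t} {δ} {δ′} {h} a b 0≤h δ′≤h 0≤δ′ s≤t+ with value a ≤? value b + (h + h)
... | yes p = p
... | no ¬p = contradiction bad (<-irrefl refl)
  where
  open ≤-Reasoning
  bad : s < s
  bad = begin-strict
    s                                        ≤⟨ s≤t+ ⟩
    t + h ^ suc d                            <⟨ +-monoˡ-< (h ^ suc d) (above b) ⟩
    (value b + δ′) ^ suc d + h ^ suc d       ≤⟨ ^-superadditive d (0≤+ (nonNeg b) 0≤δ′) 0≤h ⟩
    (value b + δ′ + h) ^ suc d
      ≤⟨ ^-mono-≤ (suc d) (0≤+ (0≤+ (nonNeg b) 0≤δ′) 0≤h)
           (≤-trans (≤-reflexive (+-assoc (value b) δ′ h)) (+-monoʳ-≤ (value b) (+-monoˡ-≤ h δ′≤h))) ⟩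
    (value b + (h + h)) ^ suc d
      ≤⟨ ^-mono-≤ (suc d) (0≤+ (nonNeg b) (0≤+ 0≤h 0≤h)) (<⇒≤ (≰⇒> ¬p)) ⟩
    value a ^ suc d                          ≤⟨ below a ⟩
    s                                        ∎

rootApprox-cauchy : ∀ d x (δ : ℕ → ℚ) → (∀ j → 0ℚ < δ j) → (∀ ε → 0ℚ < ε → ∃[ N ] (∀ j → N ℕ.≤ j → δ j ≤ ε)) →
  (r : ∀ j → RootApprox d (seq x j ⊔ 0ℚ) (δ j)) → ∀ ε → 0ℚ < ε →
  ∃[ N ] (∀ m n → N ℕ.≤ m → N ℕ.≤ n → ∣ value (r m) - value (r n) ∣ ≤ ε)
rootApprox-cauchy d x δ 0<δ δ-small r ε 0<ε with halve 0<ε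
... | h , 0<h , h+h≡ε with δ-small h 0<h | cauchy x (h ^ suc d) (^-pos (suc d) 0<h)
... | N₁ , small | N₂ , close = N₁ ℕ.⊔ N₂ , λ m n hm hn →
  ∣a-b∣≤ε (value (r m)) (value (r n)) (half m n hm hn) (half n m hn hm)
  where
  half : ∀ m n → N₁ ℕ.⊔ N₂ ℕ.≤ m → N₁ ℕ.⊔ N₂ ℕ.≤ n → value (r m) ≤ value (r n) + ε
  half m n hm hn = subst (λ e → value (r m) ≤ value (r n) + e) h+h≡ε
    (rootApprox-close (r m) (r n) (<⇒≤ 0<h)
      (small n (ℕP.m⊔n≤o⇒m≤o N₁ N₂ hn)) (<⇒≤ (0<δ n))
      (⊔0-close {seq x m} {seq x n} (^-nonNeg (suc d) (<⇒≤ 0<h))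
        (∣a-b∣≤ε⇒a≤b+ε (seq x m) (seq x n)
          (close m n (ℕP.m⊔n≤o⇒n≤o N₁ N₂ hm) (ℕP.m⊔n≤o⇒n≤o N₁ N₂ hn)))))

rootApprox-^ : ∀ {d p δ B ε η} (a : RootApprox d (p ⊔ 0ℚ) δ) → 0ℚ < δ → 0ℚ < ε →
  (∀ u v → 0ℚ ≤ u → 0ℚ ≤ v → u ≤ B + B → v ≤ B + B → ∣ u - v ∣ ≤ η → ∣ u ^ suc d - v ^ suc d ∣ ≤ ε) →
  ∣ value a ∣ ≤ B → δ ≤ η → δ ≤ B → 0ℚ ≤ p + ε → ∣ value a ^ suc d - p ∣ ≤ ε
rootApprox-^ {d} {p} {δ} {B} {ε} {η} a 0<δ 0<ε powClose ∣y∣≤B δ≤η δ≤B 0≤p+ε =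
  ∣a-b∣≤ε (y ^ suc d) p upper lower
  where
  open ≤-Reasoning
  y : ℚ
  y = value a
  y≤B : y ≤ B
  y≤B = ≤-trans (p≤∣p∣ y) ∣y∣≤B
  0≤B : 0ℚ ≤ B
  0≤B = ≤-trans (0≤∣p∣ y) ∣y∣≤B
  near : ∣ (y + δ) - y ∣ ≤ η
  near = subst (_≤ η) (sym (trans (cong ∣_∣ (+-sub y δ)) (0≤p⇒∣p∣≡p (<⇒≤ 0<δ)))) δ≤η
  upper : y ^ suc d ≤ p + ε
  upper = ≤-trans (below a) (⊔-lub (≤+ {p} (<⇒≤ 0<ε)) 0≤p+ε)
  lower : p ≤ y ^ suc d + ε
  lower = begin
    p                  ≤⟨ p≤p⊔q p 0ℚ ⟩
    p ⊔ 0ℚ             ≤⟨ <⇒≤ (above a) ⟩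
    (y + δ) ^ suc d    ≤⟨ ∣a-b∣≤ε⇒a≤b+ε ((y + δ) ^ suc d) (y ^ suc d)
                            (powClose (y + δ) y (0≤+ (nonNeg a) (<⇒≤ 0<δ)) (nonNeg a)
                              (+-mono-≤ y≤B δ≤B) (≤-trans y≤B (≤+ 0≤B)) near) ⟩
    y ^ suc d + ε      ∎

rootApprox-limit : ∀ d x (δ : ℕ → ℚ) → (∀ j → 0ℚ < δ j) → (∀ ε → 0ℚ < ε → ∃[ N ] (∀ j → N ℕ.≤ j → δ j ≤ ε)) →
  (r : ∀ j → RootApprox d (seq x j ⊔ 0ℚ) (δ j)) →
  ∃[ B ] (0ℚ < B × ∃[ N ] (∀ n → N ℕ.≤ n → ∣ value (r n) ∣ ≤ B)) → fromℚ 0ℚ ≤ᴿ x →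
  ∀ ε → 0ℚ < ε → ∃[ N ] (∀ n → N ℕ.≤ n → ∣ value (r n) ^ suc d - seq x n ∣ ≤ ε)
rootApprox-limit d x δ 0<δ δ-small r (B , 0<B , N₁ , y≤B) 0≤x ε 0<ε =
  combine (^-close (B + B) (suc d) ε (<-≤-trans 0<B (≤+ (<⇒≤ 0<B))) 0<ε)
  where
  Goal : Set
  Goal = ∃[ N ] (∀ n → N ℕ.≤ n → ∣ value (r n) ^ suc d - seq x n ∣ ≤ ε)
  combine : ∃[ η ] (0ℚ < η × (∀ u v → 0ℚ ≤ u → 0ℚ ≤ v → u ≤ B + B → v ≤ B + B →
            ∣ u - v ∣ ≤ η → ∣ u ^ suc d - v ^ suc d ∣ ≤ ε)) → Goal
  combine (η , 0<η , powClose) with δ-small η 0<η | δ-small B 0<B | 0≤x ε 0<ε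
  ... | N₂ , small | N₃ , smallB | N₄ , xPos = N₁₂ ℕ.⊔ N₃₄ , λ n hn →
    let h₁ = ℕP.m⊔n≤o⇒m≤o N₁₂ N₃₄ hn
        h₂ = ℕP.m⊔n≤o⇒n≤o N₁₂ N₃₄ hn
    in rootApprox-^ {d} {seq x n} {δ n} {B} {ε} {η} (r n) (0<δ n) 0<ε powClose
         (y≤B n (ℕP.m⊔n≤o⇒m≤o N₁ N₂ h₁)) (small n (ℕP.m⊔n≤o⇒n≤o N₁ N₂ h₁))
         (smallB n (ℕP.m⊔n≤o⇒m≤o N₃ N₄ h₂)) (xPos n (ℕP.m⊔n≤o⇒n≤o N₃ N₄ h₂))
    where
    N₁₂ = N₁ ℕ.⊔ N₂
    N₃₄ = N₃ ℕ.⊔ N₄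

-- root d x is the non-negative d-th root of x. Negative x are replaced by 0, and root 0 x is
-- the junk value 0.
root : ℕ → ℝ → ℝ
root zero    x = fromℚ 0ℚ
root (suc d) x = mkℝ (λ j → value (rootApproxᴿ d x j)) (rootApprox-cauchy d x mesh 0<mesh mesh-small (rootApproxᴿ d x))

seq-^ : ∀ x d j → seq (x ^ᴿ d) j ≡ seq x j ^ d
seq-^ x zero    j = refl
seq-^ x (suc d) j = cong (seq x j *_) (seq-^ x d j)

0≤root : ∀ d x → fromℚ 0ℚ ≤ᴿ root d x
0≤root zero    x ε 0<ε = 0 , λ _ _ → ≤+ (<⇒≤ 0<ε)
0≤root (suc d) x ε 0<ε = 0 , λ n _ → ≤-trans (nonNeg (rootApproxᴿ d x n)) (≤+ (<⇒≤ 0<ε))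

root-^ : ∀ d x → fromℚ 0ℚ ≤ᴿ x → root (suc d) x ^ᴿ suc d ≈ᴿ x
root-^ d x 0≤x ε 0<ε = proj₁ lim , λ n hn →
  subst (λ p → ∣ p - seq x n ∣ ≤ ε) (sym (seq-^ (root (suc d) x) (suc d) n)) (proj₂ lim n hn)
  where
  lim = rootApprox-limit d x mesh 0<mesh mesh-small (rootApproxᴿ d x) (eventuallyBounded (root (suc d) x)) 0≤x ε 0<ε

record Edge (n : ℕ) : Set where
  constructor edge
  field
    lo hi  : Fin n
    .lo<hi : lo Fin.< hi

open Edge public

Joins : ∀ {n} → Edge n → Rel (Fin n) 0ℓ
Joins e u v = (lo e ≡ u × hi e ≡ v) ⊎ (lo e ≡ v × hi e ≡ u)

Adjacent : ∀ {n} → List (Edge n) → Rel (Fin n) 0ℓ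
Adjacent E u v = ∃[ e ] (e ∈ E × Joins e u v)

Next : (k : ℕ) → Rel (Fin k) 0ℓ
Next k i j = suc (toℕ i) ≡ toℕ j ⊎ (suc (toℕ i) ≡ k × toℕ j ≡ 0)

-- Adjacency in C_k, for k ≥ 3.
Cycle : (k : ℕ) → Rel (Fin k) 0ℓ
Cycle k i j = Next k i j ⊎ Next k j i

ContainsCopy : ∀ {k n} → Rel (Fin k) 0ℓ → Rel (Fin n) 0ℓ → Set
ContainsCopy {k} {n} H G =
  Σ (Fin k → Fin n) λ f → Injective _≡_ _≡_ f × (∀ i j → H i j → G (f i) (f j))

-- A round is Maker's edge followed by the edges of Breaker's reply; histories list the latest
-- round first.
Round : ℕ → Set
Round n = Edge n × List (Edge n)

History : ℕ → Set
History n = List (Round n)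

makerEdges : ∀ {n} → History n → List (Edge n)
makerEdges = map proj₁

breakerEdges : ∀ {n} → History n → List (Edge n)
breakerEdges = concatMap proj₂

Claimed : ∀ {n} → History n → Edge n → Set
Claimed h e = e ∈ makerEdges h ⊎ e ∈ breakerEdges h

-- The edges open to Breaker after Maker has answered history h with e.
Available : ∀ {n} → History n → Edge n → Edge n → Set
Available h e f = ¬ Claimed h f × f ≢ e

-- The condition length ≤ q says that at most ⌊q⌋ edges are claimed; the floor function itself is
-- not computable on ℝ.
record LegalReply {n : ℕ} (q : ℝ) (h : History n) (e : Edge n) (reply : List (Edge n)) : Set where
  field
    distinct  : Unique reply
    available : All (Available h e) reply
    atMost    : fromℕ (length reply) ≤ᴿ q
    atLeast   : ∃ (Available h e) → 1 ℕ.≤ length reply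

BreakerStrategy : ℕ → Set
BreakerStrategy n = History n → Edge n → List (Edge n)

-- Histories arising when Breaker follows σ and Maker plays any legal moves.
data Play {n : ℕ} (σ : BreakerStrategy n) : History n → Set where
  start : Play σ []
  round : ∀ {h e} → Play σ h → ¬ Claimed h e → Play σ ((e , σ h e) ∷ h)

record IsWinning (k : ℕ) {n : ℕ} (q : ℝ) (σ : BreakerStrategy n) : Set where
  field
    legal : ∀ {h e} → Play σ h → ¬ Claimed h e → LegalReply q h e (σ h e)
    wins  : ∀ {h} → Play σ h → (∀ e → Claimed h e) → ¬ ContainsCopy (Cycle k) (Adjacent (makerEdges h))

BreakerWins : (k n : ℕ) → ℝ → Set
BreakerWins k n q = ∃[ σ ] IsWinning k {n} q σ

bias : ℕ → ℝ → ℕ → ℝ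
bias k β n = root (k ∸ 1) (fromℕ (k ∸ 1) *ᴿ β ^ᴿ (k ∸ 2) *ᴿ fromℕ n ^ᴿ (k ∸ 2))

{-# OPTIONS --safe #-}
-- Breaker answers Maker's edge uv by claiming every edge that would close a k-cycle with it, and spends
-- the rest of his budget Q greedily on edges between dangerous vertices. If all Maker degrees are at
-- most Δ, there are at most (k-1) Δ^(k-2) = Q closing edges, so it suffices to keep the degrees small.
--
-- A vertex of Maker degree d and Breaker degree b has weight ∏_{j<d} (1 + c(j) x) (1 - x)^b with
-- c(j) ≈ Q - (k-2) j Δ^(k-3); the value of an edge is the sum of the weights of its ends, Φ is the sum
-- of all weights, and M bounds the value of every unclaimed edge before Maker's move. At most
-- (k-2) d(u) Δ^(k-3) closing edges come from walks that leave u, and every other reply touches u or is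
-- greedy. A greedy edge is worth at least the best edge M′ left at the end of
-- the round, but possibly less than uv. This loss is at most Q x (M - M′) up to second order, so
-- Φ + Q x M never increases: Φ alone may. Hence Φ stays below n + 1.
--
-- Finally ∑_{j<Δ} c(j) ≈ k Δ^(k-1) / 2 exceeds n when Δ is chosen with (k-1) Δ^(k-1) just below β n, as
-- β > 2(k-1)/k. So a vertex of degree Δ would have weight at least (1 + σ)^Δ for a constant σ > 0,
-- which is more than n + 1.
module Submission where

import Algebra.Definitions.RawSemiring
open import Data.Fin as Fin using (Fin; toℕ)
import Data.Fin.Properties as FinP
import Data.Integer as ℤ
import Data.Integer.Properties as ℤP
open import Data.List using (List; []; _∷_; _++_; length; map; filter; concatMap; mapMaybe; cartesianProduct; upTo; allFin; lookup)
import Data.List.Membership.DecPropositional as DecMembership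
open import Data.List.Membership.Propositional using (_∈_; _∉_; lose)
open import Data.List.Membership.Propositional.Properties
  using (∈-filter⁺; ∈-filter⁻; ∈-map⁺; ∈-concatMap⁺; ∈-cartesianProduct⁺; ∈-cartesianProduct⁻; ∈-++⁺ˡ; ∈-++⁺ʳ; ∈-++⁻;
         ∈-upTo⁺; ∈-upTo⁻; ∈-allFin; ∈-lookup)
import Data.List.Properties as ListP
open import Data.List.Relation.Unary.All as All using (All)
import Data.List.Relation.Unary.All.Properties as AllP
open import Data.List.Relation.Unary.Any using (here; there)
import Data.List.Relation.Unary.Any.Properties as AnyP
open import Data.List.Relation.Unary.Unique.Propositional using (Unique)
import Data.List.Relation.Unary.Unique.Propositional.Properties as UniqueP
open import Data.Maybe using (Maybe; just; nothing)
import Data.Maybe.Relation.Unary.All as MAll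
import Data.Maybe.Relation.Unary.Any as MAny
open import Data.Nat as ℕ using (ℕ; zero; suc; z≤n; s≤s; _∸_; NonZero)
import Data.Nat.Properties as ℕP
open import Data.Nat.Tactic.RingSolver using () renaming (solve-∀ to ℕ-solve-∀)
open import Data.Product using (∃; ∃-syntax; _×_; _,_; proj₁; proj₂; uncurry)
import Data.Rational.Unnormalised as ℚᵘ
import Data.Rational.Unnormalised.Properties as ℚᵘP
open import Data.Sum using (_⊎_; inj₁; inj₂; swap; [_,_]′)
open import Function using (_∘_)
open import Relation.Binary.Bundles using (DecTotalOrder)
open import Relation.Binary.Definitions using (DecidableEquality; tri<; tri≈; tri>)
open import Relation.Binary.PropositionalEquality
open import Relation.Nullary using (¬_; Dec; yes; no; contradiction; contradiction-irr; _⊎-dec_)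
open import Relation.Nullary.Decidable using (dec⇒maybe)
open import Tactic.RingSolver using (solve-∀)
open import Tactic.RingSolver.Core.AlmostCommutativeRing using (AlmostCommutativeRing; fromCommutativeRing)
open import Defs

-- The constants resolve a conflict. A vertex of degree Δ must outweigh n + 1 although Δ is only of
-- order n^(1/(k-1)); this is achieved by letting every edge gain a constant factor 1 + σ. Then κ =
-- Q x is a constant too, and the second-order terms of a round do not fade as n grows. They are
-- paid from a reserve S deducted from every c(j): a round costs 3 κ² times the weights of the ends
-- of Maker's edge, and x is chosen so that S x = 3 κ². With S = Δ^(k-2) / g this gives κ = 1 / (3
-- (k-1) g) and σ = S x = 1 / R for R = 3 (k-1)² g². The reserve is charged three times per level,
-- once inside c(j) and twice to leave the factor 1 + σ. The total price 3 S Δ = 3 Δ^(k-1) / g fits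
-- into the gap between β and 2(k-1)/k once g is large. Choosing Δ = g R y keeps these quotients
-- integral, with y the only parameter that grows with n.
--
-- Few closing edges require small degrees, and small degrees require enough spare replies. There is
-- no circle: each round starts from the bound on Φ + Q x M, which by itself implies the degree
-- bound.

-- Inequalities for powers of rationals and the accounting of one round.

module RationalPowers where
  open import Data.Rational using (0ℚ; 1ℚ; _+_; _*_; _-_; -_; _≤_; nonNegative)
  open import Data.Rational.Base using (+-*-rawSemiring)
  open import Data.Rational.Properties
  open Algebra.Definitions.RawSemiring +-*-rawSemiring using (_^_)

  ℚ-ring : AlmostCommutativeRing _ _
  ℚ-ring = fromCommutativeRing +-*-commutativeRing (λ x → dec⇒maybe (0ℚ ≟ x))

  ≤-cert : ∀ {a b x} → 0ℚ ≤ x → a + x ≡ b → a ≤ b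
  ≤-cert 0≤x eq = subst (_ ≤_) eq (≤+ 0≤x)

  0≤- : ∀ {a b} → a ≤ b → 0ℚ ≤ b - a
  0≤- {a} {b} a≤b = subst (_≤ b - a) (+-inverseʳ a) (+-monoˡ-≤ (- a) a≤b)

  *-monoʳ-≤₀ : ∀ {a b} c → 0ℚ ≤ c → a ≤ b → c * a ≤ c * b
  *-monoʳ-≤₀ c 0≤c = *-monoˡ-≤-nonNeg c {{nonNegative 0≤c}}

  *-monoˡ-≤₀ : ∀ {a b} c → 0ℚ ≤ c → a ≤ b → a * c ≤ b * c
  *-monoˡ-≤₀ c 0≤c = *-monoʳ-≤-nonNeg c {{nonNegative 0≤c}}

  1-x≤1 : ∀ {x} → 0ℚ ≤ x → 1ℚ - x ≤ 1ℚ
  1-x≤1 {x} 0≤x = ≤-cert 0≤x (lemma x)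
    where
    lemma : ∀ x → 1ℚ - x + x ≡ 1ℚ
    lemma = solve-∀ ℚ-ring

  ×ℚ-homo-+ : ∀ m n δ → (m ℕ.+ n) ×ℚ δ ≡ m ×ℚ δ + n ×ℚ δ
  ×ℚ-homo-+ zero    n δ = sym (+-identityˡ (n ×ℚ δ))
  ×ℚ-homo-+ (suc m) n δ = trans (cong (_+ δ) (×ℚ-homo-+ m n δ)) (lemma (m ×ℚ δ) (n ×ℚ δ) δ)
    where
    lemma : ∀ a b d → a + b + d ≡ a + d + b
    lemma = solve-∀ ℚ-ring

  0≤×ℚ : ∀ m {δ} → 0ℚ ≤ δ → 0ℚ ≤ m ×ℚ δ
  0≤×ℚ zero    0≤δ = ≤-refl
  0≤×ℚ (suc m) 0≤δ = 0≤+ (0≤×ℚ m 0≤δ) 0≤δ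

  ×ℚ-mono-≤ : ∀ {m n δ} → 0ℚ ≤ δ → m ℕ.≤ n → m ×ℚ δ ≤ n ×ℚ δ
  ×ℚ-mono-≤ {m} {n} {δ} 0≤δ m≤n = ≤-cert (0≤×ℚ (n ℕ.∸ m) 0≤δ)
    (trans (sym (×ℚ-homo-+ m (n ℕ.∸ m) δ)) (cong (_×ℚ δ) (ℕP.m+[n∸m]≡n m≤n)))

  ×ℚ-*-assoc : ∀ m n δ → (m ℕ.* n) ×ℚ δ ≡ m ×ℚ (n ×ℚ δ)
  ×ℚ-*-assoc zero    n δ = refl
  ×ℚ-*-assoc (suc m) n δ = trans (×ℚ-homo-+ n (m ℕ.* n) δ)
    (trans (+-comm (n ×ℚ δ) _) (cong (_+ n ×ℚ δ) (×ℚ-*-assoc m n δ)))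

  ×ℚ-*ˡ : ∀ m δ η → (m ×ℚ δ) * η ≡ m ×ℚ (δ * η)
  ×ℚ-*ˡ zero    δ η = *-zeroˡ η
  ×ℚ-*ˡ (suc m) δ η = trans (*-distribʳ-+ η (m ×ℚ δ) δ) (cong (_+ δ * η) (×ℚ-*ˡ m δ η))

  ×ℚ-*ʳ : ∀ m δ η → δ * (m ×ℚ η) ≡ m ×ℚ (δ * η)
  ×ℚ-*ʳ m δ η = trans (*-comm δ (m ×ℚ η)) (trans (×ℚ-*ˡ m η δ) (cong (m ×ℚ_) (*-comm η δ)))

  ×ℚ-homo-* : ∀ m n → (m ℕ.* n) ×ℚ 1ℚ ≡ (m ×ℚ 1ℚ) * (n ×ℚ 1ℚ)
  ×ℚ-homo-* m n = trans (×ℚ-*-assoc m n 1ℚ)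
    (sym (trans (×ℚ-*ˡ m 1ℚ (n ×ℚ 1ℚ)) (cong (m ×ℚ_) (*-identityˡ (n ×ℚ 1ℚ)))))

  ×ℚ-homo-^ : ∀ m d → (m ℕ.^ d) ×ℚ 1ℚ ≡ (m ×ℚ 1ℚ) ^ d
  ×ℚ-homo-^ m zero    = +-identityˡ 1ℚ
  ×ℚ-homo-^ m (suc d) = trans (×ℚ-homo-* m (m ℕ.^ d)) (cong ((m ×ℚ 1ℚ) *_) (×ℚ-homo-^ m d))

  ^-homo-+ : ∀ x a b → x ^ (a ℕ.+ b) ≡ x ^ a * x ^ b
  ^-homo-+ x zero    b = sym (*-identityˡ (x ^ b))
  ^-homo-+ x (suc a) b = trans (cong (x *_) (^-homo-+ x a b)) (sym (*-assoc x (x ^ a) (x ^ b)))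

  ^-homo-* : ∀ x a b → x ^ (a ℕ.* b) ≡ (x ^ b) ^ a
  ^-homo-* x zero    b = refl
  ^-homo-* x (suc a) b = trans (^-homo-+ x b (a ℕ.* b)) (cong (x ^ b *_) (^-homo-* x a b))

  ^-distribʳ-* : ∀ a b d → (a * b) ^ d ≡ a ^ d * b ^ d
  ^-distribʳ-* a b zero    = sym (*-identityˡ 1ℚ)
  ^-distribʳ-* a b (suc d) = trans (cong (a * b *_) (^-distribʳ-* a b d)) (e a b (a ^ d) (b ^ d))
    where
    e : ∀ a b x y → a * b * (x * y) ≡ a * x * (b * y)
    e = solve-∀ ℚ-ring

  ^-≤1 : ∀ {x} a → 0ℚ ≤ x → x ≤ 1ℚ → x ^ a ≤ 1ℚ
  ^-≤1 zero        0≤x x≤1 = ≤-refl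
  ^-≤1 {x} (suc a) 0≤x x≤1 = ≤-trans (*-mono-≤₀ 0≤x (<⇒≤ 0<1) x≤1 (^-≤1 a 0≤x x≤1)) (≤-reflexive (*-identityˡ 1ℚ))

  ^-antitone : ∀ {x a b} → 0ℚ ≤ x → x ≤ 1ℚ → a ℕ.≤ b → x ^ b ≤ x ^ a
  ^-antitone {x} {a} {b} 0≤x x≤1 a≤b = begin
    x ^ b                      ≡⟨ cong (x ^_) (sym (ℕP.m+[n∸m]≡n a≤b)) ⟩
    x ^ (a ℕ.+ (b ℕ.∸ a))      ≡⟨ ^-homo-+ x a (b ℕ.∸ a) ⟩
    x ^ a * x ^ (b ℕ.∸ a)      ≤⟨ *-monoʳ-≤₀ (x ^ a) (^-nonNeg a 0≤x) (^-≤1 (b ℕ.∸ a) 0≤x x≤1) ⟩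
    x ^ a * 1ℚ                 ≡⟨ *-identityʳ (x ^ a) ⟩
    x ^ a                      ∎
    where open ≤-Reasoning

  bernoulli : ∀ {x} a → 0ℚ ≤ x → 1ℚ + a ×ℚ x ≤ (1ℚ + x) ^ a
  bernoulli zero        0≤x = ≤-reflexive (+-identityʳ 1ℚ)
  bernoulli {x} (suc a) 0≤x = ≤-trans
    (≤-cert (0≤* (0≤×ℚ a 0≤x) 0≤x) (lemma (a ×ℚ x) x))
    (*-monoʳ-≤₀ (1ℚ + x) (0≤+ (<⇒≤ 0<1) 0≤x) (bernoulli a 0≤x))
    where
    lemma : ∀ y x → 1ℚ + (y + x) + y * x ≡ (1ℚ + x) * (1ℚ + y)
    lemma = solve-∀ ℚ-ring

  bernoulli-minus : ∀ {x} a → 0ℚ ≤ x → x ≤ 1ℚ → 1ℚ - a ×ℚ x ≤ (1ℚ - x) ^ a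
  bernoulli-minus zero        0≤x x≤1 = ≤-refl
  bernoulli-minus {x} (suc a) 0≤x x≤1 = ≤-trans
    (≤-cert (0≤* (0≤×ℚ a 0≤x) 0≤x) (lemma (a ×ℚ x) x))
    (*-monoʳ-≤₀ (1ℚ - x) (0≤- x≤1) (bernoulli-minus a 0≤x x≤1))
    where
    lemma : ∀ y x → 1ℚ - (y + x) + y * x ≡ (1ℚ - x) * (1ℚ - y)
    lemma = solve-∀ ℚ-ring

  -- The square has coefficient 1 instead of the 1/2 of the expansion. The surplus x y² + y x + x²
  -- with y = a x closes the induction without assuming a x ≤ 1.
  bernoulli-minus-upper : ∀ {x} a → 0ℚ ≤ x → x ≤ 1ℚ →
                          (1ℚ - x) ^ a ≤ 1ℚ - a ×ℚ x + (a ×ℚ x) * (a ×ℚ x)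
  bernoulli-minus-upper zero        0≤x x≤1 = ≤-refl
  bernoulli-minus-upper {x} (suc a) 0≤x x≤1 = ≤-trans
    (*-monoʳ-≤₀ (1ℚ - x) (0≤- x≤1) (bernoulli-minus-upper a 0≤x x≤1))
    (≤-cert (0≤+ (0≤* 0≤x (0≤* 0≤y 0≤y)) (0≤+ (0≤* 0≤y 0≤x) (0≤* 0≤x 0≤x))) (lemma (a ×ℚ x) x))
    where
    0≤y = 0≤×ℚ a 0≤x
    lemma : ∀ y x → (1ℚ - x) * (1ℚ - y + y * y) + (x * (y * y) + (y * x + x * x))
                    ≡ 1ℚ - (y + x) + (y + x) * (y + x)
    lemma = solve-∀ ℚ-ring

  -- An endpoint of Maker's edge gains the factor 1 + c x by that edge and loses (1 - x)ᵃ by a replies.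
  touched-bound : ∀ {x} c a {q} → 0ℚ ≤ x → x ≤ 1ℚ → a ℕ.≤ q →
    (1ℚ + c ×ℚ x) * (1ℚ - x) ^ a ≤ 1ℚ + (c ×ℚ x - a ×ℚ x) + (q ×ℚ x) * (q ×ℚ x)
  touched-bound {x} c a {q} 0≤x x≤1 a≤q = begin
    (1ℚ + C) * D          ≤⟨ ≤-cert (0≤* (0≤×ℚ c 0≤x) (0≤- (^-≤1 a (0≤- x≤1) (1-x≤1 0≤x)))) (lemma₁ C D) ⟩
    D + C                 ≤⟨ +-monoˡ-≤ C (bernoulli-minus-upper a 0≤x x≤1) ⟩
    1ℚ - A + A * A + C    ≤⟨ +-monoˡ-≤ C (+-monoʳ-≤ (1ℚ - A) A²≤K²) ⟩
    1ℚ - A + K * K + C    ≡⟨ lemma₂ A C (K * K) ⟩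
    1ℚ + (C - A) + K * K  ∎
    where
    open ≤-Reasoning
    A = a ×ℚ x
    C = c ×ℚ x
    D = (1ℚ - x) ^ a
    K = q ×ℚ x
    A≤K = ×ℚ-mono-≤ 0≤x a≤q
    A²≤K² : A * A ≤ K * K
    A²≤K² = *-mono-≤₀ (0≤×ℚ a 0≤x) (0≤×ℚ q 0≤x) A≤K A≤K
    lemma₁ : ∀ C D → (1ℚ + C) * D + C * (1ℚ - D) ≡ D + C
    lemma₁ = solve-∀ ℚ-ring
    lemma₂ : ∀ A C K → 1ℚ - A + K + C ≡ 1ℚ + (C - A) + K
    lemma₂ = solve-∀ ℚ-ring

  -- p and s are the weights of the ends of Maker's edge, U and V the factors they change by, M and M′
  -- bounds for the value of an open edge before and after the round, κ = q x for bias q, and φ the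
  -- part of κ left for greedy replies.
  round-inequality : ∀ {Φ Φ₁ Φ₂ p s M M′ κ φ U V α β γ δ} →
    0ℚ ≤ p → 0ℚ ≤ s → 0ℚ ≤ φ → φ ≤ κ →
    Φ₂ + φ * M′ ≤ Φ₁ → Φ₁ + (p + s) ≤ Φ + (p * U + s * V) →
    U ≤ 1ℚ + (α - β) + κ * κ → V ≤ 1ℚ + (γ - δ) + κ * κ →
    M′ ≤ M + (κ + κ) * (p + s) → p + s ≤ M →
    α + (κ * κ + κ * κ + κ * κ) ≤ β + φ → γ + (κ * κ + κ * κ + κ * κ) ≤ δ + φ →
    Φ₂ + κ * M′ ≤ Φ + κ * M
  round-inequality {Φ} {Φ₁} {Φ₂} {p} {s} {M} {M′} {κ} {φ} {U} {V} {α} {β} {γ} {δ}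
    0≤p 0≤s 0≤φ φ≤κ h₁ h₂ hU hV hM hm hα hγ =
    ≤-trans (≤-cert (0≤- h₁) (e₁ Φ₂ Φ₁ κ φ M′))
    (≤-trans (≤-cert (0≤- h₂) (e₂ Φ Φ₁ p s (p * U) (s * V) ((κ - φ) * M′)))
    (≤-trans (+-mono-≤ (+-monoʳ-≤ (Φ - (p + s)) (+-mono-≤ (*-monoʳ-≤₀ p 0≤p hU) (*-monoʳ-≤₀ s 0≤s hV)))
                       (*-monoʳ-≤₀ (κ - φ) (0≤- φ≤κ) hM))
    -- Each end is charged 3 κ²: one κ² from the bound on `U` or `V`, two from κ times the growth 2
    -- κ (p + s) allowed to `M′`. The greedy replies contribute φ M, which covers φ (p + s) because
    -- p + s ≤ M.
    (≤-cert (0≤+ (0≤+ (0≤* 0≤φ (0≤- hm)) (0≤* 0≤p (0≤- hα)))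
                 (0≤+ (0≤* 0≤s (0≤- hγ)) (0≤* (0≤* (0≤+ 0≤κ 0≤κ) 0≤φ) (0≤+ 0≤p 0≤s))))
            (e₃ Φ p s M κ φ α β γ δ))))
    where
    0≤κ = ≤-trans 0≤φ φ≤κ
    e₁ : ∀ Φ₂ Φ₁ κ φ M′ → Φ₂ + κ * M′ + (Φ₁ - (Φ₂ + φ * M′)) ≡ Φ₁ + (κ - φ) * M′
    e₁ = solve-∀ ℚ-ring
    e₂ : ∀ Φ Φ₁ p s pU sV X → Φ₁ + X + (Φ + (pU + sV) - (Φ₁ + (p + s))) ≡ Φ - (p + s) + (pU + sV) + X
    e₂ = solve-∀ ℚ-ring
    e₃ : ∀ Φ p s M κ φ α β γ δ →
      Φ - (p + s) + (p * (1ℚ + (α - β) + κ * κ) + s * (1ℚ + (γ - δ) + κ * κ))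
        + (κ - φ) * (M + (κ + κ) * (p + s))
        + ((φ * (M - (p + s)) + p * (β + φ - (α + (κ * κ + κ * κ + κ * κ))))
          + (s * (δ + φ - (γ + (κ * κ + κ * κ + κ * κ))) + (κ + κ) * φ * (p + s)))
      ≡ Φ + κ * M
    e₃ = solve-∀ ℚ-ring

open RationalPowers

-- Edges, walks and the edges that close a k-cycle.

module Graphs where
  open import Data.Nat using (_+_; _*_; _^_; _≤_; _<_)
  open import Data.Nat.DivMod
    using (_/_; _%_; _mod_; m≡m%n+[m/n]*n; m%n<n; m<n⇒m%n≡m; n%n≡0; [m+n]%n≡m%n; [m+kn]%n≡m%n; m≤n⇒[n∸m]%m≡n%m)
  open import Data.Nat.Properties

  Touches : ∀ {n} → Fin n → Edge n → Set
  Touches v e = lo e ≡ v ⊎ hi e ≡ v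

  touches? : ∀ {n} (v : Fin n) e → Dec (Touches v e)
  touches? v e = (lo e Fin.≟ v) ⊎-dec (hi e Fin.≟ v)

  other : ∀ {n} → Fin n → Edge n → Fin n
  other v e with lo e Fin.≟ v
  ... | yes _ = hi e
  ... | no  _ = lo e

  lo≢hi : ∀ {n} (e : Edge n) → lo e ≢ hi e
  lo≢hi (edge a b p) a≡b = FinP.<-irrefl a≡b (recompute-< p)
    where
    recompute-< : ∀ {n} {a b : Fin n} → .(a Fin.< b) → a Fin.< b
    recompute-< {a = a} {b} p with a FinP.<? b
    ... | yes q = q
    ... | no ¬q = contradiction-irr p ¬q

  infix 4 _≟ᴱ_

  _≟ᴱ_ : ∀ {n} → DecidableEquality (Edge n)
  edge a b _ ≟ᴱ edge c d _ with a Fin.≟ c | b Fin.≟ d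
  ... | yes refl | yes refl = yes refl
  ... | no a≢c   | _        = no (a≢c ∘ cong lo)
  ... | _        | no b≢d   = no (b≢d ∘ cong hi)

  edgeOf : ∀ {n} → Fin n → Fin n → Maybe (Edge n)
  edgeOf u v with u FinP.<? v | v FinP.<? u
  ... | yes u<v | _       = just (edge u v u<v)
  ... | no _    | yes v<u = just (edge v u v<u)
  ... | no _    | no _    = nothing

  joins⇒edgeOf : ∀ {n} {e : Edge n} {u v} → Joins e u v → edgeOf u v ≡ just e
  joins⇒edgeOf {e = edge u v p} (inj₁ (refl , refl)) with u FinP.<? v | v FinP.<? u
  ... | yes _   | _ = refl
  ... | no u≮v  | _ = contradiction-irr p u≮v
  joins⇒edgeOf {e = edge v u p} (inj₂ (refl , refl)) with u FinP.<? v | v FinP.<? u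
  ... | yes u<v | _       = contradiction-irr p (FinP.<-asym u<v)
  ... | no _    | yes _   = refl
  ... | no _    | no v≮u  = contradiction-irr p v≮u

  edgeOf-touchesˡ : ∀ {n} (u v : Fin n) → MAll.All (Touches u) (edgeOf u v)
  edgeOf-touchesˡ u v with u FinP.<? v | v FinP.<? u
  ... | yes _ | _     = MAll.just (inj₁ refl)
  ... | no _  | yes _ = MAll.just (inj₂ refl)
  ... | no _  | no _  = MAll.nothing

  edgeOf-touchesʳ : ∀ {n} (u v : Fin n) → MAll.All (Touches v) (edgeOf u v)
  edgeOf-touchesʳ u v with u FinP.<? v | v FinP.<? u
  ... | yes _ | _     = MAll.just (inj₂ refl)
  ... | no _  | yes _ = MAll.just (inj₁ refl)
  ... | no _  | no _  = MAll.nothing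

  edgesOf : ∀ {n} → List (Fin n) → List (Fin n) → List (Edge n)
  edgesOf xs ys = mapMaybe (uncurry edgeOf) (cartesianProduct xs ys)

  length-cartesianProduct : ∀ {A B : Set} (xs : List A) (ys : List B) → length (cartesianProduct xs ys) ≡ length xs * length ys
  length-cartesianProduct []       ys = refl
  length-cartesianProduct (x ∷ xs) ys = trans (ListP.length-++ (map (x ,_) ys))
    (cong₂ _+_ (ListP.length-map (x ,_) ys) (length-cartesianProduct xs ys))

  length-edgesOf : ∀ {n} (xs ys : List (Fin n)) → length (edgesOf xs ys) ≤ length xs * length ys
  length-edgesOf xs ys = ≤-trans (ListP.length-mapMaybe (uncurry edgeOf) (cartesianProduct xs ys))
    (≤-reflexive (length-cartesianProduct xs ys))

  ∈-edgesOf : ∀ {n xs ys} {e : Edge n} {x y} → Joins e x y → x ∈ xs → y ∈ ys → e ∈ edgesOf xs ys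
  ∈-edgesOf {xs = xs} {ys} {e} j x∈ y∈ = AnyP.mapMaybe⁺ (uncurry edgeOf) (cartesianProduct xs ys)
    (AnyP.map⁺ (lose (∈-cartesianProduct⁺ x∈ y∈)
      (subst (MAny.Any (e ≡_)) (sym (joins⇒edgeOf j)) (MAny.just refl))))

  edgesOf-touchesˡ : ∀ {n} (u : Fin n) ys → All (Touches u) (edgesOf (u ∷ []) ys)
  edgesOf-touchesˡ u ys = AllP.mapMaybe⁺ (AllP.map⁺ {xs = cartesianProduct (u ∷ []) ys} (All.tabulate λ { {x , y} xy∈ →
    subst (λ w → MAll.All (Touches w) (edgeOf x y)) (∈-singleton (proj₁ (∈-cartesianProduct⁻ (u ∷ []) ys xy∈)))
      (edgeOf-touchesˡ x y) }))
    where
    ∈-singleton : ∀ {x} → x ∈ u ∷ [] → x ≡ u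
    ∈-singleton (here eq) = eq

  edgesOf-touchesʳ : ∀ {n} (v : Fin n) xs → All (Touches v) (edgesOf xs (v ∷ []))
  edgesOf-touchesʳ v xs = AllP.mapMaybe⁺ (AllP.map⁺ {xs = cartesianProduct xs (v ∷ [])} (All.tabulate λ { {x , y} xy∈ →
    subst (λ w → MAll.All (Touches w) (edgeOf x y)) (∈-singleton (proj₂ (∈-cartesianProduct⁻ xs (v ∷ []) xy∈)))
      (edgeOf-touchesʳ x y) }))
    where
    ∈-singleton : ∀ {x} → x ∈ v ∷ [] → x ≡ v
    ∈-singleton (here eq) = eq

  allEdges : ∀ n → List (Edge n)
  allEdges n = edgesOf (allFin n) (allFin n)

  ∈-allEdges : ∀ {n} (e : Edge n) → e ∈ allEdges n
  ∈-allEdges e = ∈-edgesOf (inj₁ (refl , refl)) (∈-allFin (lo e)) (∈-allFin (hi e))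

  nbrs : ∀ {n} → List (Edge n) → Fin n → List (Fin n)
  nbrs E v = map (other v) (filter (touches? v) E)

  deg : ∀ {n} → List (Edge n) → Fin n → ℕ
  deg E v = length (filter (touches? v) E)

  length-nbrs : ∀ {n} (E : List (Edge n)) v → length (nbrs E v) ≡ deg E v
  length-nbrs E v = ListP.length-map (other v) (filter (touches? v) E)

  adjacent⇒∈nbrs : ∀ {n} {E : List (Edge n)} {u v} → Adjacent E u v → v ∈ nbrs E u
  adjacent⇒∈nbrs {E = E} {u} {v} (e , e∈E , j) = subst (_∈ nbrs E u) (other≡ j) (∈-map⁺ (other u) (∈-filter⁺ (touches? u) e∈E (touch j)))
    where
    touch : Joins e u v → Touches u e
    touch (inj₁ (p , _)) = inj₁ p
    touch (inj₂ (_ , p)) = inj₂ p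
    other≡ : Joins e u v → other u e ≡ v
    other≡ j with lo e Fin.≟ u
    other≡ (inj₁ (_ , q)) | yes p = q
    other≡ (inj₂ (_ , q)) | yes p = contradiction (trans p (sym q)) (lo≢hi e)
    other≡ (inj₁ (p , _)) | no ¬p = contradiction p ¬p
    other≡ (inj₂ (p , _)) | no ¬p = p

  adjacent-sym : ∀ {n} {E : List (Edge n)} {u v} → Adjacent E u v → Adjacent E v u
  adjacent-sym (e , e∈E , j) = e , e∈E , swap j

  -- Endpoints, with multiplicity, of the walks of length i from v.
  walks : ∀ {n} → List (Edge n) → ℕ → Fin n → List (Fin n)
  walks E zero    v = v ∷ []
  walks E (suc i) v = concatMap (walks E i) (nbrs E v)

  length-concatMap-≤ : ∀ {A B : Set} (f : A → List B) {b} xs → All (λ x → length (f x) ≤ b) xs →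
                       length (concatMap f xs) ≤ length xs * b
  length-concatMap-≤ f []       All.[]         = z≤n
  length-concatMap-≤ f (x ∷ xs) (fx≤b All.∷ h) =
    ≤-trans (≤-reflexive (ListP.length-++ (f x))) (+-mono-≤ fx≤b (length-concatMap-≤ f xs h))

  length-walks : ∀ {n} (E : List (Edge n)) {Δ} → (∀ v → deg E v ≤ Δ) → ∀ i v → length (walks E i v) ≤ Δ ^ i
  length-walks-suc : ∀ {n} (E : List (Edge n)) {Δ} → (∀ v → deg E v ≤ Δ) → ∀ i v →
                     length (walks E (suc i) v) ≤ deg E v * Δ ^ i
  length-walks E h zero    v = ≤-refl
  length-walks E {Δ} h (suc i) v = ≤-trans (length-walks-suc E h i v) (*-monoˡ-≤ (Δ ^ i) (h v))
  length-walks-suc E {Δ} h i v = ≤-trans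
    (length-concatMap-≤ (walks E i) (nbrs E v) (All.tabulate λ {x} _ → length-walks E h i x))
    (≤-reflexive (cong (_* Δ ^ i) (length-nbrs E v)))

  walk-end : ∀ {n} {E : List (Edge n)} i (g : ℕ → Fin n) → (∀ p → p < i → Adjacent E (g p) (g (suc p))) →
             g i ∈ walks E i (g 0)
  walk-end zero    g step = here refl
  walk-end {E = E} (suc i) g step = ∈-concatMap⁺ (walks E i) {xs = nbrs E (g 0)}
    (lose (adjacent⇒∈nbrs (step 0 (s≤s z≤n))) (walk-end i (g ∘ suc) λ p p<i → step (suc p) (s≤s p<i)))

  -- A k-periodic sequence on ℕ instead of a map on `Fin k`: rotating the cycle is a shift of the
  -- index, and stretches of it are walks without modular arithmetic.
  record ClosedCycle {n} (k : ℕ) (E : List (Edge n)) (g : ℕ → Fin n) : Set where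
    field
      step     : ∀ p → Adjacent E (g p) (g (suc p))
      periodic : ∀ p → g (k + p) ≡ g p
      distinct : ∀ p a → 0 < a → a < k → g p ≢ g (a + p)

  open ClosedCycle

  shift : ∀ {n k E} {g : ℕ → Fin n} s → ClosedCycle k E g → ClosedCycle k E (λ p → g (p + s))
  shift {k = k} {g = g} s c = record
    { step     = λ p → step c (p + s)
    ; periodic = λ p → trans (cong g (+-assoc k p s)) (periodic c (p + s))
    ; distinct = λ p a 0<a a<k eq → distinct c (p + s) a 0<a a<k (trans eq (cong g (+-assoc a p s)))
    }

  suc-% : ∀ p k .{{_ : NonZero k}} → suc p % k ≡ suc (p % k) % k
  suc-% p k = trans (cong (λ x → suc x % k) (m≡m%n+[m/n]*n p k)) ([m+kn]%n≡m%n (suc (p % k)) (p / k) k)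

  suc-%-next : ∀ p k .{{_ : NonZero k}} → suc (p % k) ≡ suc p % k ⊎ (suc (p % k) ≡ k × suc p % k ≡ 0)
  suc-%-next p k with m≤n⇒m<n∨m≡n (m%n<n p k)
  ... | inj₁ lt = inj₁ (sym (trans (suc-% p k) (m<n⇒m%n≡m lt)))
  ... | inj₂ eq = inj₂ (eq , trans (suc-% p k) (trans (cong (_% k) eq) (n%n≡0 k)))

  +-%-distinct : ∀ p a k .{{_ : NonZero k}} → 0 < a → a < k → p % k ≢ (a + p) % k
  +-%-distinct p a k 0<a a<k eq = go (<-≤-connex (a + x) k)
    where
    x = p % k
    eq′ : x ≡ (a + x) % k
    eq′ = trans eq (trans (cong (λ y → (a + y) % k) (m≡m%n+[m/n]*n p k))
      (trans (cong (_% k) (sym (+-assoc a x (p / k * k)))) ([m+kn]%n≡m%n (a + x) (p / k) k)))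
    go : a + x < k ⊎ k ≤ a + x → _
    go (inj₁ lt) = <-irrefl (trans eq′ (m<n⇒m%n≡m lt)) (m<n+m x 0<a)
    go (inj₂ k≤) = <-irrefl {a + x} {k + x} (begin-equality
        a + x              ≡⟨ sym (m+[n∸m]≡n k≤) ⟩
        k + (a + x ∸ k)    ≡⟨ cong (k +_) (sym (trans eq′ (trans (sym (m≤n⇒[n∸m]%m≡n%m k≤)) (m<n⇒m%n≡m lt)))) ⟩
        k + x              ∎) (+-monoˡ-< x a<k)
      where
      open ≤-Reasoning
      lt : a + x ∸ k < k
      lt = +-cancelˡ-< k (a + x ∸ k) k (subst (_< k + k) (sym (m+[n∸m]≡n k≤)) (+-mono-< a<k (m%n<n p k)))

  copy⇒closedCycle : ∀ {n k} .{{_ : NonZero k}} {E : List (Edge n)} → ContainsCopy (Cycle k) (Adjacent E) →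
                     ∃ (ClosedCycle k E)
  copy⇒closedCycle {k = k} {E} (f , inj , adj) = (λ p → f (p mod k)) , record
    { step     = λ p → adj (p mod k) (suc p mod k) (inj₁ (next p))
    ; periodic = λ p → cong f (FinP.fromℕ<-cong _ _ (trans (cong (_% k) (+-comm k p)) ([m+n]%n≡m%n p k)) _ _)
    ; distinct = λ p a 0<a a<k eq → +-%-distinct p a k 0<a a<k
        (trans (sym (toℕ-mod p)) (trans (cong toℕ (inj eq)) (toℕ-mod (a + p))))
    }
    where
    toℕ-mod : ∀ p → toℕ (p mod k) ≡ p % k
    toℕ-mod p = FinP.toℕ-fromℕ< (m%n<n p k)
    next : ∀ p → Next k (p mod k) (suc p mod k)
    next p rewrite toℕ-mod p | toℕ-mod (suc p) = suc-%-next p k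

  joins-unique : ∀ {n} {e : Edge n} {x y x′ y′} → Joins e x y → Joins e x′ y′ → (x ≡ x′ × y ≡ y′) ⊎ (x ≡ y′ × y ≡ x′)
  joins-unique (inj₁ (refl , refl)) (inj₁ (refl , refl)) = inj₁ (refl , refl)
  joins-unique (inj₁ (refl , refl)) (inj₂ (refl , refl)) = inj₂ (refl , refl)
  joins-unique (inj₂ (refl , refl)) (inj₁ (refl , refl)) = inj₂ (refl , refl)
  joins-unique (inj₂ (refl , refl)) (inj₂ (refl , refl)) = inj₁ (refl , refl)

  -- Two uses in the same direction would give g p = g q. In opposite directions g p = g (q + 1),
  -- which is possible only for q + 1 - p = k; then g (p + 1) = g q are at distance k - 2, and this
  -- is positive since k ≥ 3.
  joins-once : ∀ {n k E e} {g : ℕ → Fin n} → 3 ≤ k → ClosedCycle k E g → ∀ {p q} → p < q → q < k →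
               Joins e (g p) (g (suc p)) → ¬ Joins e (g q) (g (suc q))
  joins-once {k = k} {e = e} {g = g} 3≤k c {p} {q} p<q q<k j j′ = go (joins-unique {e = e} j j′)
    where
    b = q ∸ suc p
    q≡ : q ≡ b + suc p
    q≡ = sym (m∸n+n≡m p<q)
    1+b≤q : suc b ≤ q
    1+b≤q = subst (suc b ≤_) (trans (sym (+-suc b p)) (sym q≡)) (s≤s (m≤m+n b p))
    go : (g p ≡ g q × g (suc p) ≡ g (suc q)) ⊎ (g p ≡ g (suc q) × g (suc p) ≡ g q) → _
    go (inj₁ (eq , _)) = distinct c p (suc b) (s≤s z≤n) (≤-<-trans 1+b≤q q<k)
      (trans eq (cong g (trans q≡ (+-suc b p))))
    go (inj₂ (eq , eq′)) with m≤n⇒m<n∨m≡n (≤-<-trans 1+b≤q q<k)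
    ... | inj₁ 2+b<k = distinct c p (suc (suc b)) (s≤s z≤n) 2+b<k
      (trans eq (cong g (cong suc (trans q≡ (+-suc b p)))))
    ... | inj₂ 2+b≡k = distinct c (suc p) b (≤-pred (≤-pred (subst (3 ≤_) (sym 2+b≡k) 3≤k)))
      (subst (b <_) 2+b≡k (m<n⇒m<1+n (n<1+n b))) (trans eq′ (cong g q≡))

  search : ∀ {A B : ℕ → Set} → (∀ p → A p ⊎ B p) → ∀ k → (∃[ p ] (p < k × A p)) ⊎ (∀ p → p < k → B p)
  search h zero = inj₂ λ _ ()
  search h (suc k) with search h k | h k
  ... | inj₁ (p , p<k , a) | _      = inj₁ (p , m<n⇒m<1+n p<k , a)
  ... | inj₂ _             | inj₁ a = inj₁ (k , n<1+n k , a)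
  ... | inj₂ b             | inj₂ y = inj₂ λ p p<1+k → case-≤ (m<1+n⇒m<n∨m≡n p<1+k)
    where
    case-≤ : ∀ {p} → p < k ⊎ p ≡ k → _
    case-≤ (inj₁ p<k)  = b _ p<k
    case-≤ (inj₂ refl) = y

  restrict : ∀ {n k E F} .{{_ : NonZero k}} {g : ℕ → Fin n} → ClosedCycle k E g →
             (∀ p → p < k → Adjacent F (g p) (g (suc p))) → ClosedCycle k F g
  restrict {k = k} {F = F} {g = g} c h = record
    { step     = λ p → subst₂ (Adjacent F) (sym (red p)) (sym (trans (cong g (cong suc (m≡m%n+[m/n]*n p k))) (reduce (p / k) (suc (p % k)))))
        (h (p % k) (m%n<n p k))
    ; periodic = periodic c
    ; distinct = distinct c
    }
    where
    reduce : ∀ j x → g (x + j * k) ≡ g x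
    reduce zero    x = cong g (+-identityʳ x)
    reduce (suc j) x = trans (cong g (trans (sym (+-assoc x k (j * k))) (trans (cong (_+ j * k) (+-comm x k)) (+-assoc k x (j * k)))))
      (trans (periodic c (x + j * k)) (reduce j x))
    red : ∀ p → g p ≡ g (p % k)
    red p = trans (cong g (m≡m%n+[m/n]*n p k)) (reduce (p / k) (p % k))

  module _ {n : ℕ} (r : ℕ) {E : List (Edge n)} {m e : Edge n} where

    private
      k = suc (suc r)

      classify : ∀ {u v} → Adjacent (e ∷ m ∷ E) u v → Joins e u v ⊎ (Joins m u v ⊎ Adjacent E u v)
      classify (_ , here refl , j)         = inj₁ j
      classify (_ , there (here refl) , j) = inj₂ (inj₁ j)
      classify (f , there (there f∈) , j)  = inj₂ (inj₂ (f , f∈ , j))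

      without-e : ∀ {u v} → Joins m u v ⊎ Adjacent E u v → Adjacent (m ∷ E) u v
      without-e (inj₁ j)            = m , here refl , j
      without-e (inj₂ (f , f∈ , j)) = f , there f∈ , j

      without-m : ∀ {u v} → Joins e u v ⊎ (Joins m u v ⊎ Adjacent E u v) → Joins m u v ⊎ Adjacent (e ∷ E) u v
      without-m (inj₁ j)                   = inj₂ (e , here refl , j)
      without-m (inj₂ (inj₁ j))            = inj₁ j
      without-m (inj₂ (inj₂ (f , f∈ , j))) = inj₂ (f , there f∈ , j)

    -- A cycle of length r + 2 has r edges besides `m` and `e`; they form two walks, one from each
    -- end of `m` to an end of `e`.
    ClosingPath : Fin n → Fin n → Set
    ClosingPath u v = ∃[ i ] ∃[ j ] (i + j ≡ r × ∃[ x ] ∃[ y ] (x ∈ walks E i u × y ∈ walks E j v × Joins e x y))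

    closingPath-sym : ∀ {u v} → ClosingPath u v → ClosingPath v u
    closingPath-sym (i , j , i+j≡r , x , y , x∈ , y∈ , jo) =
      j , i , trans (+-comm j i) i+j≡r , y , x , y∈ , x∈ , swap jo

    private
      -- The cycle is rotated so that `m` is its last step, from `g (suc r)` to `g k`, which equals
      -- `g 0`. By `no-m` some step q ≤ r uses `e`, and by `joins-once` neither edge occurs twice.
      -- So the steps before q form a walk in `E` from `g 0`, and those after q, reversed, a walk
      -- from `g (suc r)`.
      based-closingPath : 1 ≤ r → ∀ {g} → ClosedCycle k (e ∷ m ∷ E) g → Joins m (g (suc r)) (g k) →
        (∀ {g} → ¬ ClosedCycle k (m ∷ E) g) → ClosingPath (g 0) (g (suc r))
      based-closingPath 1≤r {g} c jm no-m with search (λ p → classify (step c p)) (suc r)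
      ... | inj₂ h = contradiction (restrict c all-m) no-m
        where
        all-m : ∀ p → p < k → Adjacent (m ∷ E) (g p) (g (suc p))
        all-m p p<k with m<1+n⇒m<n∨m≡n p<k
        ... | inj₁ p<  = without-e (h p p<)
        ... | inj₂ refl = m , here refl , jm
      ... | inj₁ (q , q<1+r , je) = q , j , q+j≡r , g q , g (suc q) ,
          walk-end q g (λ p p<q → rest p (<-trans p<q q<1+r) (<⇒≢ p<q)) ,
          subst₂ (λ a b → a ∈ walks E j b) (cong g (trans (cong (_∸ j) 1+r≡) (m+n∸n≡m (suc q) j))) refl
            (walk-end j (λ p → g (suc r ∸ p)) back) ,
          je
        where
        j = r ∸ q
        q+j≡r : q + j ≡ r
        q+j≡r = m+[n∸m]≡n (≤-pred q<1+r)
        1+r≡ : suc r ≡ suc q + j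
        1+r≡ = cong suc (sym q+j≡r)
        3≤k : 3 ≤ k
        3≤k = s≤s (s≤s 1≤r)
        rest : ∀ p → p < suc r → p ≢ q → Adjacent E (g p) (g (suc p))
        rest p p< p≢q with classify (step c p)
        ... | inj₂ (inj₂ a) = a
        ... | inj₂ (inj₁ a) = contradiction jm (joins-once {e = m} 3≤k c p< (n<1+n (suc r)) a)
        ... | inj₁ a with <-cmp p q
        ...   | tri< p<q _ _ = contradiction je (joins-once {e = e} 3≤k c p<q (m<n⇒m<1+n q<1+r) a)
        ...   | tri≈ _ p≡q _ = contradiction p≡q p≢q
        ...   | tri> _ _ q<p = contradiction a (joins-once {e = e} 3≤k c q<p (m<n⇒m<1+n p<) je)
        back : ∀ p → p < j → Adjacent E (g (suc r ∸ p)) (g (suc r ∸ suc p))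
        back p p<j = adjacent-sym (subst (λ x → Adjacent E (g (r ∸ p)) (g x)) (sym (+-∸-assoc 1 p≤r))
            (rest (r ∸ p) (s≤s (m∸n≤m r p)) λ eq → <-irrefl (sym eq) q<r∸p))
          where
          p≤r : p ≤ r
          p≤r = ≤-trans (<⇒≤ p<j) (m∸n≤m r q)
          q<r∸p : q < r ∸ p
          q<r∸p = m+n≤o⇒m≤o∸n (suc q) (subst (suc q + p ≤_) q+j≡r (subst (_≤ q + j) (+-suc q p) (+-monoʳ-≤ q p<j)))

    -- A cycle using both m and e consists of m, e and two walks in E joining an end of m to an end of e.
    closedCycle⇒closingPath : 1 ≤ r → ∀ {g} → ClosedCycle k (e ∷ m ∷ E) g →
      (∀ {g} → ¬ ClosedCycle k (m ∷ E) g) → (∀ {g} → ¬ ClosedCycle k (e ∷ E) g) → ClosingPath (lo m) (hi m)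
    closedCycle⇒closingPath 1≤r {g} c no-m no-e with search (λ p → without-m (classify (step c p))) k
    ... | inj₂ h = contradiction (restrict c h) no-e
    ... | inj₁ (q , _ , jm) = go jm (based-closingPath 1≤r (shift (suc q) c) jm′ no-m)
      where
      g′ : ℕ → Fin n
      g′ p = g (p + suc q)
      end : g′ (suc r) ≡ g q
      end = trans (cong g (cong suc (+-suc r q))) (periodic c q)
      end′ : g′ k ≡ g (suc q)
      end′ = periodic c (suc q)
      jm′ : Joins m (g′ (suc r)) (g′ k)
      jm′ = subst₂ (Joins m) (sym end) (sym end′) jm
      go : Joins m (g q) (g (suc q)) → ClosingPath (g′ 0) (g′ (suc r)) → ClosingPath (lo m) (hi m)
      go (inj₁ (a , b)) w = closingPath-sym (subst₂ ClosingPath (sym b) (trans end (sym a)) w)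
      go (inj₂ (a , b)) w = subst₂ ClosingPath (sym a) (trans end (sym b)) w

  -- Closing edges sorted by the length i of the walk from `lo m`: i = 0, i = ρ + 1, and 1 ≤ i ≤ ρ.
  -- Edges of the first two kinds touch an end of `m` and so lower its weight themselves; the middle
  -- ones need not help either end.
  closingFrom closingTo closingMiddle : ∀ {n} → ℕ → List (Edge n) → Edge n → List (Edge n)
  closingFrom ρ E m = edgesOf (lo m ∷ []) (walks E (suc ρ) (hi m))
  closingTo ρ E m = edgesOf (walks E (suc ρ) (lo m)) (hi m ∷ [])
  closingMiddle ρ E m = concatMap (λ i → edgesOf (walks E (suc i) (lo m)) (walks E (ρ ∸ i) (hi m))) (upTo ρ)

  ∈-closing : ∀ {n} ρ {E : List (Edge n)} {m e} → ClosingPath (suc ρ) {E} {m} {e} (lo m) (hi m) →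
              e ∈ closingFrom ρ E m ⊎ e ∈ closingTo ρ E m ⊎ e ∈ closingMiddle ρ E m
  ∈-closing ρ (zero , _ , refl , x , y , x∈ , y∈ , j) = inj₁ (∈-edgesOf j x∈ y∈)
  ∈-closing ρ {E} {m} {e} (suc i , j , eq , x , y , x∈ , y∈ , jo) with m≤n⇒m<n∨m≡n (m+n≤o⇒m≤o i (≤-reflexive (suc-injective eq)))
  ... | inj₂ refl = inj₂ (inj₁ (∈-edgesOf jo x∈ (subst (λ l → y ∈ walks E l (hi m)) j≡0 y∈)))
    where
    j≡0 : j ≡ 0
    j≡0 = +-cancelˡ-≡ i j 0 (trans (suc-injective eq) (sym (+-identityʳ i)))
  ... | inj₁ i<ρ = inj₂ (inj₂ (∈-concatMap⁺ (λ i → edgesOf (walks E (suc i) (lo m)) (walks E (ρ ∸ i) (hi m))) {xs = upTo ρ}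
    (lose (∈-upTo⁺ i<ρ) (∈-edgesOf jo x∈ (subst (λ l → y ∈ walks E l (hi m)) j≡ y∈)))))
    where
    j≡ : j ≡ ρ ∸ i
    j≡ = trans (sym (m+n∸m≡n i j)) (cong (_∸ i) (suc-injective eq))

  module _ {n Δ} (ρ : ℕ) (E : List (Edge n)) (deg≤Δ : ∀ v → deg E v ≤ Δ) (m : Edge n) where
    open ≤-Reasoning

    length-closingFrom : length (closingFrom ρ E m) ≤ deg E (hi m) * Δ ^ ρ
    length-closingFrom = begin
      length (closingFrom ρ E m)                ≤⟨ length-edgesOf (lo m ∷ []) (walks E (suc ρ) (hi m)) ⟩
      1 * length (walks E (suc ρ) (hi m))       ≡⟨ *-identityˡ _ ⟩
      length (walks E (suc ρ) (hi m))           ≤⟨ length-walks-suc E deg≤Δ ρ (hi m) ⟩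
      deg E (hi m) * Δ ^ ρ                      ∎

    length-closingTo : length (closingTo ρ E m) ≤ deg E (lo m) * Δ ^ ρ
    length-closingTo = begin
      length (closingTo ρ E m)                  ≤⟨ length-edgesOf (walks E (suc ρ) (lo m)) (hi m ∷ []) ⟩
      length (walks E (suc ρ) (lo m)) * 1       ≡⟨ *-identityʳ _ ⟩
      length (walks E (suc ρ) (lo m))           ≤⟨ length-walks-suc E deg≤Δ ρ (lo m) ⟩
      deg E (lo m) * Δ ^ ρ                      ∎

    private
      pieces : (b : ℕ) → (∀ i → i < ρ → length (walks E (suc i) (lo m)) * length (walks E (ρ ∸ i) (hi m)) ≤ b) →
               length (closingMiddle ρ E m) ≤ ρ * b
      pieces b h = ≤-trans
        (length-concatMap-≤ (λ i → edgesOf (walks E (suc i) (lo m)) (walks E (ρ ∸ i) (hi m))) (upTo ρ)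
          (All.tabulate λ {i} i∈ → ≤-trans (length-edgesOf (walks E (suc i) (lo m)) (walks E (ρ ∸ i) (hi m)))
            (h i (∈-upTo⁻ i∈))))
        (≤-reflexive (cong (_* b) (ListP.length-upTo ρ)))

    -- Both walks of a middle edge have positive length, so the first step of either one can be
    -- counted by the true degree of its starting vertex instead of Δ. Each end of `m` needs the
    -- version with its own degree.
    length-closingMiddle-lo : length (closingMiddle ρ E m) ≤ ρ * (deg E (lo m) * Δ ^ ρ)
    length-closingMiddle-lo = pieces (deg E (lo m) * Δ ^ ρ) λ i i<ρ → begin
      length (walks E (suc i) (lo m)) * length (walks E (ρ ∸ i) (hi m))
        ≤⟨ *-mono-≤ (length-walks-suc E deg≤Δ i (lo m)) (length-walks E deg≤Δ (ρ ∸ i) (hi m)) ⟩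
      deg E (lo m) * Δ ^ i * Δ ^ (ρ ∸ i)     ≡⟨ *-assoc (deg E (lo m)) (Δ ^ i) (Δ ^ (ρ ∸ i)) ⟩
      deg E (lo m) * (Δ ^ i * Δ ^ (ρ ∸ i))   ≡⟨ cong (deg E (lo m) *_) (sym (^-distribˡ-+-* Δ i (ρ ∸ i))) ⟩
      deg E (lo m) * Δ ^ (i + (ρ ∸ i))       ≡⟨ cong (λ x → deg E (lo m) * Δ ^ x) (m+[n∸m]≡n (<⇒≤ i<ρ)) ⟩
      deg E (lo m) * Δ ^ ρ                   ∎

    length-closingMiddle-hi : length (closingMiddle ρ E m) ≤ ρ * (deg E (hi m) * Δ ^ ρ)
    length-closingMiddle-hi = pieces (deg E (hi m) * Δ ^ ρ) λ i i<ρ → begin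
      length (walks E (suc i) (lo m)) * length (walks E (ρ ∸ i) (hi m))
        ≡⟨ cong (λ x → length (walks E (suc i) (lo m)) * length (walks E x (hi m))) (ρ∸i≡ i i<ρ) ⟩
      length (walks E (suc i) (lo m)) * length (walks E (suc (ρ ∸ suc i)) (hi m))
        ≤⟨ *-mono-≤ (length-walks E deg≤Δ (suc i) (lo m)) (length-walks-suc E deg≤Δ (ρ ∸ suc i) (hi m)) ⟩
      Δ ^ suc i * (deg E (hi m) * Δ ^ (ρ ∸ suc i))   ≡⟨ x∙yz≈y∙xz (Δ ^ suc i) (deg E (hi m)) _ ⟩
      deg E (hi m) * (Δ ^ suc i * Δ ^ (ρ ∸ suc i))   ≡⟨ cong (deg E (hi m) *_) (sym (^-distribˡ-+-* Δ (suc i) (ρ ∸ suc i))) ⟩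
      deg E (hi m) * Δ ^ (suc i + (ρ ∸ suc i))       ≡⟨ cong (λ x → deg E (hi m) * Δ ^ x) (m+[n∸m]≡n i<ρ) ⟩
      deg E (hi m) * Δ ^ ρ                           ∎
      where
      open import Algebra.Properties.CommutativeSemigroup *-commutativeSemigroup using (x∙yz≈y∙xz)
      ρ∸i≡ : ∀ i → i < ρ → ρ ∸ i ≡ suc (ρ ∸ suc i)
      ρ∸i≡ i i<ρ = +-∸-assoc 1 i<ρ

open Graphs

-- Sums over vertices, claiming from lists, and greedy replies.

module GreedyBreaker where
  open import Data.Fin using (zero; suc)
  open import Data.List.Relation.Unary.All using ([]; _∷_)
  open import Data.List.Relation.Unary.AllPairs using ([]; _∷_)
  open import Data.Rational using (ℚ; 0ℚ; 1ℚ; _+_; _*_; _-_; _≤_)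
  open import Data.Rational.Base using (+-*-rawSemiring)
  open import Data.Rational.Properties
  open Algebra.Definitions.RawSemiring +-*-rawSemiring using (_^_)
  open import Algebra.Properties.CommutativeMonoid.Sum +-0-commutativeMonoid using (sum; ∑-distrib-+; sum-replicate-zero)
  open import Data.List.Extrema (DecTotalOrder.totalOrder ≤-decTotalOrder)
    using (argmax; argmax-sel; f[⊥]≤f[argmax]; f[xs]≤f[argmax])

  sum-mono : ∀ {n} {f g : Fin n → ℚ} → (∀ i → f i ≤ g i) → sum f ≤ sum g
  sum-mono {zero}  h = ≤-refl
  sum-mono {suc n} h = +-mono-≤ (h zero) (sum-mono (h ∘ suc))

  0≤sum : ∀ {n} {f : Fin n → ℚ} → (∀ i → 0ℚ ≤ f i) → 0ℚ ≤ sum f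
  0≤sum {n} h = ≤-trans (≤-reflexive (sym (sum-replicate-zero n))) (sum-mono h)

  ≤sum : ∀ {n} {f : Fin n → ℚ} → (∀ i → 0ℚ ≤ f i) → ∀ i → f i ≤ sum f
  ≤sum h zero    = ≤+ (0≤sum (h ∘ suc))
  ≤sum {f = f} h (suc i) = ≤-trans (≤sum (h ∘ suc) i)
    (subst (sum (f ∘ suc) ≤_) (+-comm (sum (f ∘ suc)) (f zero)) (≤+ (h zero)))

  sum-const-1 : ∀ n → sum {n} (λ _ → 1ℚ) ≡ n ×ℚ 1ℚ
  sum-const-1 zero    = refl
  sum-const-1 (suc n) = trans (cong (1ℚ +_) (sum-const-1 n)) (+-comm 1ℚ (n ×ℚ 1ℚ))

  single : ∀ {n} → Fin n → ℚ → Fin n → ℚ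
  single zero    a zero    = a
  single zero    a (suc _) = 0ℚ
  single (suc _) a zero    = 0ℚ
  single (suc i) a (suc j) = single i a j

  single-≡ : ∀ {n} (i : Fin n) {a} → single i a i ≡ a
  single-≡ zero    = refl
  single-≡ (suc i) = single-≡ i

  single-≢ : ∀ {n} {i j : Fin n} {a} → i ≢ j → single i a j ≡ 0ℚ
  single-≢ {i = zero}  {zero}  i≢j = contradiction refl i≢j
  single-≢ {i = zero}  {suc j} i≢j = refl
  single-≢ {i = suc i} {zero}  i≢j = refl
  single-≢ {i = suc i} {suc j} i≢j = single-≢ (i≢j ∘ cong suc)

  sum-single : ∀ {n} (i : Fin n) a → sum (single i a) ≡ a
  sum-single {suc n} zero    a = trans (cong (a +_) (sum-replicate-zero n)) (+-identityʳ a)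
  sum-single {suc n} (suc i) a = trans (+-identityˡ _) (sum-single i a)

  sum-change₂ : ∀ {n} {f g : Fin n → ℚ} {i j a b} → i ≢ j → f i + a ≤ g i → f j + b ≤ g j →
                (∀ w → i ≢ w → j ≢ w → f w ≤ g w) → sum f + (a + b) ≤ sum g
  sum-change₂ {n} {f} {g} {i} {j} {a} {b} i≢j hi hj hw = begin
    sum f + (a + b)                                 ≡⟨ cong (sum f +_) (sym (cong₂ _+_ (sum-single i a) (sum-single j b))) ⟩
    sum f + (sum (single i a) + sum (single j b))   ≡⟨ cong (sum f +_) (sym (∑-distrib-+ (single i a) (single j b))) ⟩
    sum f + sum (λ w → single i a w + single j b w) ≡⟨ sym (∑-distrib-+ f (λ w → single i a w + single j b w)) ⟩
    sum (λ w → f w + (single i a w + single j b w)) ≤⟨ sum-mono pointwise ⟩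
    sum g                                           ∎
    where
    open ≤-Reasoning
    pointwise : ∀ w → f w + (single i a w + single j b w) ≤ g w
    pointwise w with i Fin.≟ w | j Fin.≟ w
    ... | yes refl | yes refl = contradiction refl i≢j
    ... | yes refl | no j≢w = subst (λ x → f w + x ≤ g w)
      (sym (trans (cong₂ _+_ (single-≡ w) (single-≢ j≢w)) (+-identityʳ a))) hi
    ... | no i≢w | yes refl = subst (λ x → f w + x ≤ g w)
      (sym (trans (cong₂ _+_ (single-≢ i≢w) (single-≡ w)) (+-identityˡ b))) hj
    ... | no i≢w | no j≢w = subst (λ x → f w + x ≤ g w)
      (sym (cong₂ _+_ (single-≢ {a = a} i≢w) (single-≢ {a = b} j≢w)))
      (≤-trans (≤-reflexive (+-identityʳ (f w))) (hw w i≢w j≢w))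

  deg-++ : ∀ {n} (E F : List (Edge n)) v → deg (E ++ F) v ≡ deg E v ℕ.+ deg F v
  deg-++ E F v = trans (cong length (ListP.filter-++ (touches? v) E F)) (ListP.length-++ (filter (touches? v) E))

  deg-∷-touches : ∀ {n} {E : List (Edge n)} {e v} → Touches v e → deg (e ∷ E) v ≡ suc (deg E v)
  deg-∷-touches {v = v} t = cong length (ListP.filter-accept (touches? v) t)

  deg-∷-¬touches : ∀ {n} {E : List (Edge n)} {e v} → ¬ Touches v e → deg (e ∷ E) v ≡ deg E v
  deg-∷-¬touches {v = v} t = cong length (ListP.filter-reject (touches? v) t)

  deg-all : ∀ {n} {E : List (Edge n)} {v} → All (Touches v) E → deg E v ≡ length E
  deg-all {v = v} h = cong length (ListP.filter-all (touches? v) h)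

  unique⇒lookup-injective : ∀ {A : Set} {xs : List A} → Unique xs → ∀ {i j} → lookup xs i ≡ lookup xs j → i ≡ j
  unique⇒lookup-injective (_ ∷ _)  {zero}  {zero}  eq = refl
  unique⇒lookup-injective (x∉ ∷ _) {zero}  {suc j} eq = contradiction eq (All.lookup x∉ (∈-lookup j))
  unique⇒lookup-injective (x∉ ∷ _) {suc i} {zero}  eq = contradiction (sym eq) (All.lookup x∉ (∈-lookup i))
  unique⇒lookup-injective (_ ∷ u)  {suc i} {suc j} eq = cong suc (unique⇒lookup-injective u eq)

  other-injective : ∀ {n} {v : Fin n} {e f} → Touches v e → Touches v f → other v e ≡ other v f → e ≡ f
  other-injective {v = v} {e} {f} te tf eq = edge-≡ (joins te) (joins tf) eq
    where
    joins : ∀ {e} → Touches v e → Joins e v (other v e)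
    joins {e} t with lo e Fin.≟ v
    joins {e} t         | yes p = inj₁ (p , refl)
    joins {e} (inj₁ p)  | no ¬p = contradiction p ¬p
    joins {e} (inj₂ p)  | no ¬p = inj₂ (refl , p)
    edge-≡ : ∀ {a b} → Joins e v a → Joins f v b → a ≡ b → e ≡ f
    edge-≡ j j′ refl with trans (sym (joins⇒edgeOf {e = e} j)) (joins⇒edgeOf {e = f} j′)
    ... | refl = refl

  deg≤n : ∀ {n} {E : List (Edge n)} → Unique E → ∀ v → deg E v ℕ.≤ n
  deg≤n {E = E} u v = FinP.injective⇒≤ {f = λ i → other v (lookup F i)} λ {i} {j} eq →
      unique⇒lookup-injective (UniqueP.filter⁺ (touches? v) u) (other-injective (touch i) (touch j) eq)
    where
    F = filter (touches? v) E
    touch : ∀ i → Touches v (lookup F i)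
    touch i = proj₂ (∈-filter⁻ (touches? v) {xs = E} (∈-lookup i))

  module _ {n : ℕ} where
    open DecMembership (_≟ᴱ_ {n}) using (_∈?_; _∉?_)

    claim : List (Edge n) → List (Edge n) → List (Edge n) → List (Edge n)
    claim T []       R = R
    claim T (e ∷ es) R with e ∈? R ++ T
    ... | yes _ = claim T es R
    ... | no  _ = claim T es (e ∷ R)

    Fresh : List (Edge n) → List (Edge n) → Set
    Fresh T R = Unique R × All (_∉ T) R

    fresh-∷ : ∀ {T R e} → e ∉ R ++ T → Fresh T R → Fresh T (e ∷ R)
    fresh-∷ {T} {R} {e} e∉ (u , a) =
      (All.tabulate (λ {x} x∈R e≡x → e∉ (∈-++⁺ˡ (subst (_∈ R) (sym e≡x) x∈R))) ∷ u) , (e∉ ∘ ∈-++⁺ʳ R) ∷ a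

    fresh-claim : ∀ T es {R} → Fresh T R → Fresh T (claim T es R)
    fresh-claim T []       fr = fr
    fresh-claim T (e ∷ es) {R} fr with e ∈? R ++ T
    ... | yes _ = fresh-claim T es fr
    ... | no e∉ = fresh-claim T es (fresh-∷ e∉ fr)

    -- Isolates the newly claimed part `R′`, so that it can be counted against `es` and inherits the
    -- incidences of `es`, even though earlier lists may already have claimed some of these edges.
    claim-++ : ∀ T es R → ∃[ R′ ] (claim T es R ≡ R′ ++ R × length R′ ℕ.≤ length es × All (_∈ es) R′)
    claim-++ T []       R = [] , refl , z≤n , []
    claim-++ T (e ∷ es) R with e ∈? R ++ T
    ... | yes _ with claim-++ T es R
    ...   | R′ , eq , le , h = R′ , eq , ℕP.m≤n⇒m≤1+n le , All.map there h
    claim-++ T (e ∷ es) R | no _ with claim-++ T es (e ∷ R)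
    ...   | R′ , eq , le , h = R′ ++ e ∷ [] , trans eq (sym (ListP.++-assoc R′ (e ∷ []) R))
            , subst (ℕ._≤ suc (length es)) (sym (trans (ListP.length-++ R′) (ℕP.+-comm (length R′) 1))) (s≤s le)
            , AllP.++⁺ (All.map there h) (here refl ∷ [])

    claim-⊇ : ∀ T es R {e} → e ∈ R → e ∈ claim T es R
    claim-⊇ T es R e∈ with claim-++ T es R
    ... | R′ , eq , _ = subst (_ ∈_) (sym eq) (∈-++⁺ʳ R′ e∈)

    claim-claims : ∀ T es R {e} → e ∈ es → e ∉ T → e ∈ claim T es R
    claim-claims T (x ∷ es) R e∈ e∉T with x ∈? R ++ T
    claim-claims T (x ∷ es) R (here refl) e∉T | yes x∈ = claim-⊇ T es R ([ (λ p → p) , (λ p → contradiction p e∉T) ]′ (∈-++⁻ R x∈))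
    claim-claims T (x ∷ es) R (there e∈)  e∉T | yes _ = claim-claims T es R e∈ e∉T
    claim-claims T (x ∷ es) R (here refl) e∉T | no _ = claim-⊇ T es (x ∷ R) (here refl)
    claim-claims T (x ∷ es) R (there e∈)  e∉T | no _ = claim-claims T es (x ∷ R) e∈ e∉T

    -- While Breaker replies, Maker's degrees are fixed and only the factors (1 - x)^b change. The
    -- Maker part of the weights can therefore be an arbitrary non-negative `U`.
    module Greedy (x : ℚ) (0≤x : 0ℚ ≤ x) (x≤1 : x ≤ 1ℚ) (U : Fin n → ℚ) (0≤U : ∀ v → 0ℚ ≤ U v) where

      potential : List (Edge n) → Fin n → ℚ
      potential B v = U v * (1ℚ - x) ^ deg B v

      total : List (Edge n) → ℚ
      total B = sum (potential B)

      value : List (Edge n) → Edge n → ℚ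
      value B e = potential B (lo e) + potential B (hi e)

      private
        y = 1ℚ - x
        0≤y : 0ℚ ≤ y
        0≤y = 0≤- x≤1
        y≤1 : y ≤ 1ℚ
        y≤1 = 1-x≤1 0≤x

      0≤potential : ∀ B v → 0ℚ ≤ potential B v
      0≤potential B v = 0≤* (0≤U v) (^-nonNeg (deg B v) 0≤y)

      0≤value : ∀ B e → 0ℚ ≤ value B e
      0≤value B e = 0≤+ (0≤potential B (lo e)) (0≤potential B (hi e))

      potential-antitone : ∀ R B v → potential (R ++ B) v ≤ potential B v
      potential-antitone R B v = *-monoʳ-≤₀ (U v) (0≤U v)
        (^-antitone 0≤y y≤1 (subst (deg B v ℕ.≤_) (sym (deg-++ R B v)) (ℕP.m≤n+m (deg B v) (deg R v))))

      value-antitone : ∀ R B e → value (R ++ B) e ≤ value B e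
      value-antitone R B e = +-mono-≤ (potential-antitone R B (lo e)) (potential-antitone R B (hi e))

      potential-∷-touches : ∀ B {e v} → Touches v e → potential (e ∷ B) v + x * potential B v ≡ potential B v
      potential-∷-touches B {e} {v} t = trans
        (cong (λ d → U v * y ^ d + x * (U v * y ^ deg B v)) (deg-∷-touches {E = B} t)) (lemma (U v) x (y ^ deg B v))
        where
        lemma : ∀ u x d → u * ((1ℚ - x) * d) + x * (u * d) ≡ u * d
        lemma = solve-∀ ℚ-ring

      total-∷ : ∀ B e → total (e ∷ B) + x * value B e ≤ total B
      total-∷ B e = subst (λ z → total (e ∷ B) + z ≤ total B) (sym (*-distribˡ-+ x _ _))
        (sum-change₂ (lo≢hi e) (≤-reflexive (potential-∷-touches B {e} (inj₁ refl)))
          (≤-reflexive (potential-∷-touches B {e} (inj₂ refl)))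
          λ w _ _ → potential-antitone (e ∷ []) B w)

      module _ (T B : List (Edge n)) where

        open-edges : List (Edge n) → List (Edge n)
        open-edges R = filter (_∉? (R ++ T)) (allEdges n)

        Bounds : List (Edge n) → ℚ → Set
        Bounds R M = ∀ e → e ∉ R ++ T → value (R ++ B) e ≤ M

        fill : ℕ → List (Edge n) → List (Edge n)
        fill zero    R = R
        fill (suc j) R with open-edges R
        ... | []     = R
        ... | e ∷ es = let best = argmax (value (R ++ B)) e es in fill j (best ∷ R)

        private
          open-edges-⁻ : ∀ R {e} → e ∈ open-edges R → e ∉ R ++ T
          open-edges-⁻ R e∈ = proj₂ (∈-filter⁻ (_∉? (R ++ T)) {xs = allEdges n} e∈)

          open-edges-⁺ : ∀ R {e} → e ∉ R ++ T → e ∈ open-edges R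
          open-edges-⁺ R {e} e∉ = ∈-filter⁺ (_∉? (R ++ T)) (∈-allEdges e) e∉

          best∈ : ∀ (f : Edge n → ℚ) e es → argmax f e es ∈ e ∷ es
          best∈ f e es with argmax-sel f e es
          ... | inj₁ eq = here eq
          ... | inj₂ p  = there p

          best-max : ∀ (f : Edge n → ℚ) e es {e′} → e′ ∈ e ∷ es → f e′ ≤ f (argmax f e es)
          best-max f e es (here refl) = f[⊥]≤f[argmax] {f = f} e es
          best-max f e es (there p)   = All.lookup (f[xs]≤f[argmax] {f = f} e es) p

        fresh-fill : ∀ j {R} → Fresh T R → Fresh T (fill j R)
        fresh-fill zero    fr = fr
        fresh-fill (suc j) {R} fr with open-edges R in eq
        ... | []     = fr
        ... | e ∷ es = fresh-fill j (fresh-∷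
          (open-edges-⁻ R (subst (argmax (value (R ++ B)) e es ∈_) (sym eq) (best∈ (value (R ++ B)) e es))) fr)

        length-fill : ∀ j R → length (fill j R) ℕ.≤ j ℕ.+ length R
        length-fill zero    R = ℕP.≤-refl
        length-fill (suc j) R with open-edges R
        ... | []     = ℕP.m≤n+m (length R) (suc j)
        ... | e ∷ es = ℕP.≤-trans (length-fill j _) (ℕP.≤-reflexive (ℕP.+-suc j (length R)))

        fill-⊇ : ∀ j R {e} → e ∈ R → e ∈ fill j R
        fill-⊇ zero    R e∈ = e∈
        fill-⊇ (suc j) R e∈ with open-edges R
        ... | []     = e∈
        ... | f ∷ fs = fill-⊇ j _ (there e∈)

        fill-nonempty : ∀ j R {e} → e ∉ R ++ T → 1 ℕ.≤ length (fill (suc j) R)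
        fill-nonempty j R e∉ with open-edges R | open-edges-⁺ R e∉
        ... | []     | ()
        ... | e ∷ es | _ = nonempty (fill-⊇ j _ (here refl))
          where
          nonempty : ∀ {e} {F : List (Edge n)} → e ∈ F → 1 ℕ.≤ length F
          nonempty (here _)  = s≤s z≤n
          nonempty (there _) = s≤s z≤n

        bound : List (Edge n) → ℚ
        bound R with open-edges R
        -- The default 0 matters: when the open edges run out before the budget, the greedy term in
        -- `total-fill` must vanish.
        ... | []     = 0ℚ
        ... | e ∷ es = value (R ++ B) (argmax (value (R ++ B)) e es)

        bounds-bound : ∀ R → Bounds R (bound R)
        bounds-bound R e e∉ with open-edges R | open-edges-⁺ R e∉
        ... | []      | ()
        ... | e′ ∷ es | e∈ = best-max (value (R ++ B)) e′ es e∈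

        0≤bound : ∀ R → 0ℚ ≤ bound R
        0≤bound R with open-edges R
        ... | []     = ≤-refl
        ... | e ∷ es = 0≤value (R ++ B) (argmax (value (R ++ B)) e es)

        bound-least : ∀ R {M} → 0ℚ ≤ M → Bounds R M → bound R ≤ M
        bound-least R 0≤M h with open-edges R in eq
        ... | []     = 0≤M
        ... | e ∷ es = h (argmax (value (R ++ B)) e es) (open-edges-⁻ R (subst (argmax (value (R ++ B)) e es ∈_) (sym eq) (best∈ (value (R ++ B)) e es)))

        bounds-∷ : ∀ {R M} e → Bounds R M → Bounds (e ∷ R) M
        bounds-∷ {R} e h f f∉ = ≤-trans (value-antitone (e ∷ []) (R ++ B) f) (h f (f∉ ∘ there))

        bounds-fill : ∀ j {R M} → Bounds R M → Bounds (fill j R) M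
        bounds-fill zero    h = h
        bounds-fill (suc j) {R} h with open-edges R
        ... | []     = h
        ... | e ∷ es = bounds-fill j (bounds-∷ _ h)

        -- Each edge added by the greedy choice is worth at least the best edge left open at the end.
        total-fill : ∀ j R → total (fill j R ++ B) + (j ×ℚ x) * bound (fill j R) ≤ total (R ++ B)
        total-fill zero    R = ≤-reflexive (trans (cong (total (R ++ B) +_) (*-zeroˡ (bound R))) (+-identityʳ _))
        total-fill (suc j) R with open-edges R in eq
        ... | []     = ≤-reflexive (trans (cong (λ z → total (R ++ B) + (suc j ×ℚ x) * z) bound≡0)
                         (trans (cong (total (R ++ B) +_) (*-zeroʳ (suc j ×ℚ x))) (+-identityʳ _)))
          where
          bound≡0 : bound R ≡ 0ℚ
          bound≡0 rewrite eq = refl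
        ... | e ∷ es = begin
          total (F ++ B) + (j ×ℚ x + x) * bound F             ≡⟨ lemma (total (F ++ B)) (j ×ℚ x) x (bound F) ⟩
          total (F ++ B) + (j ×ℚ x) * bound F + x * bound F   ≤⟨ +-mono-≤ (total-fill j (best ∷ R)) (*-monoʳ-≤₀ x 0≤x bound≤) ⟩
          total (best ∷ R ++ B) + x * value (R ++ B) best     ≤⟨ total-∷ (R ++ B) best ⟩
          total (R ++ B)                                      ∎
          where
          open ≤-Reasoning
          best = argmax (value (R ++ B)) e es
          F = fill j (best ∷ R)
          lemma : ∀ t a x b → t + (a + x) * b ≡ t + a * b + x * b
          lemma = solve-∀ ℚ-ring
          -- Values only fall while Breaker claims, and no edge becomes open again, so the maximum
          -- at the time of this choice still bounds every edge open at the end.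
          bound≤ : bound F ≤ value (R ++ B) best
          bound≤ = bound-least F (0≤value (R ++ B) best) (bounds-fill j {R = best ∷ R} (bounds-∷ {R} best λ f f∉ →
            best-max (value (R ++ B)) e es (subst (f ∈_) eq (open-edges-⁺ R f∉))))

open GreedyBreaker

-- Breaker's strategy and the invariant it preserves.

module CycleGame where
  open import Data.List.Relation.Unary.All using ([]; _∷_)
  open import Data.List.Relation.Unary.AllPairs using ([]; _∷_)
  open import Data.Rational using (ℚ; 0ℚ; 1ℚ; _+_; _*_; _-_; _≤_; _<_)
  open import Data.Rational.Base using (+-*-rawSemiring)
  open import Data.Rational.Properties
  open Algebra.Definitions.RawSemiring +-*-rawSemiring using (_^_)

  -- For one end of Maker's edge, `A` counts closing replies that touch it and `X` the other closing
  -- replies; the rest of `Q` is greedy. Only `X` is lost to this end, so at least Q - X replies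
  -- serve it. `Y` is the degree bound for `X`, and `S` the reserve.
  budget-≤ : ∀ Q A {X Y S} → X ℕ.≤ Y → Y ℕ.+ S ℕ.≤ Q → (Q ∸ (Y ℕ.+ S)) ℕ.+ S ℕ.≤ A ℕ.+ (Q ∸ (A ℕ.+ X))
  budget-≤ Q A {X} {Y} {S} X≤Y Y+S≤Q = begin
    (Q ∸ (Y ℕ.+ S)) ℕ.+ S        ≡⟨ cong (ℕ._+ S) (sym (ℕP.∸-+-assoc Q Y S)) ⟩
    (Q ∸ Y ∸ S) ℕ.+ S            ≡⟨ ℕP.m∸n+n≡m (ℕP.m+n≤o⇒m≤o∸n S (subst (ℕ._≤ Q) (ℕP.+-comm Y S) Y+S≤Q)) ⟩
    Q ∸ Y                        ≤⟨ ℕP.∸-monoʳ-≤ Q X≤Y ⟩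
    Q ∸ X                        ≤⟨ ℕP.m≤n+m∸n (Q ∸ X) A ⟩
    A ℕ.+ (Q ∸ X ∸ A)            ≡⟨ cong (A ℕ.+_) (trans (ℕP.∸-+-assoc Q X A) (cong (Q ∸_) (ℕP.+-comm X A))) ⟩
    A ℕ.+ (Q ∸ (A ℕ.+ X))        ∎
    where open ℕP.≤-Reasoning

  module Game {n : ℕ} (ρ Δ S : ℕ) (x : ℚ) (0≤x : 0ℚ ≤ x) (x≤1 : x ≤ 1ℚ) where

    P Q : ℕ
    P = Δ ℕ.^ ρ
    Q = suc (suc ρ) ℕ.* (Δ ℕ.* P)

    -- The number of Breaker edges at a vertex that pay for Maker raising its degree from d to d + 1. At
    -- most suc ρ * (d * P) of the closing edges come from walks leaving that vertex.
    c : ℕ → ℕ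
    c d = Q ∸ (suc ρ ℕ.* (d ℕ.* P) ℕ.+ S)

    up : ℕ → ℚ
    up zero    = 1ℚ
    up (suc d) = up d * (1ℚ + c d ×ℚ x)

    0≤up : ∀ d → 0ℚ ≤ up d
    0≤up zero    = <⇒≤ 0<1
    0≤up (suc d) = 0≤* (0≤up d) (0≤+ (<⇒≤ 0<1) (0≤×ℚ (c d) 0≤x))

    module At (E : List (Edge n)) = Greedy x 0≤x x≤1 (λ v → up (deg E v)) (λ v → 0≤up (deg E v))

    module _ (T E : List (Edge n)) (m : Edge n) where

      claim₁ claim₂ claim₃ : List (Edge n)
      claim₁ = claim T (closingFrom ρ E m) []
      claim₂ = claim T (closingTo ρ E m) claim₁
      claim₃ = claim T (closingMiddle ρ E m) claim₂

      fresh-claim₃ : Fresh T claim₃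
      fresh-claim₃ = fresh-claim T (closingMiddle ρ E m) (fresh-claim T (closingTo ρ E m)
        (fresh-claim T (closingFrom ρ E m) ([] , [])))

      ∈-claim₃ : ∀ {e} → ClosingPath (suc ρ) {E} {m} {e} (lo m) (hi m) → e ∉ T → e ∈ claim₃
      ∈-claim₃ {e} w e∉T with ∈-closing ρ {E} {m} {e} w
      ... | inj₁ p = claim-⊇ T (closingMiddle ρ E m) claim₂ (claim-⊇ T (closingTo ρ E m) claim₁
                       (claim-claims T (closingFrom ρ E m) [] p e∉T))
      ... | inj₂ (inj₁ p) = claim-⊇ T (closingMiddle ρ E m) claim₂
                       (claim-claims T (closingTo ρ E m) claim₁ p e∉T)
      ... | inj₂ (inj₂ p) = claim-claims T (closingMiddle ρ E m) claim₂ p e∉T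

      -- The three lists may overlap each other and the taken edges, so `a`, `b`, `c′` count only
      -- what each one newly contributes. The degrees are only bounded below, as edges from the
      -- other lists may touch the same end.
      record Split : Set where
        field
          a b c′      : ℕ
          length≡     : length claim₃ ≡ a ℕ.+ b ℕ.+ c′
          a≤deg       : a ℕ.≤ deg claim₃ (lo m)
          b≤deg       : b ℕ.≤ deg claim₃ (hi m)
          a≤          : a ℕ.≤ length (closingFrom ρ E m)
          b≤          : b ℕ.≤ length (closingTo ρ E m)
          c≤          : c′ ℕ.≤ length (closingMiddle ρ E m)

      split : Split
      split with claim-++ T (closingFrom ρ E m) [] | claim-++ T (closingTo ρ E m) claim₁
               | claim-++ T (closingMiddle ρ E m) claim₂
      ... | R₁ , eq₁ , l₁ , h₁ | R₂ , eq₂ , l₂ , h₂ | R₃ , eq₃ , l₃ , h₃ = record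
        { a = length R₁ ; b = length R₂ ; c′ = length R₃
        ; length≡ = length≡′
        ; a≤deg = subst (ℕ._≤ deg claim₃ (lo m)) (deg-all (All.map (All.lookup (edgesOf-touchesˡ (lo m) (walks E (suc ρ) (hi m)))) h₁)) deg₁
        ; b≤deg = subst (ℕ._≤ deg claim₃ (hi m)) (deg-all (All.map (All.lookup (edgesOf-touchesʳ (hi m) (walks E (suc ρ) (lo m)))) h₂)) deg₂
        ; a≤ = l₁ ; b≤ = l₂ ; c≤ = l₃ }
        where
        eq : claim₃ ≡ R₃ ++ (R₂ ++ R₁)
        eq = trans eq₃ (cong (R₃ ++_) (trans eq₂ (cong (R₂ ++_) (trans eq₁ (ListP.++-identityʳ R₁)))))
        length≡′ : length claim₃ ≡ length R₁ ℕ.+ length R₂ ℕ.+ length R₃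
        length≡′ = trans (cong length eq) (trans (ListP.length-++ R₃)
          (trans (ℕP.+-comm (length R₃) _) (cong (ℕ._+ length R₃)
            (trans (ListP.length-++ R₂) (ℕP.+-comm (length R₂) (length R₁))))))
        deg≡ : ∀ v → deg claim₃ v ≡ deg R₃ v ℕ.+ (deg R₂ v ℕ.+ deg R₁ v)
        deg≡ v = trans (cong (λ X → deg X v) eq) (trans (deg-++ R₃ _ v) (cong (deg R₃ v ℕ.+_) (deg-++ R₂ R₁ v)))
        deg₁ : deg R₁ (lo m) ℕ.≤ deg claim₃ (lo m)
        deg₁ = subst (deg R₁ (lo m) ℕ.≤_) (sym (deg≡ (lo m)))
          (ℕP.≤-trans (ℕP.m≤n+m _ (deg R₂ (lo m))) (ℕP.m≤n+m _ (deg R₃ (lo m))))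
        deg₂ : deg R₂ (hi m) ℕ.≤ deg claim₃ (hi m)
        deg₂ = subst (deg R₂ (hi m) ℕ.≤_) (sym (deg≡ (hi m)))
          (ℕP.≤-trans (ℕP.m≤m+n _ (deg R₁ (hi m))) (ℕP.m≤n+m _ (deg R₃ (hi m))))

    taken : History n → Edge n → List (Edge n)
    taken h m = m ∷ makerEdges h ++ breakerEdges h

    closing : History n → Edge n → List (Edge n)
    closing h m = claim₃ (taken h m) (makerEdges h) m

    strategy : BreakerStrategy n
    strategy h m = At.fill (m ∷ makerEdges h) (taken h m) (breakerEdges h) (Q ∸ length (closing h m)) (closing h m)

    κ : ℚ
    κ = Q ×ℚ x

    -- `κ²≤` lets the reserve pay the second-order cost of a round. In `heavy`, n + 2 κ is the value
    -- of Φ + κ M before the first move, and n bounds the Breaker degree of a vertex.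
    module Analysis (1≤Q : 1 ℕ.≤ Q) (S≤ : S ℕ.≤ Δ ℕ.* P) (κ²≤ : κ * κ + κ * κ + κ * κ ≤ S ×ℚ x)
      (heavy : ∀ d b → Δ ℕ.< d → b ℕ.≤ n → n ×ℚ 1ℚ + κ * (1ℚ + 1ℚ) < up d * (1ℚ - x) ^ b) where

      k : ℕ
      k = suc (suc (suc ρ))

      -- `safe` looks one Maker move ahead; applied to the edge Maker actually plays it yields
      -- `noCycle` for the next round. `unique` is what bounds Breaker degrees by n.
      record Invariant (h : History n) : Set where
        E : List (Edge n)
        E = makerEdges h
        B : List (Edge n)
        B = breakerEdges h
        field
          unique  : Unique B
          noCycle : ∀ {g} → ¬ ClosedCycle k E g
          safe    : ∀ {e} → e ∉ B → ∀ {g} → ¬ ClosedCycle k (e ∷ E) g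
          M       : ℚ
          0≤M     : 0ℚ ≤ M
          bounds  : ∀ e → ¬ Claimed h e → At.value E B e ≤ M
          small   : At.total E B + κ * M ≤ n ×ℚ 1ℚ + κ * (1ℚ + 1ℚ)

      0≤κ : 0ℚ ≤ κ
      0≤κ = 0≤×ℚ Q 0≤x

      -- A single weight is at most Φ, which `small` keeps below the threshold of `heavy`. The
      -- degree bound is thus a consequence of the potential and is not carried along separately.
      deg≤Δ : ∀ {h} → Invariant h → ∀ v → deg (makerEdges h) v ℕ.≤ Δ
      deg≤Δ {h} inv v with deg E v ℕ.≤? Δ
        where open Invariant inv
      ... | yes p = p
      ... | no ¬p = contradiction (<-≤-trans (heavy (deg E v) (deg B v) (ℕP.≰⇒> ¬p) (deg≤n unique v))
              (≤-trans (≤sum (At.0≤potential E B) v) (≤-trans (≤+ (0≤* 0≤κ 0≤M)) small))) (<-irrefl refl)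
        where open Invariant inv

      invariant-start : Invariant []
      invariant-start = record
        { unique = []
        ; noCycle = λ c → no-step (ClosedCycle.step c 0)
        ; safe = λ _ c → ℕP.<-irrefl refl (joins-step c)
        -- All weights are 1 at the start, so every edge has value 2.
        ; M = 1ℚ + 1ℚ
        ; 0≤M = 0≤+ (<⇒≤ 0<1) (<⇒≤ 0<1)
        ; bounds = λ e _ → ≤-refl
        ; small = ≤-reflexive (cong (_+ κ * (1ℚ + 1ℚ)) (sum-const-1 n))
        }
        where
        no-step : ∀ {u v} → ¬ Adjacent [] u v
        no-step (_ , () , _)
        only : ∀ {e u v} → Adjacent (e ∷ []) u v → Joins e u v
        only (_ , here refl , j) = j
        joins-step : ∀ {e g} → ClosedCycle k (e ∷ []) g → 0 ℕ.< 0
        joins-step {e} c = contradiction (only (ClosedCycle.step c 1))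
          (joins-once {e = e} (s≤s (s≤s (s≤s z≤n))) c (ℕP.n<1+n 0) (s≤s (s≤s z≤n)) (only (ClosedCycle.step c 0)))

      module Round {h : History n} (inv : Invariant h) (m : Edge n) (m-free : ¬ Claimed h m) where

        open Invariant inv
        open At E
        open DecMembership (_≟ᴱ_ {n}) using (_∈?_)
        module New = At (m ∷ E)

        T K F : List (Edge n)
        T = taken h m
        K = closing h m
        F = strategy h m

        open Split (split T E m)

        ∉T : ∀ {e} → e ∉ T → ¬ Claimed h e × e ≢ m
        ∉T e∉ = [ e∉ ∘ there ∘ ∈-++⁺ˡ , e∉ ∘ there ∘ ∈-++⁺ʳ E ]′ , λ e≡m → e∉ (here e≡m)

        available⇒∉T : ∀ {e} → Available h m e → e ∉ T
        available⇒∉T (¬c , e≢m) (here e≡m) = e≢m e≡m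
        available⇒∉T (¬c , e≢m) (there p)  = ¬c (∈-++⁻ E p)

        u v : Fin n
        u = lo m
        v = hi m

        du≤Δ : deg E u ℕ.≤ Δ
        du≤Δ = deg≤Δ inv u

        dv≤Δ : deg E v ℕ.≤ Δ
        dv≤Δ = deg≤Δ inv v

        a≤dv : a ℕ.≤ deg E v ℕ.* P
        a≤dv = ℕP.≤-trans a≤ (length-closingFrom ρ E (deg≤Δ inv) m)

        b≤du : b ℕ.≤ deg E u ℕ.* P
        b≤du = ℕP.≤-trans b≤ (length-closingTo ρ E (deg≤Δ inv) m)

        b+c≤ : b ℕ.+ c′ ℕ.≤ suc ρ ℕ.* (deg E u ℕ.* P)
        b+c≤ = ℕP.+-mono-≤ b≤du (ℕP.≤-trans c≤ (length-closingMiddle-lo ρ E (deg≤Δ inv) m))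

        a+c≤ : a ℕ.+ c′ ℕ.≤ suc ρ ℕ.* (deg E v ℕ.* P)
        a+c≤ = ℕP.+-mono-≤ a≤dv (ℕP.≤-trans c≤ (length-closingMiddle-hi ρ E (deg≤Δ inv) m))

        -- Of the ρ + 2 multiples of Δ P in `Q`, the walks leaving the vertex use at most ρ + 1 and
        -- the last one holds `S`. So the subtraction defining `c` is not truncated for d ≤ Δ.
        slack : ∀ {d} → d ℕ.≤ Δ → suc ρ ℕ.* (d ℕ.* P) ℕ.+ S ℕ.≤ Q
        slack d≤Δ = ℕP.≤-trans (ℕP.+-mono-≤ (ℕP.*-monoʳ-≤ (suc ρ) (ℕP.*-monoˡ-≤ P d≤Δ)) S≤)
          (ℕP.≤-reflexive (ℕP.+-comm (suc ρ ℕ.* (Δ ℕ.* P)) (Δ ℕ.* P)))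

        K≡ : length K ≡ a ℕ.+ (b ℕ.+ c′)
        K≡ = trans length≡ (ℕP.+-assoc a b c′)

        K≡′ : length K ≡ b ℕ.+ (a ℕ.+ c′)
        K≡′ = trans length≡ (trans (cong (ℕ._+ c′) (ℕP.+-comm a b)) (ℕP.+-assoc b a c′))

        K≤Q : length K ℕ.≤ Q
        K≤Q = subst (ℕ._≤ Q) (sym K≡) (ℕP.+-mono-≤ (ℕP.≤-trans a≤dv (ℕP.*-monoˡ-≤ P dv≤Δ))
          (ℕP.≤-trans b+c≤ (ℕP.*-monoʳ-≤ (suc ρ) (ℕP.*-monoˡ-≤ P du≤Δ))))

        fresh : Fresh T F
        fresh = New.fresh-fill T B (Q ∸ length K) (fresh-claim₃ T E m)

        F≤Q : length F ℕ.≤ Q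
        F≤Q = subst (length F ℕ.≤_) (ℕP.m∸n+n≡m K≤Q) (New.length-fill T B (Q ∸ length K) K)

        1≤F : ∃ (Available h m) → 1 ℕ.≤ length F
        1≤F (e , av) = go K
          where
          go : ∀ R → 1 ℕ.≤ length (New.fill T B (Q ∸ length R) R)
          go []      = positive-budget 1≤Q
            where
            positive-budget : ∀ {j} → 1 ℕ.≤ j → 1 ℕ.≤ length (New.fill T B j [])
            positive-budget {suc j} _ = New.fill-nonempty T B j [] (available⇒∉T av)
          go (f ∷ R) = nonempty (New.fill-⊇ T B (Q ∸ suc (length R)) (f ∷ R) (here refl))
            where
            nonempty : ∀ {G : List (Edge n)} → f ∈ G → 1 ℕ.≤ length G
            nonempty (here _)  = s≤s z≤n
            nonempty (there _) = s≤s z≤n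

        U V p s φ : ℚ
        U = (1ℚ + c (deg E u) ×ℚ x) * (1ℚ - x) ^ a
        V = (1ℚ + c (deg E v) ×ℚ x) * (1ℚ - x) ^ b
        p = potential B u
        s = potential B v
        φ = (Q ∸ length K) ×ℚ x

        0≤p : 0ℚ ≤ p
        0≤p = 0≤potential B u

        0≤s : 0ℚ ≤ s
        0≤s = 0≤potential B v

        0≤1-x : 0ℚ ≤ 1ℚ - x
        0≤1-x = 0≤- x≤1

        c≤Q : ∀ d → c d ℕ.≤ Q
        c≤Q d = ℕP.m∸n≤m Q (suc ρ ℕ.* (d ℕ.* P) ℕ.+ S)

        end-potential : ∀ {w j} → Touches w m → j ℕ.≤ deg K w →
          New.potential (K ++ B) w ≤ potential B w * ((1ℚ + c (deg E w) ×ℚ x) * (1ℚ - x) ^ j)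
        end-potential {w} {j} t j≤ = begin
          up (deg (m ∷ E) w) * y ^ deg (K ++ B) w
            ≡⟨ cong₂ (λ d b → up d * y ^ b) (deg-∷-touches {E = E} t) (deg-++ K B w) ⟩
          up (deg E w) * (1ℚ + c (deg E w) ×ℚ x) * y ^ (deg K w ℕ.+ deg B w)
            ≤⟨ *-monoʳ-≤₀ _ (0≤up (suc (deg E w))) (^-antitone 0≤1-x (1-x≤1 0≤x) (ℕP.+-monoˡ-≤ (deg B w) j≤)) ⟩
          up (deg E w) * (1ℚ + c (deg E w) ×ℚ x) * y ^ (j ℕ.+ deg B w)
            ≡⟨ cong (up (deg E w) * (1ℚ + c (deg E w) ×ℚ x) *_) (^-homo-+ y j (deg B w)) ⟩
          up (deg E w) * (1ℚ + c (deg E w) ×ℚ x) * (y ^ j * y ^ deg B w)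
            ≡⟨ lemma (up (deg E w)) (1ℚ + c (deg E w) ×ℚ x) (y ^ j) (y ^ deg B w) ⟩
          potential B w * ((1ℚ + c (deg E w) ×ℚ x) * y ^ j)  ∎
          where
          open ≤-Reasoning
          y = 1ℚ - x
          lemma : ∀ a b c d → a * b * (c * d) ≡ a * d * (b * c)
          lemma = solve-∀ ℚ-ring

        rest-potential : ∀ w → u ≢ w → v ≢ w → New.potential (K ++ B) w ≤ potential B w
        rest-potential w u≢w v≢w = subst (λ d → up d * (1ℚ - x) ^ deg (K ++ B) w ≤ potential B w)
          (sym (deg-∷-¬touches {E = E} {m} {w} [ u≢w , v≢w ]′)) (potential-antitone K B w)

        total-closing : New.total (K ++ B) + (p + s) ≤ total B + (p * U + s * V)
        total-closing = ≤-trans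
          (≤-reflexive (lemma₁ (New.total (K ++ B)) p s (p * U) (s * V)))
          (+-monoˡ-≤ (p * U + s * V) (sum-change₂ (lo≢hi m)
            (≤-trans (+-monoˡ-≤ (p - p * U) (end-potential (inj₁ refl) a≤deg)) (≤-reflexive (lemma₂ p (p * U))))
            (≤-trans (+-monoˡ-≤ (s - s * V) (end-potential (inj₂ refl) b≤deg)) (≤-reflexive (lemma₂ s (s * V))))
            rest-potential))
          where
          lemma₁ : ∀ t p s pU sV → t + (p + s) ≡ t + ((p - pU) + (s - sV)) + (pU + sV)
          lemma₁ = solve-∀ ℚ-ring
          lemma₂ : ∀ p pU → pU + (p - pU) ≡ p
          lemma₂ = solve-∀ ℚ-ring

        grown-factor : ∀ d → (1ℚ + c d ×ℚ x) * 1ℚ ≤ 1ℚ + κ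
        grown-factor d = ≤-trans (≤-reflexive (*-identityʳ _)) (+-monoʳ-≤ 1ℚ (×ℚ-mono-≤ 0≤x (c≤Q d)))

        -- Only the ends of `m` can grow, each by a factor of at most 1 + κ. Allowing the same
        -- increment κ (p + s) at every vertex bounds the growth of any edge value by 2 κ (p + s),
        -- without asking how the edge meets `m`.
        grown : ∀ w → New.potential (K ++ B) w ≤ potential B w + κ * (p + s)
        grown w = by-cases (u Fin.≟ w) (v Fin.≟ w)
          where
          lemma₁ : ∀ p s κ → p * (1ℚ + κ) + κ * s ≡ p + κ * (p + s)
          lemma₁ = solve-∀ ℚ-ring
          lemma₂ : ∀ p s κ → s * (1ℚ + κ) + κ * p ≡ s + κ * (p + s)
          lemma₂ = solve-∀ ℚ-ring
          by-cases : Dec (u ≡ w) → Dec (v ≡ w) → New.potential (K ++ B) w ≤ potential B w + κ * (p + s)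
          by-cases (yes refl) _ = ≤-trans (end-potential {u} {0} (inj₁ refl) z≤n)
            (≤-trans (*-monoʳ-≤₀ p 0≤p (grown-factor (deg E u))) (≤-cert (0≤* 0≤κ 0≤s) (lemma₁ p s κ)))
          by-cases (no _) (yes refl) = ≤-trans (end-potential {v} {0} (inj₂ refl) z≤n)
            (≤-trans (*-monoʳ-≤₀ s 0≤s (grown-factor (deg E v))) (≤-cert (0≤* 0≤κ 0≤p) (lemma₂ p s κ)))
          by-cases (no u≢w) (no v≢w) = ≤-trans (rest-potential w u≢w v≢w) (≤+ (0≤* 0≤κ (0≤+ 0≤p 0≤s)))

        M′ : ℚ
        M′ = New.bound T B F

        bounds-closing : New.Bounds T B K (M + (κ + κ) * (p + s))
        bounds-closing e e∉ = ≤-trans (+-mono-≤ (grown (lo e)) (grown (hi e)))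
          (≤-trans (≤-reflexive (lemma (potential B (lo e)) (potential B (hi e)) κ (p + s)))
            (+-monoˡ-≤ ((κ + κ) * (p + s)) (bounds e (proj₁ (∉T (e∉ ∘ ∈-++⁺ʳ K))))))
          where
          lemma : ∀ a b κ t → a + κ * t + (b + κ * t) ≡ a + b + (κ + κ) * t
          lemma = solve-∀ ℚ-ring

        M′≤ : M′ ≤ M + (κ + κ) * (p + s)
        M′≤ = New.bound-least T B F (0≤+ 0≤M (0≤* (0≤+ 0≤κ 0≤κ) (0≤+ 0≤p 0≤s)))
          (New.bounds-fill T B (Q ∸ length K) bounds-closing)

        -- The rate `c d` gained by an end is matched by the `j` closing replies at it together with
        -- all greedy replies; the part `S` withheld in `c` absorbs the second-order terms.
        drift : ∀ {d i} j → d ℕ.≤ Δ → length K ≡ j ℕ.+ i → i ℕ.≤ suc ρ ℕ.* (d ℕ.* P) →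
                c d ×ℚ x + (κ * κ + κ * κ + κ * κ) ≤ j ×ℚ x + φ
        drift {d} {i} j d≤Δ K≡j+i i≤ = begin
          c d ×ℚ x + (κ * κ + κ * κ + κ * κ)    ≤⟨ +-monoʳ-≤ (c d ×ℚ x) κ²≤ ⟩
          c d ×ℚ x + S ×ℚ x                     ≡⟨ sym (×ℚ-homo-+ (c d) S x) ⟩
          (c d ℕ.+ S) ×ℚ x                      ≤⟨ ×ℚ-mono-≤ 0≤x (budget-≤ Q j i≤ (slack d≤Δ)) ⟩
          (j ℕ.+ (Q ∸ (j ℕ.+ i))) ×ℚ x          ≡⟨ cong (λ l → (j ℕ.+ (Q ∸ l)) ×ℚ x) (sym K≡j+i) ⟩
          (j ℕ.+ (Q ∸ length K)) ×ℚ x           ≡⟨ ×ℚ-homo-+ j (Q ∸ length K) x ⟩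
          j ×ℚ x + φ                            ∎
          where open ≤-Reasoning

        total-round : New.total (F ++ B) + κ * M′ ≤ total B + κ * M
        total-round = round-inequality {Φ = total B} {Φ₂ = New.total (F ++ B)} {p} {s} {M′ = M′} {κ} {φ} {U} {V}
          {c (deg E u) ×ℚ x} {a ×ℚ x} {c (deg E v) ×ℚ x} {b ×ℚ x}
          0≤p 0≤s (0≤×ℚ (Q ∸ length K) 0≤x) (×ℚ-mono-≤ 0≤x (ℕP.m∸n≤m Q (length K)))
          (New.total-fill T B (Q ∸ length K) K) total-closing
          (touched-bound (c (deg E u)) a 0≤x x≤1 (ℕP.≤-trans (subst (a ℕ.≤_) (sym K≡) (ℕP.m≤m+n a _)) K≤Q))
          (touched-bound (c (deg E v)) b 0≤x x≤1 (ℕP.≤-trans (subst (b ℕ.≤_) (sym K≡′) (ℕP.m≤m+n b _)) K≤Q))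
          M′≤ (bounds m m-free) (drift a du≤Δ K≡ b+c≤) (drift b dv≤Δ K≡′ a+c≤)

        next : Invariant ((m , F) ∷ h)
        next = record
          { unique  = UniqueP.++⁺ (proj₁ fresh) unique λ { (e∈F , e∈B) →
              All.lookup (proj₂ fresh) e∈F (there (∈-++⁺ʳ E e∈B)) }
          ; noCycle = safe (m-free ∘ inj₂)
          -- `m` was safe and so was `e`, hence a cycle in `e ∷ m ∷ E` uses both; then `e` is a
          -- closing edge and has been claimed.
          ; safe    = λ e∉ cyc → caught e∉ (closedCycle⇒closingPath (suc ρ) (s≤s z≤n) cyc
              (safe (m-free ∘ inj₂)) (safe (e∉ ∘ ∈-++⁺ʳ F))) cyc
          ; M       = M′
          ; 0≤M     = New.0≤bound T B F
          ; bounds  = λ e ¬cl → New.bounds-bound T B F e (unclaimed ¬cl)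
          ; small   = ≤-trans total-round small
          }
          where
          unclaimed : ∀ {e} → ¬ Claimed ((m , F) ∷ h) e → e ∉ F ++ T
          unclaimed ¬cl e∈ with ∈-++⁻ F e∈
          ... | inj₁ e∈F         = ¬cl (inj₂ (∈-++⁺ˡ e∈F))
          ... | inj₂ (here refl) = ¬cl (inj₁ (here refl))
          ... | inj₂ (there e∈′) = ¬cl ([ inj₁ ∘ there , inj₂ ∘ ∈-++⁺ʳ F ]′ (∈-++⁻ E e∈′))
          absorb : ∀ {e G g} → e ∈ G → ClosedCycle k (e ∷ G) g → ClosedCycle k G g
          absorb {e} {G} e∈G cyc = restrict cyc λ p _ → weaken (ClosedCycle.step cyc p)
            where
            weaken : ∀ {x y} → Adjacent (e ∷ G) x y → Adjacent G x y
            weaken (f , here refl , j) = f , e∈G , j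
            weaken (f , there f∈ , j)  = f , f∈ , j
          caught : ∀ {e g} → e ∉ F ++ B → ClosingPath (suc ρ) {E} {m} {e} (lo m) (hi m) →
                   ¬ ClosedCycle k (e ∷ m ∷ E) g
          caught {e} e∉ w cyc with e ∈? m ∷ E
          -- Here `e` is already Maker's and adds nothing, so the safety of `m` applies.
          ... | yes e∈ = safe (m-free ∘ inj₂) (absorb e∈ cyc)
          ... | no e∉′ = e∉ (∈-++⁺ˡ (New.fill-⊇ T B (Q ∸ length K) K (∈-claim₃ T E m w e∉T)))
            where
            e∉T : e ∉ T
            e∉T (here eq) = e∉′ (here eq)
            e∉T (there q) = [ e∉′ ∘ there , e∉ ∘ ∈-++⁺ʳ F ]′ (∈-++⁻ E q)

      invariant : ∀ {h} → Play strategy h → Invariant h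
      invariant start             = invariant-start
      invariant (round play free) = Round.next (invariant play) _ free

      strategy-wins : ∀ q → (∀ j → j ℕ.≤ Q → fromℕ j ≤ᴿ q) → IsWinning k q strategy
      strategy-wins q affordable = record
        { legal = λ {h} {e} play free → let open Round (invariant play) e free in record
            { distinct  = proj₁ fresh
            ; available = All.map ∉T (proj₂ fresh)
            ; atMost    = affordable (length F) F≤Q
            ; atLeast   = 1≤F
            }
        ; wins = λ play _ copy → Invariant.noCycle (invariant play) (proj₂ (copy⇒closedCycle copy))
        }

open CycleGame

-- Choice of parameters, and why a vertex of large degree is too heavy.

module VertexWeights where
  open import Data.Rational using (ℚ; 0ℚ; 1ℚ; _+_; _*_; _-_; _≤_; _<_)
  open import Data.Rational.Base using (+-*-rawSemiring)
  open import Data.Rational.Properties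
  open Algebra.Definitions.RawSemiring +-*-rawSemiring using (_^_)

  sumTo : (ℕ → ℕ) → ℕ → ℕ
  sumTo f zero    = 0
  sumTo f (suc j) = sumTo f j ℕ.+ f j

  -- Sums f(d) ≥ q - r d - s over d < j, using that twice the sum of the d is at most j². Everything
  -- is doubled and kept additive, so neither halves nor truncated differences appear. The induction
  -- step pads with r because (j + 1)² = j² + 2 j + 1.
  sumTo-linear : ∀ (f : ℕ → ℕ) q r s → (∀ d → q ℕ.≤ f d ℕ.+ (r ℕ.* d ℕ.+ s)) → ∀ j →
    2 ℕ.* (q ℕ.* j) ℕ.≤ 2 ℕ.* sumTo f j ℕ.+ (r ℕ.* (j ℕ.* j) ℕ.+ 2 ℕ.* (s ℕ.* j))
  sumTo-linear f q r s h zero rewrite ℕP.*-zeroʳ q = z≤n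
  sumTo-linear f q r s h (suc j) = begin
    2 ℕ.* (q ℕ.* suc j)                  ≡⟨ e₁ q j ⟩
    2 ℕ.* (q ℕ.* j) ℕ.+ 2 ℕ.* q          ≤⟨ ℕP.+-mono-≤ (sumTo-linear f q r s h j) (ℕP.*-monoʳ-≤ 2 (h j)) ⟩
    2 ℕ.* sumTo f j ℕ.+ (r ℕ.* (j ℕ.* j) ℕ.+ 2 ℕ.* (s ℕ.* j)) ℕ.+ 2 ℕ.* (f j ℕ.+ (r ℕ.* j ℕ.+ s))
                                         ≤⟨ ℕP.m≤m+n _ r ⟩
    2 ℕ.* sumTo f j ℕ.+ (r ℕ.* (j ℕ.* j) ℕ.+ 2 ℕ.* (s ℕ.* j)) ℕ.+ 2 ℕ.* (f j ℕ.+ (r ℕ.* j ℕ.+ s)) ℕ.+ r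
                                         ≡⟨ e₂ (sumTo f j) (f j) r s j ⟩
    2 ℕ.* (sumTo f j ℕ.+ f j) ℕ.+ (r ℕ.* (suc j ℕ.* suc j) ℕ.+ 2 ℕ.* (s ℕ.* suc j)) ∎
    where
    open ℕP.≤-Reasoning
    e₁ : ∀ q j → 2 ℕ.* (q ℕ.* suc j) ≡ 2 ℕ.* (q ℕ.* j) ℕ.+ 2 ℕ.* q
    e₁ = ℕ-solve-∀
    e₂ : ∀ F f r s j → 2 ℕ.* F ℕ.+ (r ℕ.* (j ℕ.* j) ℕ.+ 2 ℕ.* (s ℕ.* j)) ℕ.+ 2 ℕ.* (f ℕ.+ (r ℕ.* j ℕ.+ s)) ℕ.+ r
      ≡ 2 ℕ.* (F ℕ.+ f) ℕ.+ (r ℕ.* (suc j ℕ.* suc j) ℕ.+ 2 ℕ.* (s ℕ.* suc j))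
    e₂ = ℕ-solve-∀

  module Parameters (n ρ g y : ℕ) where

    -- With x = 1 / L these choices give 3 (Q x)² = S x for Breaker's budget Q = e Δ P.
    e k R t Δ P S L D : ℕ
    e = suc (suc ρ)
    k = suc e
    R = 3 ℕ.* (e ℕ.* e ℕ.* (g ℕ.* g))
    t = R ℕ.* y
    Δ = g ℕ.* t
    P = Δ ℕ.^ ρ
    S = P ℕ.* t
    L = R ℕ.* S
    D = Δ ℕ.* (Δ ℕ.* P)

    module Positivity (3≤g : 3 ℕ.≤ g) (1≤y : 1 ℕ.≤ y) where

      1≤g : 1 ℕ.≤ g
      1≤g = ℕP.≤-trans (s≤s z≤n) 3≤g

      *-pos : ∀ {a b} → 1 ℕ.≤ a → 1 ℕ.≤ b → 1 ℕ.≤ a ℕ.* b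
      *-pos = ℕP.*-mono-≤

      1≤R : 1 ℕ.≤ R
      1≤R = *-pos {3} (s≤s z≤n) (*-pos {e ℕ.* e} (s≤s z≤n) (*-pos 1≤g 1≤g))

      1≤t : 1 ℕ.≤ t
      1≤t = *-pos 1≤R 1≤y

      1≤Δ : 1 ℕ.≤ Δ
      1≤Δ = *-pos 1≤g 1≤t

      1≤P : 1 ℕ.≤ P
      1≤P = subst (ℕ._≤ P) (ℕP.^-zeroˡ ρ) (ℕP.^-monoˡ-≤ ρ 1≤Δ)

      1≤L : 1 ℕ.≤ L
      1≤L = *-pos 1≤R (*-pos 1≤P 1≤t)

    -- Since D = g S Δ, dividing `room` by 2 g gives n + 3 S Δ ≤ k D / 2: the sum of the rates must
    -- exceed n even after the reserve is charged three times per level.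
    module Weights (3≤g : 3 ℕ.≤ g) (1≤y : 1 ℕ.≤ y) (room : 2 ℕ.* (g ℕ.* n) ℕ.+ 6 ℕ.* D ℕ.≤ k ℕ.* (g ℕ.* D))
      (large : suc (suc n) ℕ.≤ y ℕ.^ g) (x : ℚ) (0≤x : 0ℚ ≤ x) (L×x≡1 : L ×ℚ x ≡ 1ℚ) where

      open Positivity 3≤g 1≤y
      ≤L⇒≤1 : ∀ {m} → m ℕ.≤ L → m ×ℚ x ≤ 1ℚ
      ≤L⇒≤1 m≤L = ≤-trans (×ℚ-mono-≤ 0≤x m≤L) (≤-reflexive L×x≡1)

      x≤1 : x ≤ 1ℚ
      x≤1 = ≤-trans (≤-reflexive (sym (+-identityˡ x))) (≤L⇒≤1 1≤L)

      open Game {n} ρ Δ S x 0≤x x≤1 hiding (P)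

      1≤Q : 1 ℕ.≤ Q
      1≤Q = *-pos {e} (s≤s z≤n) (*-pos 1≤Δ 1≤P)

      3S≤ : 3 ℕ.* S ℕ.≤ Δ ℕ.* P
      3S≤ = ℕP.≤-trans (ℕP.*-monoˡ-≤ S 3≤g) (ℕP.≤-reflexive (rearrange g P t))
        where
        rearrange : ∀ g P t → g ℕ.* (P ℕ.* t) ≡ g ℕ.* t ℕ.* P
        rearrange = ℕ-solve-∀

      S≤ : S ℕ.≤ Δ ℕ.* P
      S≤ = ℕP.≤-trans (ℕP.m≤n*m S 3) 3S≤

      3Q²≡SL : 3 ℕ.* (Q ℕ.* Q) ≡ S ℕ.* L
      3Q²≡SL = rearrange e g t P
        where
        rearrange : ∀ e g t P → 3 ℕ.* (e ℕ.* (g ℕ.* t ℕ.* P) ℕ.* (e ℕ.* (g ℕ.* t ℕ.* P)))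
          ≡ P ℕ.* t ℕ.* (3 ℕ.* (e ℕ.* e ℕ.* (g ℕ.* g)) ℕ.* (P ℕ.* t))
        rearrange = ℕ-solve-∀

      κ²≡ : κ * κ + κ * κ + κ * κ ≡ S ×ℚ x
      κ²≡ = begin
        κ * κ + κ * κ + κ * κ                  ≡⟨ cong (λ z → z + κ * κ + κ * κ) (sym (+-identityˡ (κ * κ))) ⟩
        3 ×ℚ (κ * κ)                           ≡⟨ cong (3 ×ℚ_) (trans (×ℚ-*ˡ Q x κ) (cong (Q ×ℚ_) (×ℚ-*ʳ Q x x))) ⟩
        3 ×ℚ (Q ×ℚ (Q ×ℚ (x * x)))             ≡⟨ cong (3 ×ℚ_) (sym (×ℚ-*-assoc Q Q (x * x))) ⟩
        3 ×ℚ ((Q ℕ.* Q) ×ℚ (x * x))            ≡⟨ sym (×ℚ-*-assoc 3 (Q ℕ.* Q) (x * x)) ⟩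
        (3 ℕ.* (Q ℕ.* Q)) ×ℚ (x * x)           ≡⟨ cong (_×ℚ (x * x)) 3Q²≡SL ⟩
        (S ℕ.* L) ×ℚ (x * x)                   ≡⟨ ×ℚ-*-assoc S L (x * x) ⟩
        S ×ℚ (L ×ℚ (x * x))                    ≡⟨ cong (S ×ℚ_) (sym (×ℚ-*ˡ L x x)) ⟩
        S ×ℚ ((L ×ℚ x) * x)                    ≡⟨ cong (S ×ℚ_) (trans (cong (_* x) L×x≡1) (*-identityˡ x)) ⟩
        S ×ℚ x                                 ∎
        where open ≡-Reasoning

      σ : ℚ
      σ = S ×ℚ x

      0≤σ : 0ℚ ≤ σ
      0≤σ = 0≤×ℚ S 0≤x

      0≤κ : 0ℚ ≤ κ
      0≤κ = 0≤×ℚ Q 0≤x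

      κ²≤σ : κ * κ ≤ σ
      κ²≤σ = ≤-trans (≤-cert (0≤+ (0≤* 0≤κ 0≤κ) (0≤* 0≤κ 0≤κ)) (sym (+-assoc (κ * κ) (κ * κ) (κ * κ))))
        (≤-reflexive κ²≡)

      R×σ≡1 : R ×ℚ σ ≡ 1ℚ
      R×σ≡1 = trans (sym (×ℚ-*-assoc R S x)) L×x≡1

      2κ≤1 : κ * (1ℚ + 1ℚ) ≤ 1ℚ
      2κ≤1 = ≤-trans (≤-reflexive (trans (lemma κ) (sym (×ℚ-homo-+ Q Q x)))) (≤L⇒≤1 (begin
        Q ℕ.+ Q                                   ≡⟨ e₁ e g t P ⟩
        2 ℕ.* (e ℕ.* g ℕ.* (P ℕ.* t))             ≤⟨ ℕP.*-mono-≤ {2} {3} (s≤s (s≤s z≤n))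
                                                       (ℕP.m≤n*m (e ℕ.* g ℕ.* (P ℕ.* t)) (e ℕ.* g) {{ℕ.>-nonZero (*-pos {e} (s≤s z≤n) 1≤g)}}) ⟩
        3 ℕ.* (e ℕ.* g ℕ.* (e ℕ.* g ℕ.* (P ℕ.* t))) ≡⟨ e₂ e g t P ⟩
        L                                         ∎))
        where
        open ℕP.≤-Reasoning
        lemma : ∀ κ → κ * (1ℚ + 1ℚ) ≡ κ + κ
        lemma = solve-∀ ℚ-ring
        e₁ : ∀ e g t P → e ℕ.* (g ℕ.* t ℕ.* P) ℕ.+ e ℕ.* (g ℕ.* t ℕ.* P) ≡ 2 ℕ.* (e ℕ.* g ℕ.* (P ℕ.* t))
        e₁ = ℕ-solve-∀
        e₂ : ∀ e g t P → 3 ℕ.* (e ℕ.* g ℕ.* (e ℕ.* g ℕ.* (P ℕ.* t))) ≡ 3 ℕ.* (e ℕ.* e ℕ.* (g ℕ.* g)) ℕ.* (P ℕ.* t)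
        e₂ = ℕ-solve-∀

      -- Number of Breaker edges at a vertex outweighed by Maker's edge at level d with factor 1 + σ to spare.
      m : ℕ → ℕ
      m d = c d ∸ 2 ℕ.* S

      2S≤c : ∀ {d} → d ℕ.< Δ → 2 ℕ.* S ℕ.≤ c d
      2S≤c {d} d<Δ = ℕP.m+n≤o⇒m≤o∸n (2 ℕ.* S) (begin
        2 ℕ.* S ℕ.+ (suc ρ ℕ.* (d ℕ.* P) ℕ.+ S)      ≡⟨ e₁ S (suc ρ ℕ.* (d ℕ.* P)) ⟩
        3 ℕ.* S ℕ.+ suc ρ ℕ.* (d ℕ.* P)              ≤⟨ ℕP.+-mono-≤ 3S≤ (ℕP.*-monoʳ-≤ (suc ρ) (ℕP.*-monoˡ-≤ P (ℕP.<⇒≤ d<Δ))) ⟩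
        Q                                            ∎)
        where
        open ℕP.≤-Reasoning
        e₁ : ∀ S a → 2 ℕ.* S ℕ.+ (a ℕ.+ S) ≡ 3 ℕ.* S ℕ.+ a
        e₁ = ℕ-solve-∀

      0≤1-x : 0ℚ ≤ 1ℚ - x
      0≤1-x = 0≤- x≤1

      -- With C = c(d) x and M = m(d) x, the product (1 + C)(1 - M) equals 1 + (C - M) - C M. Here C
      -- - M = 2 σ and C M ≤ κ² ≤ σ, so one of the two reserves subtracted in `m` pays the product
      -- and the other remains as gain.
      level-factor : ∀ {d} → d ℕ.< Δ → 1ℚ + σ ≤ (1ℚ + c d ×ℚ x) * (1ℚ - x) ^ m d
      level-factor {d} d<Δ = begin
        1ℚ + σ                        ≤⟨ ≤-cert (0≤- κ²≤σ) (e₁ σ κ) ⟩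
        1ℚ + (σ + σ) - κ * κ          ≤⟨ +-monoʳ-≤ (1ℚ + (σ + σ)) (neg-antimono-≤ CM≤κ²) ⟩
        1ℚ + (σ + σ) - C * M          ≡⟨ cong (λ z → 1ℚ + z - C * M) σ+σ≡ ⟩
        1ℚ + (C - M) - C * M          ≡⟨ e₂ C M ⟩
        (1ℚ + C) * (1ℚ - M)           ≤⟨ *-monoʳ-≤₀ (1ℚ + C) (0≤+ (<⇒≤ 0<1) (0≤×ℚ (c d) 0≤x)) (bernoulli-minus (m d) 0≤x x≤1) ⟩
        (1ℚ + C) * (1ℚ - x) ^ m d     ∎
        where
        open ≤-Reasoning
        C M : ℚ
        C = c d ×ℚ x
        M = m d ×ℚ x
        c≤Q : c d ℕ.≤ Q
        c≤Q = ℕP.m∸n≤m Q (suc ρ ℕ.* (d ℕ.* P) ℕ.+ S)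
        CM≤κ² : C * M ≤ κ * κ
        CM≤κ² = *-mono-≤₀ (0≤×ℚ (c d) 0≤x) 0≤κ (×ℚ-mono-≤ 0≤x c≤Q)
          (×ℚ-mono-≤ 0≤x (ℕP.≤-trans (ℕP.m∸n≤m (c d) (2 ℕ.* S)) c≤Q))
        C≡ : C ≡ M + (σ + σ)
        C≡ = trans (cong (_×ℚ x) (sym (ℕP.m∸n+n≡m (2S≤c d<Δ)))) (trans (×ℚ-homo-+ (m d) (2 ℕ.* S) x)
          (cong (M +_) (trans (×ℚ-homo-+ S (S ℕ.+ 0) x) (cong (λ s → σ + s ×ℚ x) (ℕP.+-identityʳ S)))))
        σ+σ≡ : σ + σ ≡ C - M
        σ+σ≡ = sym (trans (cong (_- M) C≡) (e₃ M (σ + σ)))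
          where
          e₃ : ∀ M s → M + s - M ≡ s
          e₃ = solve-∀ ℚ-ring
        e₁ : ∀ σ κ → 1ℚ + σ + (σ - κ * κ) ≡ 1ℚ + (σ + σ) - κ * κ
        e₁ = solve-∀ ℚ-ring
        e₂ : ∀ C M → 1ℚ + (C - M) - C * M ≡ (1ℚ + C) * (1ℚ - M)
        e₂ = solve-∀ ℚ-ring

      level-product : ∀ j → j ℕ.≤ Δ → (1ℚ + σ) ^ j ≤ up j * (1ℚ - x) ^ sumTo m j
      level-product zero    _   = ≤-reflexive (sym (*-identityˡ 1ℚ))
      level-product (suc j) j<Δ = begin
        (1ℚ + σ) * (1ℚ + σ) ^ j
          ≤⟨ *-mono-≤₀ (0≤+ (<⇒≤ 0<1) 0≤σ) (0≤* (0≤up j) (^-nonNeg (sumTo m j) 0≤1-x))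
               (level-factor j<Δ) (level-product j (ℕP.<⇒≤ j<Δ)) ⟩
        (1ℚ + c j ×ℚ x) * (1ℚ - x) ^ m j * (up j * (1ℚ - x) ^ sumTo m j)
          ≡⟨ rearrange (1ℚ + c j ×ℚ x) ((1ℚ - x) ^ m j) (up j) ((1ℚ - x) ^ sumTo m j) ⟩
        up j * (1ℚ + c j ×ℚ x) * ((1ℚ - x) ^ sumTo m j * (1ℚ - x) ^ m j)
          ≡⟨ cong (up (suc j) *_) (sym (^-homo-+ (1ℚ - x) (sumTo m j) (m j))) ⟩
        up (suc j) * (1ℚ - x) ^ (sumTo m j ℕ.+ m j)   ∎
        where
        open ≤-Reasoning
        rearrange : ∀ a b c d → a * b * (c * d) ≡ c * a * (d * b)
        rearrange = solve-∀ ℚ-ring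

      -- The sum is at least e D - (ρ + 1) D / 2 - 3 S Δ. As 2 e - (ρ + 1) = k, this is k D / 2 - 3
      -- S Δ, which `room` compares with n.
      n≤sum : n ℕ.≤ sumTo m Δ
      n≤sum = ℕP.*-cancelˡ-≤ (2 ℕ.* g) {{ℕ.>-nonZero (*-pos {2} (s≤s z≤n) 1≤g)}} (ℕP.+-cancelʳ-≤ X _ _ (begin
        2 ℕ.* g ℕ.* n ℕ.+ X                                           ≡⟨ e₁ g n D ρ ⟩
        2 ℕ.* (g ℕ.* n) ℕ.+ 6 ℕ.* D ℕ.+ suc ρ ℕ.* (g ℕ.* D)           ≤⟨ ℕP.+-monoˡ-≤ (suc ρ ℕ.* (g ℕ.* D)) room ⟩
        k ℕ.* (g ℕ.* D) ℕ.+ suc ρ ℕ.* (g ℕ.* D)                       ≡⟨ e₂ g t P ρ ⟩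
        g ℕ.* (2 ℕ.* (Q ℕ.* Δ))                                       ≤⟨ ℕP.*-monoʳ-≤ g (sumTo-linear m Q (suc ρ ℕ.* P) (3 ℕ.* S) covers Δ) ⟩
        g ℕ.* (2 ℕ.* Σm ℕ.+ (suc ρ ℕ.* P ℕ.* (Δ ℕ.* Δ) ℕ.+ 2 ℕ.* (3 ℕ.* S ℕ.* Δ))) ≡⟨ e₃ g t P ρ Σm ⟩
        2 ℕ.* g ℕ.* Σm ℕ.+ X                                          ∎))
        where
        open ℕP.≤-Reasoning
        X Σm : ℕ
        X = 6 ℕ.* D ℕ.+ suc ρ ℕ.* (g ℕ.* D)
        Σm = sumTo m Δ
        covers : ∀ d → Q ℕ.≤ m d ℕ.+ (suc ρ ℕ.* P ℕ.* d ℕ.+ 3 ℕ.* S)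
        covers d = begin
          Q                                               ≤⟨ ℕP.m≤n+m∸n Q Y ⟩
          Y ℕ.+ c d                                       ≤⟨ ℕP.+-monoʳ-≤ Y (ℕP.m≤n+m∸n (c d) (2 ℕ.* S)) ⟩
          Y ℕ.+ (2 ℕ.* S ℕ.+ m d)                         ≡⟨ e₄ (suc ρ) d P S (m d) ⟩
          m d ℕ.+ (suc ρ ℕ.* P ℕ.* d ℕ.+ 3 ℕ.* S)         ∎
          where
          Y = suc ρ ℕ.* (d ℕ.* P) ℕ.+ S
          e₄ : ∀ r d P S m → r ℕ.* (d ℕ.* P) ℕ.+ S ℕ.+ (2 ℕ.* S ℕ.+ m) ≡ m ℕ.+ (r ℕ.* P ℕ.* d ℕ.+ 3 ℕ.* S)
          e₄ = ℕ-solve-∀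
        e₁ : ∀ g n D ρ → 2 ℕ.* g ℕ.* n ℕ.+ (6 ℕ.* D ℕ.+ suc ρ ℕ.* (g ℕ.* D))
                         ≡ 2 ℕ.* (g ℕ.* n) ℕ.+ 6 ℕ.* D ℕ.+ suc ρ ℕ.* (g ℕ.* D)
        e₁ = ℕ-solve-∀
        e₂ : ∀ g t P ρ → suc (suc (suc ρ)) ℕ.* (g ℕ.* (g ℕ.* t ℕ.* (g ℕ.* t ℕ.* P))) ℕ.+ suc ρ ℕ.* (g ℕ.* (g ℕ.* t ℕ.* (g ℕ.* t ℕ.* P)))
                         ≡ g ℕ.* (2 ℕ.* (suc (suc ρ) ℕ.* (g ℕ.* t ℕ.* P) ℕ.* (g ℕ.* t)))
        e₂ = ℕ-solve-∀
        e₃ : ∀ g t P ρ Σm → g ℕ.* (2 ℕ.* Σm ℕ.+ (suc ρ ℕ.* P ℕ.* (g ℕ.* t ℕ.* (g ℕ.* t)) ℕ.+ 2 ℕ.* (3 ℕ.* (P ℕ.* t) ℕ.* (g ℕ.* t))))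
          ≡ 2 ℕ.* g ℕ.* Σm ℕ.+ (6 ℕ.* (g ℕ.* t ℕ.* (g ℕ.* t ℕ.* P)) ℕ.+ suc ρ ℕ.* (g ℕ.* (g ℕ.* t ℕ.* (g ℕ.* t ℕ.* P))))
        e₃ = ℕ-solve-∀

      up-mono : ∀ {d d′} → d ℕ.≤′ d′ → up d ≤ up d′
      up-mono (ℕ.≤′-reflexive refl) = ≤-refl
      up-mono (ℕ.≤′-step {d′} p) = ≤-trans (up-mono p)
        (≤-trans (≤-reflexive (sym (*-identityʳ (up d′)))) (*-monoʳ-≤₀ (up d′) (0≤up d′) (≤+ (0≤×ℚ (c d′) 0≤x))))

      -- Bernoulli over all Δ = g t factors would give only growth linear in y. Over blocks of t = R
      -- y factors it gives at least y per block, as R σ = 1, and the g blocks multiply to y^g.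
      large-power : suc (suc n) ×ℚ 1ℚ ≤ (1ℚ + σ) ^ Δ
      large-power = begin
        suc (suc n) ×ℚ 1ℚ        ≤⟨ ×ℚ-mono-≤ (<⇒≤ 0<1) large ⟩
        (y ℕ.^ g) ×ℚ 1ℚ          ≡⟨ ×ℚ-homo-^ y g ⟩
        (y ×ℚ 1ℚ) ^ g            ≤⟨ ^-mono-≤ g (0≤×ℚ y (<⇒≤ 0<1)) y≤ ⟩
        ((1ℚ + σ) ^ t) ^ g       ≡⟨ sym (^-homo-* (1ℚ + σ) g t) ⟩
        (1ℚ + σ) ^ Δ             ∎
        where
        open ≤-Reasoning
        y≤ : y ×ℚ 1ℚ ≤ (1ℚ + σ) ^ t
        y≤ = begin
          y ×ℚ 1ℚ                ≡⟨ cong (y ×ℚ_) (sym R×σ≡1) ⟩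
          y ×ℚ (R ×ℚ σ)          ≡⟨ sym (×ℚ-*-assoc y R σ) ⟩
          (y ℕ.* R) ×ℚ σ         ≡⟨ cong (_×ℚ σ) (ℕP.*-comm y R) ⟩
          t ×ℚ σ                 ≤⟨ ≤-cert (<⇒≤ 0<1) (+-comm (t ×ℚ σ) 1ℚ) ⟩
          1ℚ + t ×ℚ σ            ≤⟨ bernoulli t 0≤σ ⟩
          (1ℚ + σ) ^ t           ∎

      -- At most n ≤ ∑ m(j) Breaker edges meet a vertex, so they cannot cancel more than
      -- `level-product` allows. What remains is (1 + σ)^Δ ≥ n + 2, whereas the starting value n + 2
      -- κ is at most n + 1.
      heavy : ∀ d b → Δ ℕ.< d → b ℕ.≤ n → n ×ℚ 1ℚ + κ * (1ℚ + 1ℚ) < up d * (1ℚ - x) ^ b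
      heavy d b Δ<d b≤n = begin-strict
        n ×ℚ 1ℚ + κ * (1ℚ + 1ℚ)              ≤⟨ +-monoʳ-≤ (n ×ℚ 1ℚ) 2κ≤1 ⟩
        suc n ×ℚ 1ℚ                          ≡⟨ sym (+-identityʳ (suc n ×ℚ 1ℚ)) ⟩
        suc n ×ℚ 1ℚ + 0ℚ                     <⟨ +-monoʳ-< (suc n ×ℚ 1ℚ) 0<1 ⟩
        suc (suc n) ×ℚ 1ℚ                    ≤⟨ large-power ⟩
        (1ℚ + σ) ^ Δ                         ≤⟨ level-product Δ ℕP.≤-refl ⟩
        up Δ * (1ℚ - x) ^ sumTo m Δ          ≤⟨ *-mono-≤₀ (0≤up Δ) (^-nonNeg b 0≤1-x)
                                                  (up-mono (ℕP.≤⇒≤′ (ℕP.<⇒≤ Δ<d)))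
                                                  (^-antitone 0≤1-x (1-x≤1 0≤x) (ℕP.≤-trans b≤n n≤sum)) ⟩
        up d * (1ℚ - x) ^ b                  ∎
        where open ≤-Reasoning

      winning-strategy : ∀ q → (∀ j → j ℕ.≤ Q → fromℕ j ≤ᴿ q) → BreakerWins (suc (suc (suc ρ))) n q
      winning-strategy q affordable = strategy ,
        Analysis.strategy-wins 1≤Q S≤ (≤-reflexive κ²≡) heavy q affordable

    breaker-wins : 3 ℕ.≤ g → 1 ℕ.≤ y → 2 ℕ.* (g ℕ.* n) ℕ.+ 6 ℕ.* D ℕ.≤ k ℕ.* (g ℕ.* D) → suc (suc n) ℕ.≤ y ℕ.^ g →
      ∀ q → (∀ j → j ℕ.≤ e ℕ.* (Δ ℕ.* P) → fromℕ j ≤ᴿ q) → BreakerWins (suc (suc (suc ρ))) n q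
    breaker-wins 3≤g 1≤y room large q affordable = from-inverse (shrink 0<L 0<1)
      where
      0<L : 0ℚ < L ×ℚ 1ℚ
      0<L = <-≤-trans 0<1 (≤-trans (≤-reflexive (sym (+-identityˡ 1ℚ)))
        (×ℚ-mono-≤ {1} {L} (<⇒≤ 0<1) (Positivity.1≤L 3≤g 1≤y)))
      from-inverse : ∃[ x ] (0ℚ < x × (L ×ℚ 1ℚ) * x ≡ 1ℚ) → BreakerWins (suc (suc (suc ρ))) n q
      from-inverse (x , 0<x , eq) = Weights.winning-strategy 3≤g 1≤y room large x (<⇒≤ 0<x)
        (trans (cong (L ×ℚ_) (sym (*-identityˡ x))) (trans (sym (×ℚ-*ˡ L 1ℚ x)) eq)) q affordable

open VertexWeights

-- Choosing y for given n, and comparing the budget with the real bias.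

module Thresholds where
  open import Data.Integer using (+_)
  open import Data.Rational using (ℚ; 0ℚ; 1ℚ; _+_; _*_; _≤_; _<_; _/_; _⊔_; toℚᵘ; positive)
  open import Data.Rational.Base using (+-*-rawSemiring)
  open import Data.Rational.Properties
  open Algebra.Definitions.RawSemiring +-*-rawSemiring using (_^_)

  last-below : ∀ (f : ℕ → ℕ) {m} a j → f a ℕ.≤ m → m ℕ.< f (a ℕ.+ j) → ∃[ y ] (a ℕ.≤ y × f y ℕ.≤ m × m ℕ.< f (suc y))
  last-below f a zero    lo hi = contradiction (ℕP.<-≤-trans (subst (λ b → _ ℕ.< f b) (ℕP.+-identityʳ a) hi) lo) (ℕP.<-irrefl refl)
  last-below f {m} a (suc j) lo hi with f (a ℕ.+ j) ℕ.≤? m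
  ... | yes p = a ℕ.+ j , ℕP.m≤m+n a j , p , subst (λ b → m ℕ.< f b) (ℕP.+-suc a j) hi
  ... | no ¬p = last-below f a j lo (ℕP.≰⇒> ¬p)

  1≤*ℕ : ∀ {a b} → 1 ℕ.≤ a → 1 ℕ.≤ b → 1 ℕ.≤ a ℕ.* b
  1≤*ℕ = ℕP.*-mono-≤

  1≤^ℕ : ∀ {a} d → 1 ℕ.≤ a → 1 ℕ.≤ a ℕ.^ d
  1≤^ℕ zero    1≤a = ℕP.≤-refl
  1≤^ℕ (suc d) 1≤a = 1≤*ℕ 1≤a (1≤^ℕ d 1≤a)

  -- The mean value bound (y + 1)^d - y^d ≤ d (y + 1)^(d-1), multiplied by y + 1 to avoid the
  -- exponent d - 1.
  suc^≤ : ∀ y d → suc y ℕ.^ suc d ℕ.≤ y ℕ.^ d ℕ.* suc y ℕ.+ d ℕ.* suc y ℕ.^ d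
  suc^≤ y zero    = ℕP.≤-reflexive (e y)
    where
    e : ∀ y → suc y ℕ.* 1 ≡ 1 ℕ.* suc y ℕ.+ 0
    e = ℕ-solve-∀
  suc^≤ y (suc d) = begin
    suc y ℕ.* (suc y ℕ.* Z)                                 ≤⟨ ℕP.*-monoʳ-≤ (suc y) (suc^≤ y d) ⟩
    suc y ℕ.* (Y ℕ.* suc y ℕ.+ d ℕ.* Z)                     ≡⟨ e₁ y Y d Z ⟩
    y ℕ.* Y ℕ.* suc y ℕ.+ d ℕ.* (suc y ℕ.* Z) ℕ.+ Y ℕ.* suc y ≤⟨ ℕP.+-monoʳ-≤ _ (ℕP.*-monoˡ-≤ (suc y) (ℕP.^-monoˡ-≤ d (ℕP.n≤1+n y))) ⟩
    y ℕ.* Y ℕ.* suc y ℕ.+ d ℕ.* (suc y ℕ.* Z) ℕ.+ Z ℕ.* suc y ≡⟨ e₂ y Y d Z ⟩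
    y ℕ.* Y ℕ.* suc y ℕ.+ suc d ℕ.* (suc y ℕ.* Z)           ∎
    where
    open ℕP.≤-Reasoning
    Y Z : ℕ
    Y = y ℕ.^ d
    Z = suc y ℕ.^ d
    e₁ : ∀ y Y d Z → suc y ℕ.* (Y ℕ.* suc y ℕ.+ d ℕ.* Z) ≡ y ℕ.* Y ℕ.* suc y ℕ.+ d ℕ.* (suc y ℕ.* Z) ℕ.+ Y ℕ.* suc y
    e₁ = ℕ-solve-∀
    e₂ : ∀ y Y d Z → y ℕ.* Y ℕ.* suc y ℕ.+ d ℕ.* (suc y ℕ.* Z) ℕ.+ Z ℕ.* suc y ≡ y ℕ.* Y ℕ.* suc y ℕ.+ suc d ℕ.* (suc y ℕ.* Z)
    e₂ = ℕ-solve-∀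

  suc^-ratio : ∀ C y d → suc C ℕ.* d ℕ.≤ suc y → C ℕ.* suc y ℕ.^ d ℕ.≤ suc C ℕ.* y ℕ.^ d
  suc^-ratio C y d h = ℕP.*-cancelˡ-≤ (suc y) (ℕP.+-cancelʳ-≤ (suc y ℕ.* Z) _ _ (begin
    suc y ℕ.* (C ℕ.* Z) ℕ.+ suc y ℕ.* Z                  ≡⟨ e₁ C y Z ⟩
    suc C ℕ.* (suc y ℕ.* Z)                              ≤⟨ ℕP.*-monoʳ-≤ (suc C) (suc^≤ y d) ⟩
    suc C ℕ.* (Y ℕ.* suc y ℕ.+ d ℕ.* Z)                  ≡⟨ e₂ C y d Y Z ⟩
    suc y ℕ.* (suc C ℕ.* Y) ℕ.+ suc C ℕ.* d ℕ.* Z        ≤⟨ ℕP.+-monoʳ-≤ _ (ℕP.*-monoˡ-≤ Z h) ⟩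
    suc y ℕ.* (suc C ℕ.* Y) ℕ.+ suc y ℕ.* Z              ∎))
    where
    open ℕP.≤-Reasoning
    Y Z : ℕ
    Y = y ℕ.^ d
    Z = suc y ℕ.^ d
    e₁ : ∀ C y Z → suc y ℕ.* (C ℕ.* Z) ℕ.+ suc y ℕ.* Z ≡ suc C ℕ.* (suc y ℕ.* Z)
    e₁ = ℕ-solve-∀
    e₂ : ∀ C y d Y Z → suc C ℕ.* (Y ℕ.* suc y ℕ.+ d ℕ.* Z) ≡ suc y ℕ.* (suc C ℕ.* Y) ℕ.+ suc C ℕ.* d ℕ.* Z
    e₂ = ℕ-solve-∀

  ^-distribʳ-*ℕ : ∀ a b d → (a ℕ.* b) ℕ.^ d ≡ a ℕ.^ d ℕ.* b ℕ.^ d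
  ^-distribʳ-*ℕ a b zero    = refl
  ^-distribʳ-*ℕ a b (suc d) = trans (cong (a ℕ.* b ℕ.*_) (^-distribʳ-*ℕ a b d)) (e a b (a ℕ.^ d) (b ℕ.^ d))
    where
    e : ∀ a b x y → a ℕ.* b ℕ.* (x ℕ.* y) ≡ a ℕ.* x ℕ.* (b ℕ.* y)
    e = ℕ-solve-∀

  -- G y is the degree bound Δ, e is k - 1, and the fraction A / B stands for β. The second
  -- condition makes Δ large enough to keep Maker's degrees below it; the last makes Δ small enough
  -- for Breaker's bias.
  Scale : (e g G A B n y : ℕ) → Set
  Scale e g G A B n y = 1 ℕ.≤ y
    × 2 ℕ.* (g ℕ.* n) ℕ.+ 6 ℕ.* (G ℕ.* y) ℕ.^ e ℕ.≤ suc e ℕ.* (g ℕ.* (G ℕ.* y) ℕ.^ e)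
    × suc (suc n) ℕ.≤ y ℕ.^ g
    × B ℕ.* (e ℕ.* (G ℕ.* y) ℕ.^ e) ℕ.≤ A ℕ.* n

  -- y is the largest value with B e (G y)ᵉ ≤ A n; the lower bound on G y then holds because
  -- (y + 1)ᵉ / yᵉ tends to 1.
  scale-exists : ∀ r g G A B → 1 ℕ.≤ G → 1 ℕ.≤ A → 1 ℕ.≤ B → suc (6 ℕ.* A) ℕ.≤ g → suc (suc r) ℕ.≤ g →
    suc (2 ℕ.* (suc r ℕ.* B)) ℕ.≤ A ℕ.* suc (suc r) → ∃[ N ] (∀ n → N ℕ.< n → ∃ (Scale (suc r) g G A B n))
  scale-exists r g G A B 1≤G 1≤A 1≤B 6A<g k≤g gap = f Y , λ n N<n →
    from-last n (last-below f Y (suc (A ℕ.* n))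
      (ℕP.≤-trans (ℕP.<⇒≤ N<n) (ℕP.m≤n*m n A {{ℕ.>-nonZero 1≤A}}))
      (ℕP.≤-trans (ℕP.m≤n+m (suc (A ℕ.* n)) Y) (id≤f (Y ℕ.+ suc (A ℕ.* n)))))
    where
    e C Y : ℕ
    e = suc r
    -- `C` is the coefficient of (y + 1)^e in `room` apart from G^e. Passing from y + 1 to y raises
    -- it only to C + 1, and this 1 together with 6 A is absorbed by g.
    C = 2 ℕ.* (g ℕ.* (e ℕ.* B))
    -- The first summand makes y exceed the constant factor in `large`; the second is the condition
    -- of `suc^-ratio`.
    Y = suc (suc (suc e ℕ.* G ℕ.^ e)) ℕ.+ suc C ℕ.* e
    f : ℕ → ℕ
    f y = B ℕ.* (e ℕ.* (G ℕ.* y) ℕ.^ e)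
    1≤g : 1 ℕ.≤ g
    1≤g = ℕP.≤-trans (s≤s z≤n) k≤g
    id≤f : ∀ y → y ℕ.≤ f y
    id≤f zero      = z≤n
    id≤f y@(suc _) = begin
      y                          ≤⟨ ℕP.m≤n*m y G {{ℕ.>-nonZero 1≤G}} ⟩
      G ℕ.* y                    ≤⟨ ℕP.m≤m*n (G ℕ.* y) ((G ℕ.* y) ℕ.^ r) {{ℕ.>-nonZero (1≤^ℕ r (1≤*ℕ 1≤G (s≤s z≤n)))}} ⟩
      (G ℕ.* y) ℕ.^ e            ≤⟨ ℕP.m≤n*m ((G ℕ.* y) ℕ.^ e) e ⟩
      e ℕ.* (G ℕ.* y) ℕ.^ e      ≤⟨ ℕP.m≤n*m (e ℕ.* (G ℕ.* y) ℕ.^ e) B {{ℕ.>-nonZero 1≤B}} ⟩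
      f y                        ∎
      where open ℕP.≤-Reasoning
    from-last : ∀ n → ∃[ y ] (Y ℕ.≤ y × f y ℕ.≤ A ℕ.* n × A ℕ.* n ℕ.< f (suc y)) → ∃ (Scale e g G A B n)
    from-last n (y , Y≤y , below , above) = y , 1≤y , room , large , below
      where
      open ℕP.≤-Reasoning
      D H : ℕ
      D = (G ℕ.* y) ℕ.^ e
      H = G ℕ.^ e
      1≤y : 1 ℕ.≤ y
      1≤y = ℕP.≤-trans (s≤s z≤n) Y≤y
      room : 2 ℕ.* (g ℕ.* n) ℕ.+ 6 ℕ.* D ℕ.≤ suc e ℕ.* (g ℕ.* D)
      room = ℕP.*-cancelˡ-≤ A {{ℕ.>-nonZero 1≤A}} (begin
        A ℕ.* (2 ℕ.* (g ℕ.* n) ℕ.+ 6 ℕ.* D)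
          ≡⟨ e₁ A g n D ⟩
        2 ℕ.* g ℕ.* (A ℕ.* n) ℕ.+ 6 ℕ.* A ℕ.* D
          ≤⟨ ℕP.+-monoˡ-≤ (6 ℕ.* A ℕ.* D) (ℕP.*-monoʳ-≤ (2 ℕ.* g) (ℕP.<⇒≤ above)) ⟩
        2 ℕ.* g ℕ.* (B ℕ.* (e ℕ.* (G ℕ.* suc y) ℕ.^ e)) ℕ.+ 6 ℕ.* A ℕ.* D
          ≡⟨ cong (λ z → 2 ℕ.* g ℕ.* (B ℕ.* (e ℕ.* z)) ℕ.+ 6 ℕ.* A ℕ.* D) (^-distribʳ-*ℕ G (suc y) e) ⟩
        2 ℕ.* g ℕ.* (B ℕ.* (e ℕ.* (H ℕ.* suc y ℕ.^ e))) ℕ.+ 6 ℕ.* A ℕ.* D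
          ≡⟨ cong (ℕ._+ 6 ℕ.* A ℕ.* D) (e₂ g B e H (suc y ℕ.^ e)) ⟩
        H ℕ.* (C ℕ.* suc y ℕ.^ e) ℕ.+ 6 ℕ.* A ℕ.* D
          ≤⟨ ℕP.+-monoˡ-≤ (6 ℕ.* A ℕ.* D) (ℕP.*-monoʳ-≤ H (suc^-ratio C y e
               (ℕP.≤-trans (ℕP.m≤n+m (suc C ℕ.* e) (suc (suc (suc e ℕ.* H)))) (ℕP.≤-trans Y≤y (ℕP.n≤1+n y))))) ⟩
        H ℕ.* (suc C ℕ.* y ℕ.^ e) ℕ.+ 6 ℕ.* A ℕ.* D
          ≡⟨ cong (ℕ._+ 6 ℕ.* A ℕ.* D) (trans (e₃ H C (y ℕ.^ e)) (cong (suc C ℕ.*_) (sym (^-distribʳ-*ℕ G y e)))) ⟩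
        suc C ℕ.* D ℕ.+ 6 ℕ.* A ℕ.* D
          ≡⟨ e₄ C A D ⟩
        (C ℕ.+ suc (6 ℕ.* A)) ℕ.* D
          ≤⟨ ℕP.*-monoˡ-≤ D (ℕP.+-monoʳ-≤ C 6A<g) ⟩
        (C ℕ.+ g) ℕ.* D
          ≡⟨ e₅ g (e ℕ.* B) D ⟩
        suc (2 ℕ.* (e ℕ.* B)) ℕ.* (g ℕ.* D)
          ≤⟨ ℕP.*-monoˡ-≤ (g ℕ.* D) gap ⟩
        A ℕ.* suc e ℕ.* (g ℕ.* D)
          ≡⟨ ℕP.*-assoc A (suc e) (g ℕ.* D) ⟩
        A ℕ.* (suc e ℕ.* (g ℕ.* D)) ∎)
        where
        e₁ : ∀ A g n D → A ℕ.* (2 ℕ.* (g ℕ.* n) ℕ.+ 6 ℕ.* D) ≡ 2 ℕ.* g ℕ.* (A ℕ.* n) ℕ.+ 6 ℕ.* A ℕ.* D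
        e₁ = ℕ-solve-∀
        e₂ : ∀ g B e H z → 2 ℕ.* g ℕ.* (B ℕ.* (e ℕ.* (H ℕ.* z))) ≡ H ℕ.* (2 ℕ.* (g ℕ.* (e ℕ.* B)) ℕ.* z)
        e₂ = ℕ-solve-∀
        e₃ : ∀ H C z → H ℕ.* (suc C ℕ.* z) ≡ suc C ℕ.* (H ℕ.* z)
        e₃ = ℕ-solve-∀
        e₄ : ∀ C A D → suc C ℕ.* D ℕ.+ 6 ℕ.* A ℕ.* D ≡ (C ℕ.+ suc (6 ℕ.* A)) ℕ.* D
        e₄ = ℕ-solve-∀
        e₅ : ∀ g b D → (2 ℕ.* (g ℕ.* b) ℕ.+ g) ℕ.* D ≡ suc (2 ℕ.* b) ℕ.* (g ℕ.* D)
        e₅ = ℕ-solve-∀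
      n≤kD : n ℕ.≤ suc e ℕ.* D
      n≤kD = ℕP.*-cancelˡ-≤ g {{ℕ.>-nonZero 1≤g}} (begin
        g ℕ.* n                               ≤⟨ ℕP.m≤n*m (g ℕ.* n) 2 ⟩
        2 ℕ.* (g ℕ.* n)                       ≤⟨ ℕP.m≤m+n _ (6 ℕ.* D) ⟩
        2 ℕ.* (g ℕ.* n) ℕ.+ 6 ℕ.* D           ≤⟨ room ⟩
        suc e ℕ.* (g ℕ.* D)                   ≡⟨ e₁ (suc e) g D ⟩
        g ℕ.* (suc e ℕ.* D)                   ∎)
        where
        e₁ : ∀ k g D → k ℕ.* (g ℕ.* D) ≡ g ℕ.* (k ℕ.* D)
        e₁ = ℕ-solve-∀
      large : suc (suc n) ℕ.≤ y ℕ.^ g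
      large = begin
        2 ℕ.+ n                                          ≤⟨ ℕP.+-mono-≤ {2} {2 ℕ.* y ℕ.^ e}
                                                              (ℕP.m≤m*n 2 (y ℕ.^ e) {{ℕ.>-nonZero (1≤^ℕ e 1≤y)}}) n≤kD ⟩
        2 ℕ.* y ℕ.^ e ℕ.+ suc e ℕ.* D                    ≡⟨ cong (λ z → 2 ℕ.* y ℕ.^ e ℕ.+ suc e ℕ.* z) (^-distribʳ-*ℕ G y e) ⟩
        2 ℕ.* y ℕ.^ e ℕ.+ suc e ℕ.* (H ℕ.* y ℕ.^ e)      ≡⟨ e₁ (suc e) H (y ℕ.^ e) ⟩
        suc (suc (suc e ℕ.* H)) ℕ.* y ℕ.^ e              ≤⟨ ℕP.*-monoˡ-≤ (y ℕ.^ e) (ℕP.≤-trans (ℕP.m≤m+n _ (suc C ℕ.* e)) Y≤y) ⟩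
        y ℕ.^ suc e                                      ≤⟨ ℕP.^-monoʳ-≤ y {{ℕ.>-nonZero 1≤y}} k≤g ⟩
        y ℕ.^ g                                          ∎
        where
        e₁ : ∀ k H z → 2 ℕ.* z ℕ.+ k ℕ.* (H ℕ.* z) ≡ suc (suc (k ℕ.* H)) ℕ.* z
        e₁ = ℕ-solve-∀

  /1≡×ℚ1 : ∀ m → + m / 1 ≡ m ×ℚ 1ℚ
  /1≡×ℚ1 m = toℚᵘ-injective (ℚᵘP.≃-trans (toℚᵘ-fromℚᵘ (ℚᵘ.mkℚᵘ (+ m) 0)) (ℚᵘP.≃-sym (toℚᵘ-×ℚ1 m)))

  ×ℚ1-*-/ : ∀ k m → (suc k ×ℚ 1ℚ) * (+ m / suc k) ≡ m ×ℚ 1ℚ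
  ×ℚ1-*-/ k m = toℚᵘ-injective (begin
    toℚᵘ ((suc k ×ℚ 1ℚ) * (+ m / suc k))                    ≈⟨ toℚᵘ-homo-* (suc k ×ℚ 1ℚ) (+ m / suc k) ⟩
    toℚᵘ (suc k ×ℚ 1ℚ) ℚᵘ.* toℚᵘ (+ m / suc k)              ≈⟨ ℚᵘP.*-cong (toℚᵘ-×ℚ1 (suc k)) (toℚᵘ-fromℚᵘ (ℚᵘ.mkℚᵘ (+ m) k)) ⟩
    ℚᵘ.mkℚᵘ (+ suc k) 0 ℚᵘ.* ℚᵘ.mkℚᵘ (+ m) k                ≈⟨ ℚᵘ.*≡* (cross (+ suc k) (+ m)) ⟩
    ℚᵘ.mkℚᵘ (+ m) 0                                         ≈⟨ ℚᵘP.≃-sym (toℚᵘ-×ℚ1 m) ⟩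
    toℚᵘ (m ×ℚ 1ℚ)                                          ∎)
    where
    open ℚᵘP.≃-Reasoning
    cross : ∀ a b → a ℤ.* b ℤ.* + 1 ≡ b ℤ.* (+ 1 ℤ.* a)
    cross a b = trans (ℤP.*-identityʳ (a ℤ.* b)) (trans (ℤP.*-comm a b) (cong (b ℤ.*_) (sym (ℤP.*-identityˡ a))))

  open RootApprox using (value; nonNeg; above)

  -- By `above`, the approximation plus its mesh overshoots the true root and hence q; the mesh is
  -- then absorbed by ε.
  ≤ᴿ-root : ∀ d x q → ∃[ N ] (∀ j → N ℕ.≤ j → q ^ suc d ≤ seq x j) → fromℚ q ≤ᴿ root (suc d) x
  ≤ᴿ-root d x q (N₁ , below) ε 0<ε = N₁ ℕ.⊔ proj₁ small , λ j hj →
    at j (below j (ℕP.m⊔n≤o⇒m≤o N₁ (proj₁ small) hj)) (proj₂ small j (ℕP.m⊔n≤o⇒n≤o N₁ (proj₁ small) hj))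
    where
    small : ∃[ N ] (∀ j → N ℕ.≤ j → mesh j ≤ ε)
    small = mesh-small ε 0<ε
    at : ∀ j → q ^ suc d ≤ seq x j → mesh j ≤ ε → q ≤ value (rootApproxᴿ d x j) + ε
    at j h mesh≤ε = by-cases (q ≤? z)
      where
      open ≤-Reasoning
      z : ℚ
      z = value (rootApproxᴿ d x j) + mesh j
      0≤z : 0ℚ ≤ z
      0≤z = 0≤+ (nonNeg (rootApproxᴿ d x j)) (<⇒≤ (0<mesh j))
      q^<z^ : q ^ suc d < z ^ suc d
      q^<z^ = ≤-<-trans h (≤-<-trans (p≤p⊔q (seq x j) 0ℚ) (above (rootApproxᴿ d x j)))
      by-cases : Dec (q ≤ z) → q ≤ value (rootApproxᴿ d x j) + ε
      by-cases (yes p) = ≤-trans p (+-monoʳ-≤ (value (rootApproxᴿ d x j)) mesh≤ε)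
      by-cases (no ¬p) = contradiction (<-≤-trans q^<z^ (^-mono-≤ (suc d) 0≤z (<⇒≤ (≰⇒> ¬p)))) (<-irrefl refl)

  module Affordable (r Δ n A B : ℕ) (1≤B : 1 ℕ.≤ B) (scale : B ℕ.* (suc r ℕ.* Δ ℕ.^ suc r) ℕ.≤ A ℕ.* n)
    (β : ℝ) {b : ℚ} (0≤b : 0ℚ ≤ b) (A≤Bb : A ×ℚ 1ℚ ≤ (B ×ℚ 1ℚ) * b) {N : ℕ} (b≤β : ∀ j → N ℕ.≤ j → b ≤ seq β j) where

    e Q X : ℕ
    e = suc r
    Q = e ℕ.* Δ ℕ.^ r
    X = e ℕ.* Δ ℕ.^ e

    private
      ι : ℕ → ℚ
      ι m = m ×ℚ 1ℚ

    0<B : 0ℚ < ι B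
    0<B = <-≤-trans 0<1 (≤-trans (≤-reflexive (sym (+-identityˡ 1ℚ))) (×ℚ-mono-≤ {1} (<⇒≤ 0<1) 1≤B))

    0≤ι : ∀ m → 0ℚ ≤ ι m
    0≤ι m = 0≤×ℚ m (<⇒≤ 0<1)

    X≤bn : ι X ≤ b * ι n
    X≤bn = *-cancelˡ-≤-pos (ι B) {{positive 0<B}} (begin
      ι B * ι X          ≡⟨ sym (×ℚ-homo-* B X) ⟩
      ι (B ℕ.* X)        ≤⟨ ×ℚ-mono-≤ (<⇒≤ 0<1) scale ⟩
      ι (A ℕ.* n)        ≡⟨ ×ℚ-homo-* A n ⟩
      ι A * ι n          ≤⟨ *-monoˡ-≤₀ (ι n) (0≤ι n) A≤Bb ⟩
      ι B * b * ι n      ≡⟨ *-assoc (ι B) b (ι n) ⟩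
      ι B * (b * ι n)    ∎)
      where open ≤-Reasoning

    -- This identity explains the form of q(n): with r = k - 2, the budget satisfies Q^(k-1) = (k-1)
    -- X^(k-2), so X ≤ β n gives Q ≤ q(n).
    Q^e≡ : Q ℕ.^ e ≡ e ℕ.* X ℕ.^ r
    Q^e≡ = begin
      Q ℕ.^ e                                          ≡⟨ ^-distribʳ-*ℕ e (Δ ℕ.^ r) e ⟩
      e ℕ.* e ℕ.^ r ℕ.* (Δ ℕ.^ r) ℕ.^ e                ≡⟨ cong (e ℕ.* e ℕ.^ r ℕ.*_) (trans (ℕP.^-*-assoc Δ r e)
                                                            (trans (cong (Δ ℕ.^_) (ℕP.*-comm r e)) (sym (ℕP.^-*-assoc Δ e r)))) ⟩
      e ℕ.* e ℕ.^ r ℕ.* (Δ ℕ.^ e) ℕ.^ r                ≡⟨ ℕP.*-assoc e (e ℕ.^ r) _ ⟩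
      e ℕ.* (e ℕ.^ r ℕ.* (Δ ℕ.^ e) ℕ.^ r)              ≡⟨ cong (e ℕ.*_) (sym (^-distribʳ-*ℕ e (Δ ℕ.^ e) r)) ⟩
      e ℕ.* X ℕ.^ r                                    ∎
      where open ≡-Reasoning

    x : ℝ
    x = fromℕ e *ᴿ β ^ᴿ r *ᴿ fromℕ n ^ᴿ r

    below : ∀ j → N ℕ.≤ j → ∀ q → q ℕ.≤ Q → (+ q / 1) ^ e ≤ seq x j
    below j N≤j q q≤Q = begin
      (+ q / 1) ^ e                            ≡⟨ cong (_^ e) (/1≡×ℚ1 q) ⟩
      ι q ^ e                                  ≤⟨ ^-mono-≤ e (0≤ι q) (×ℚ-mono-≤ (<⇒≤ 0<1) q≤Q) ⟩
      ι Q ^ e                                  ≡⟨ sym (×ℚ-homo-^ Q e) ⟩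
      ι (Q ℕ.^ e)                              ≡⟨ cong ι Q^e≡ ⟩
      ι (e ℕ.* X ℕ.^ r)                        ≡⟨ trans (×ℚ-homo-* e (X ℕ.^ r)) (cong (ι e *_) (×ℚ-homo-^ X r)) ⟩
      ι e * ι X ^ r                            ≤⟨ *-monoʳ-≤₀ (ι e) (0≤ι e) (^-mono-≤ r (0≤ι X) X≤bn) ⟩
      ι e * (b * ι n) ^ r                      ≤⟨ *-monoʳ-≤₀ (ι e) (0≤ι e) (^-mono-≤ r (0≤* 0≤b (0≤ι n))
                                                    (*-monoˡ-≤₀ (ι n) (0≤ι n) (b≤β j N≤j))) ⟩
      ι e * (seq β j * ι n) ^ r                ≡⟨ cong (ι e *_) (^-distribʳ-* (seq β j) (ι n) r) ⟩
      ι e * (seq β j ^ r * ι n ^ r)            ≡⟨ sym (*-assoc (ι e) _ _) ⟩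
      ι e * seq β j ^ r * ι n ^ r              ≡⟨ cong₂ _*_ (cong₂ _*_ (sym (/1≡×ℚ1 e)) (sym (seq-^ β r j)))
                                                    (trans (cong (_^ r) (sym (/1≡×ℚ1 n))) (sym (seq-^ (fromℕ n) r j))) ⟩
      seq x j                                  ∎
      where open ≤-Reasoning

    affordable : ∀ q → q ℕ.≤ Q → fromℕ q ≤ᴿ root e x
    affordable q q≤Q = ≤ᴿ-root r x (+ q / 1) (N , λ j N≤j → below j N≤j q q≤Q)

  -- (m w + 1) / ((k + 1) w) exceeds m / (k + 1) by 1 / ((k + 1) w), which is at most ε for large w.
  rational-between : ∀ m k {b ε} → 0ℚ < ε → b ≡ + m / suc k + ε → ∃[ w ] (1 ℕ.≤ w ×
    suc (m ℕ.* w) ×ℚ 1ℚ ≤ ((suc k ℕ.* w) ×ℚ 1ℚ) * b)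
  rational-between m k {b} {ε} 0<ε refl with archimedean 1ℚ 0<ε
  ... | zero  , 1<0 = contradiction (<-trans 0<1 1<0) (<-irrefl refl)
  ... | suc w , 1<w = suc w , s≤s z≤n , (begin
      (m ℕ.* W) ×ℚ 1ℚ + 1ℚ                       ≤⟨ +-monoʳ-≤ ((m ℕ.* W) ×ℚ 1ℚ) (≤-trans (<⇒≤ 1<w) (×ℚ-mono-≤ (<⇒≤ 0<ε) (ℕP.m≤n*m W (suc k)))) ⟩
      (m ℕ.* W) ×ℚ 1ℚ + (suc k ℕ.* W) ×ℚ ε       ≡⟨ cong₂ _+_ left right ⟩
      B * (+ m / suc k) + B * ε                  ≡⟨ sym (*-distribˡ-+ B (+ m / suc k) ε) ⟩
      B * (+ m / suc k + ε)                      ∎)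
    where
    open ≤-Reasoning
    W : ℕ
    W = suc w
    B : ℚ
    B = (suc k ℕ.* W) ×ℚ 1ℚ
    left : (m ℕ.* W) ×ℚ 1ℚ ≡ B * (+ m / suc k)
    left = sym (begin-equality
      B * (+ m / suc k)                                        ≡⟨ cong (_* (+ m / suc k)) (×ℚ-homo-* (suc k) W) ⟩
      (suc k ×ℚ 1ℚ) * (W ×ℚ 1ℚ) * (+ m / suc k)                ≡⟨ e (suc k ×ℚ 1ℚ) (W ×ℚ 1ℚ) (+ m / suc k) ⟩
      (suc k ×ℚ 1ℚ) * (+ m / suc k) * (W ×ℚ 1ℚ)                ≡⟨ cong (_* (W ×ℚ 1ℚ)) (×ℚ1-*-/ k m) ⟩
      (m ×ℚ 1ℚ) * (W ×ℚ 1ℚ)                                    ≡⟨ sym (×ℚ-homo-* m W) ⟩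
      (m ℕ.* W) ×ℚ 1ℚ                                          ∎)
      where
      e : ∀ a b c → a * b * c ≡ a * c * b
      e = solve-∀ ℚ-ring
    right : (suc k ℕ.* W) ×ℚ ε ≡ B * ε
    right = sym (trans (×ℚ-*ˡ (suc k ℕ.* W) 1ℚ ε) (cong ((suc k ℕ.* W) ×ℚ_) (*-identityˡ ε)))

  module Final (ρ : ℕ) (β : ℝ) {ε : ℚ} (0<ε : 0ℚ < ε) {N : ℕ}
    (β-above : ∀ j → N ℕ.≤ j → + (2 ℕ.* suc (suc ρ)) / suc (suc (suc ρ)) + ε ≤ seq β j) where

    e k m : ℕ
    e = suc (suc ρ)
    k = suc e
    m = 2 ℕ.* e

    b : ℚ
    b = + m / k + ε

    module _ (w : ℕ) (1≤w : 1 ℕ.≤ w) (A≤Bb : suc (m ℕ.* w) ×ℚ 1ℚ ≤ ((k ℕ.* w) ×ℚ 1ℚ) * b) where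

      A B g R G : ℕ
      A = suc (m ℕ.* w)
      B = k ℕ.* w
      -- Exceeding 6 A lets the loss 6 D fit into the unit by which A k exceeds 2 e B. The summand k
      -- gives g ≥ 3, and y^g ≥ y^k for the comparison with n.
      g = suc (6 ℕ.* A) ℕ.+ k
      R = 3 ℕ.* (e ℕ.* e ℕ.* (g ℕ.* g))
      G = g ℕ.* R

      1≤B : 1 ℕ.≤ B
      1≤B = 1≤*ℕ {k} (s≤s z≤n) 1≤w

      1≤g : 1 ℕ.≤ g
      1≤g = s≤s z≤n

      1≤G : 1 ℕ.≤ G
      1≤G = 1≤*ℕ 1≤g (1≤*ℕ {3} (s≤s z≤n) (1≤*ℕ {e ℕ.* e} (s≤s z≤n) (1≤*ℕ 1≤g 1≤g)))

      0≤b : 0ℚ ≤ b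
      0≤b = *-cancelˡ-≤-pos ((k ℕ.* w) ×ℚ 1ℚ) {{positive (<-≤-trans 0<1 (≤-trans (≤-reflexive (sym (+-identityˡ 1ℚ)))
              (×ℚ-mono-≤ {1} (<⇒≤ 0<1) 1≤B)))}}
        (≤-trans (≤-reflexive (*-zeroʳ ((k ℕ.* w) ×ℚ 1ℚ))) (≤-trans (0≤×ℚ A (<⇒≤ 0<1)) A≤Bb))

      gap : suc (2 ℕ.* (e ℕ.* B)) ℕ.≤ A ℕ.* k
      gap = ℕP.≤-trans (s≤s (ℕP.m≤m+n (2 ℕ.* (e ℕ.* B)) e)) (ℕP.≤-reflexive (e₁ e w))
        where
        e₁ : ∀ e w → suc (2 ℕ.* (e ℕ.* (suc e ℕ.* w)) ℕ.+ e) ≡ suc (2 ℕ.* e ℕ.* w) ℕ.* suc e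
        e₁ = ℕ-solve-∀

      scaled : ∀ n y → Scale e g G A B n y → BreakerWins k n (bias k β n)
      scaled n y (1≤y , room , large , cheap) = breaker-wins n ρ g y 3≤g 1≤y
        (subst (λ z → 2 ℕ.* (g ℕ.* n) ℕ.+ 6 ℕ.* z ℕ.^ e ℕ.≤ k ℕ.* (g ℕ.* z ℕ.^ e)) (ℕP.*-assoc g R y) room)
        large (bias k β n)
        (Affordable.affordable (suc ρ) (g ℕ.* (R ℕ.* y)) n A B 1≤B
          (subst (λ z → B ℕ.* (e ℕ.* z ℕ.^ e) ℕ.≤ A ℕ.* n) (ℕP.*-assoc g R y) cheap) β 0≤b A≤Bb β-above)
        where
        open Parameters using (breaker-wins)
        3≤g : 3 ℕ.≤ g
        3≤g = ℕP.≤-trans (s≤s (s≤s (s≤s z≤n))) (ℕP.m≤n+m k (suc (6 ℕ.* A)))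

      threshold : ∃[ N′ ] (∀ n → N′ ℕ.< n → BreakerWins k n (bias k β n))
      threshold = from-scale (scale-exists (suc ρ) g G A B 1≤G (s≤s z≤n) 1≤B (ℕP.m≤m+n (suc (6 ℕ.* A)) k) (ℕP.m≤n+m k (suc (6 ℕ.* A))) gap)
        where
        from-scale : ∃[ N′ ] (∀ n → N′ ℕ.< n → ∃ (Scale e g G A B n)) → ∃[ N′ ] (∀ n → N′ ℕ.< n → BreakerWins k n (bias k β n))
        from-scale (N′ , h) = N′ , λ n N′<n → scaled n (proj₁ (h n N′<n)) (proj₂ (h n N′<n))

    breaker-threshold : ∃[ N′ ] (∀ n → N′ ℕ.< n → BreakerWins k n (bias k β n))
    breaker-threshold = from-rational (rational-between m e 0<ε refl)
      where
      from-rational : ∃[ w ] (1 ℕ.≤ w × suc (m ℕ.* w) ×ℚ 1ℚ ≤ ((k ℕ.* w) ×ℚ 1ℚ) * b) →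
                      ∃[ N′ ] (∀ n → N′ ℕ.< n → BreakerWins k n (bias k β n))
      from-rational (w , 1≤w , h) = threshold w 1≤w h

open Thresholds

open import Data.Integer using (+_)
open import Data.Nat using (_*_; _≤_; _<_)
open import Data.Rational using (_/_)

theorem3p1 : (k : ℕ) .{{_ : NonZero k}} → 3 ≤ k →
    (β : ℝ) → fromℚ (+ (2 * (k ∸ 1)) / k) <ᴿ β →
    ∃[ N ] (∀ n → N < n → BreakerWins k n (bias k β n))
theorem3p1 (suc (suc (suc ρ))) (s≤s (s≤s (s≤s _))) β (ε , 0<ε , N , β-above) =
  Final.breaker-threshold ρ β 0<ε β-above
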